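{- Let $i\in[n]$, let $f,s_if,fs_i,s_ifs_i\in\mathbf{B}_{k,n}$ with $fs_i>f$, and let $P\in\mathcal{P}_{k,n}$ with $P_i=\mathrm U$ and $P_{i+1}=\mathrm R$ (so $s_iP\in\mathcal{P}_{k,n}$). Then for every $r$ there are bijections $$\mathcal{A}^r_{f,P}\cong\begin{cases}\mathcal{A}^r_{s_ifs_i,\,s_iP}, & s_if<f;\\ \mathcal{A}^{r-1}_{fs_i,\,s_iP}\sqcup\mathcal{A}^r_{s_ifs_i,\,s_iP}, & s_if>f.\end{cases}$$
   Context: Let $n\ge 2$, $0\le k\le n$, $[n]=\{1,\dots,n\}$. An $n$-periodic affine permutation is a bijection $f:\mathbb{Z}\to\mathbb{Z}$ with $f(i+n)=f(i)+n$ for all $i$. Products are read left to right: $(fg)(a)=g(f(a))$. $\mathbf{B}_{k,n}$ is the set of those with $\frac1n\sum_{i=1}^n(f(i)-i)=k$ and $i\le f(i)\le i+n$ for all $i$. Length: $\ell(f)=\#\{(a,b): a\in[n],\,b\in\mathbb{Z},\,a<b,\,f(a)>f(b)\}$. $s_i$ exchanges $i+mn$ and $i+1+mn$ for all $m$ and fixes all other integers. $fs_i>f$ means $\ell(fs_i)>\ell(f)$, and similarly for the other comparisons. Lattice paths: $\mathcal{P}_{k,n}$ is the set of lattice paths $P$ from $(0,0)$ to $(n-k,k)$ with unit steps $P_1,\dots,P_n\in\{\mathrm R,\mathrm U\}$; $s_iP$ is obtained by swapping $P_i$ and $P_{i+1}$, indices modulo $n$. Extend $P$ to a bi-infinite path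 with steps indexed by $\mathbb{Z}$ via $P_{i+n}=P_i$ (step $1$ starts at $(0,0)$), invariant under translation by $(n-k,k)$. The strip of $P$ is the region between the extended path $P$ (southern boundary) and $P+(0,k)$ (northern boundary). The southern edge labeled $i\in\mathbb{Z}$ is step $i$ of $P$, and the northern edge labeled $i$ is its translate by $(0,k)$. A periodic filling assigns to each unit box of the strip a crossing or an elbow, invariantly under translation by $(n-k,k)$. Strands enter at northern edges and travel right/down: in a crossing, left goes to right and top goes to bottom; in an elbow, a strand entering from the left exits at the bottom and one entering from the top exits right. The strand permutation sends $i$ to $j$ if the strand entering at northern edge $i$ exits at southern edge $j$. An $(f,P)$-affine Deogram is a periodic filling with strand permutation $f$ such that whenever two strands form an elbow, they have crossed each other an even number of times before it (counting from the northern boundary). $\mathcal{A}^r_{f,P}$ is the set of $(f,P)$-affine Deograms with exactly $r$ elbows modulo translation by $(n-k,k)$ (equivalently, distinguished $f$-subwords, with exactly $r$ unselected letters, of the reduced word obtained by reading the boxes of the strip from northwest to southeast); $\mathcal{A}^{r}_{f,P}=\varnothing$ for $r<0$. -}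

module Defs where

import Algebra.Properties.CommutativeMonoid.Sum
open import Data.Bool using (if_then_else_)
open import Data.Fin using (Fin; toℕ; fromℕ<)
open import Data.Fin.Permutation using (transpose; _⟨$⟩ʳ_)
open import Data.Integer using (ℤ; +_; -[1+_]; 0ℤ; 1ℤ; _+_; _-_; _≤_; _<_; pred; suc; _≟_)
open import Data.Integer.Divisibility.Signed using (_∣?_)
open import Data.Integer.DivMod using (_%ℕ_; n%ℕd<d)
open import Data.Integer.Properties using (+-0-commutativeMonoid)
open import Data.List using (List; []; _∷_; filter; length)
open import Data.List.Membership.DecPropositional using () renaming (_∈?_ to member?)
open import Data.Nat as ℕ using (ℕ; NonTrivial; NonZero; nonTrivial⇒nonZero)
open import Data.Nat.Divisibility using (_∣_)
open import Data.Product using (Σ-syntax; ∃₂; ∃-syntax; _×_; _,_)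
open import Data.Product.Properties using (≡-dec)
import Data.Rational as ℚ
open import Data.Vec.Functional using (Vector)
open import Function using (_∘_; _↔_; Bijective)
open import Level using (0ℓ)
open import Relation.Binary.Bundles using (Setoid)
open import Relation.Binary.Construct.Closure.ReflexiveTransitive using (Star; ε; _◅_)
open import Relation.Binary.Definitions using (DecidableEquality)
open import Relation.Binary.PropositionalEquality using (_≡_; refl; sym; trans)
open import Relation.Nullary using (does)

module Sumℤ = Algebra.Properties.CommutativeMonoid.Sum +-0-commutativeMonoid
open Sumℤ using (sum; sum-syntax; sum-permute)

HasCardinality : Set → ℕ → Set
HasCardinality A m = A ↔ Fin m

Point : Set
Point = ℤ × ℤ

infixl 6 _⊕_ _⊖_

_⊕_ _⊖_ : Point → Point → Point
(x , y) ⊕ (x′ , y′) = x + x′ , y + y′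
(x , y) ⊖ (x′ , y′) = x - x′ , y - y′

_≟ₚ_ : DecidableEquality Point
_≟ₚ_ = ≡-dec _≟_ _≟_

data Step : Set where
  R U : Step

dx dy : Step → ℤ
dx R = 1ℤ
dx U = 0ℤ
dy R = 0ℤ
dy U = 1ℤ

direction : Step → Point
direction s = dx s , dy s

-- A unit edge is given by its left or lower endpoint and its direction.
Edge : Set
Edge = Point × Step

data Tile : Set where
  crossing elbow : Tile

data Entry : Set where
  fromLeft fromTop : Entry

data Exit : Set where
  toRight toBottom : Exit

route : Tile → Entry → Exit
route crossing fromLeft = toRight
route crossing fromTop  = toBottom
route elbow    fromLeft = toBottom
route elbow    fromTop  = toRight

-- Products are read left to right.
infixl 7 _·_

_·_ : (ℤ → ℤ) → (ℤ → ℤ) → (ℤ → ℤ)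
(f · g) a = g (f a)

module Periodic (n : ℕ) .{{_ : NonTrivial n}} where

  private instance
    n≢0 : NonZero n
    n≢0 = nonTrivial⇒nonZero n

  infix 4 _∈[n]
  _∈[n] : ℤ → Set
  a ∈[n] = 1ℤ ≤ a × a ≤ + n

  record IsAffinePermutation (f : ℤ → ℤ) : Set where
    field
      bijective : Bijective _≡_ _≡_ f
      periodic  : ∀ a → f (a + + n) ≡ f a + + n

  -- In the sum, the index a : Fin n stands for the integer toℕ a + 1.
  record 𝐁 (k : ℕ) (f : ℤ → ℤ) : Set where
    field
      isAffinePermutation : IsAffinePermutation f
      average : (∑[ a < n ] (f (suc (+ toℕ a)) - suc (+ toℕ a))) ℚ./ n ≡ (+ k) ℚ./ 1
      bounded : ∀ a → a ≤ f a × f a ≤ a + + n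

  s : ℤ → ℤ → ℤ
  s i a = if does (+ n ∣? (a - i)) then suc a
          else if does (+ n ∣? (a - suc i)) then pred a
          else a

  Inversion : (ℤ → ℤ) → Set
  Inversion f = Σ[ (a , b) ∈ ℤ × ℤ ] (a ∈[n] × a < b × f b < f a)

  -- The length ℓ(f), as a relation: HasLength f m says ℓ(f) = m.
  HasLength : (ℤ → ℤ) → ℕ → Set
  HasLength f = HasCardinality (Inversion f)

  infix 4 _≺_ _≻_
  _≺_ _≻_ : (ℤ → ℤ) → (ℤ → ℤ) → Set
  f ≺ g = ∃₂ λ l m → HasLength f l × HasLength g m × l ℕ.< m
  f ≻ g = g ≺ f

  record 𝒫 (k : ℕ) : Set where
    field
      step : Vector Step n
      endX : sum (dx ∘ step) ≡ + n - + k
      endY : sum (dy ∘ step) ≡ + k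

  -- Steps are numbered from 1, so index 1 is the element zero of Fin n.
  index : ℤ → Fin n
  index j = fromℕ< (n%ℕd<d (pred j) n)

  infix 9 _⟦_⟧
  _⟦_⟧ : ∀ {k} → 𝒫 k → ℤ → Step
  P ⟦ j ⟧ = 𝒫.step P (index j)

  swap : ∀ {k} → ℤ → 𝒫 k → 𝒫 k
  swap i P = record
    { step = step ∘ (τ ⟨$⟩ʳ_)
    ; endX = trans (sym (sum-permute (dx ∘ step) τ)) endX
    ; endY = trans (sym (sum-permute (dy ∘ step) τ)) endY
    }
    where
    open 𝒫 P
    τ = transpose (index i) (index (suc i))

  module _ {k : ℕ} (P : 𝒫 k) where

    -- Step j of the extended path goes from vertex (pred j) to vertex j.
    vertex : ℤ → Point
    vertex (+ ℕ.zero)      = 0ℤ , 0ℤ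
    vertex (+ ℕ.suc m)     = vertex (+ m) ⊕ direction (P ⟦ + ℕ.suc m ⟧)
    vertex -[1+ ℕ.zero ]   = (0ℤ , 0ℤ) ⊖ direction (P ⟦ 0ℤ ⟧)
    vertex -[1+ ℕ.suc m ]  = vertex -[1+ m ] ⊖ direction (P ⟦ -[1+ m ] ⟧)

    south north : ℤ → Edge
    south j = vertex (pred j) , P ⟦ j ⟧
    north j = vertex (pred j) ⊕ (0ℤ , + k) , P ⟦ j ⟧

    -- The unit boxes of the strip lying in one vertical column are the k
    -- boxes stacked between a horizontal southern edge and its translate
    -- by (0 , k).  A box is given by the label of that southern edge and
    -- by its height above it.
    record Box : Set where
      constructor box
      field
        column      : ℤ
        .horizontal : P ⟦ column ⟧ ≡ R
        height      : Fin k

      corner : Point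
      corner = vertex (pred column) ⊕ (0ℤ , + toℕ height)

    open Box

    entry : Box → Entry → Edge
    entry b fromLeft = corner b , U
    entry b fromTop  = corner b ⊕ (0ℤ , 1ℤ) , R

    exit : Box → Exit → Edge
    exit b toRight  = corner b ⊕ (1ℤ , 0ℤ) , U
    exit b toBottom = corner b , R

    record Filling : Set where
      field
        tile     : Box → Tile
        periodic : ∀ b b′ → corner b′ ≡ corner b ⊕ (+ n - + k , + k) → tile b′ ≡ tile b

  module _ {k : ℕ} {P : 𝒫 k} (F : Filling P) where

    open Filling F

    data Pass : Edge → Edge → Set where
      pass : (b : Box P) (e : Entry) → Pass (entry P b e) (exit P b (route (tile b) e))

    Strand : Edge → Edge → Set
    Strand = Star Pass

    recordCrossing : Box P → Tile → List Point → List Point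
    recordCrossing b crossing bs = Box.corner b ∷ bs
    recordCrossing b elbow    bs = bs

    -- The crossings (named by their lower left corners) along a strand.
    crossings : ∀ {e e′} → Strand e e′ → List Point
    crossings ε             = []
    crossings (pass b _ ◅ t) = recordCrossing b (tile b) (crossings t)

    -- Two distinct strands cross exactly in the crossings they both pass.
    commonCrossings : ∀ {e₁ e₁′ e₂ e₂′} → Strand e₁ e₁′ → Strand e₂ e₂′ → ℕ
    commonCrossings t₁ t₂ =
      length (filter (λ p → member? _≟ₚ_ p (crossings t₂)) (crossings t₁))

    HasStrandPermutation : (ℤ → ℤ) → Set
    HasStrandPermutation f = ∀ i → Strand (north P i) (south P (f i))

    Distinguished : Set
    Distinguished = ∀ b → tile b ≡ elbow →
      ∀ i j (t : Strand (north P i) (entry P b fromLeft))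
            (u : Strand (north P j) (entry P b fromTop)) →
      2 ∣ commonCrossings t u

    -- Translation by (n - k , k) adds n to column labels, so the columns
    -- labelled 1 , … , n form a system of representatives.
    ElbowModTranslation : Set
    ElbowModTranslation = Σ[ b ∈ Box P ] (Box.column b ∈[n] × tile b ≡ elbow)

  record Deogram {k : ℕ} (r : ℤ) (f : ℤ → ℤ) (P : 𝒫 k) : Set where
    field
      filling           : Filling P
      strandPermutation : HasStrandPermutation filling f
      distinguished     : Distinguished filling
      elbows            : ∃[ m ] (+ m ≡ r × HasCardinality (ElbowModTranslation filling) m)

    open Filling filling public

  -- Deograms are equal when their fillings are.
  𝒜 : {k : ℕ} → ℤ → (ℤ → ℤ) → 𝒫 k → Setoid 0ℓ 0ℓ
  𝒜 r f P = record
    { Carrier       = Deogram r f P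
    ; _≈_           = λ D E → ∀ b → Deogram.tile D b ≡ Deogram.tile E b
    ; isEquivalence = record
      { refl  = λ b → refl
      ; sym   = λ p b → sym (p b)
      ; trans = λ p q b → trans (p b) (q b)
      }
    }

{-# OPTIONS --safe #-}
module Submission where

-- Read the boxes of the strip modulo translation as a word of simple reflections, keeping track of the label
-- of the strand at each position of the moving path. Two strands have crossed an odd number of times exactly
-- when their labels are inverted, so a filling is distinguished iff at each elbow the label on the left is the
-- smaller one. Replacing P by s_i P deletes the first letter N of the word and appends a letter S at the end.
--
-- The strands i and i + 1 leave N with the same pair of paths whatever the tile of N is, and likewise at each
-- of their later meetings; no other strand can tell the two apart by order. Hence the tiles c_0 (at N), c_1, …,
-- c_m at their meetings may be shifted: the new filling has c_0, …, c_{m-1} at the last m meetings. The tile c_m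
-- left over decides the case, an elbow being possible only if f i < f (i + 1): an elbow gives the permutation
-- f s_i, with one elbow less, and a crossing gives s_i f s_i. Since f s_i > f, the tile at S must be a crossing.

open import Defs
open Sumℤ using (sum)
import Algebra.Properties.AbelianGroup
open import Axiom.UniquenessOfIdentityProofs using (module Decidable⇒UIP)
open import Data.Bool using (Bool; true; false; if_then_else_; not)
open import Data.Empty using (⊥; ⊥-elim)
open import Data.Fin using (Fin; toℕ; fromℕ<)
import Data.Fin.Permutation.Components as PC
open import Data.Fin.Permutation using (↔⇒≡)
import Data.Fin.Properties as Finₚ
open import Data.Integer using (ℤ; +_; -[1+_]; 0ℤ; 1ℤ; -1ℤ; _+_; _-_; _*_; -_; _≤_; _<_; pred; suc; _≟_; -≤+; +≤+; +<+; ∣_∣)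
open import Data.Integer.Divisibility.Signed using (divides; _∣?_) renaming (_∣_ to _∣ℤ_)
open import Data.Integer.DivMod using (_%ℕ_; _/ℕ_; n%ℕd<d; a≡a%ℕn+[a/ℕn]*n)
import Data.Integer.Properties as ℤₚ
open import Data.Integer.Properties using () renaming (suc[i]≤j⇒i<j to ⇒<; i<j⇒suc[i]≤j to <⇒)
open import Data.Integer.Tactic.RingSolver using (solve-∀)
open import Data.List using (List; []; _∷_; filter; length)
open import Data.List.Membership.DecPropositional using () renaming (_∈?_ to member?)
open import Data.List.Membership.Propositional using (_∈_; _∉_)
open import Data.List.Properties using (filter-accept; filter-reject)
open import Data.List.Relation.Unary.All as All using (All; []; _∷_)
open import Data.List.Relation.Unary.Any using (here; there)
open import Data.Nat as ℕ using (ℕ; NonTrivial; NonZero; nonTrivial⇒nonZero)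
import Data.Nat.Divisibility as ℕ∣
open import Data.Nat.Divisibility using () renaming (_∣_ to _∣ℕ_)
import Data.Nat.DivMod as ℕ%
import Data.Nat.Properties as ℕₚ
open import Data.Product using (Σ-syntax; ∃; ∃₂; ∃-syntax; _×_; _,_; proj₁; proj₂)
open import Data.Sum using (_⊎_; inj₁; inj₂; [_,_]′)
open import Data.Sum.Function.Propositional using (_⊎-↔_)
open import Data.Sum.Relation.Binary.Pointwise using (_⊎ₛ_)
import Data.Sum.Relation.Binary.Pointwise as Pointwise
open import Data.Unit using (⊤)
open import Function using (_∘_; id; flip; _↔_; mk↔ₛ′; Inverse; _⇔_; mk⇔; Equivalence; Bijection)
open import Function.Construct.Composition using (_↔-∘_)
open import Function.Construct.Symmetry using (↔-sym)
open import Level using (0ℓ)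
open import Relation.Binary.Bundles using (Setoid)
open import Relation.Binary.Construct.Closure.ReflexiveTransitive using (Star; ε; _◅_; _◅◅_; reverse)
open import Relation.Binary.Definitions using (tri<; tri≈; tri>)
open import Relation.Binary.PropositionalEquality hiding ([_])
open import Relation.Nullary using (¬_; Dec; yes; no; does; contradiction; recompute)
open import Relation.Nullary.Decidable using (map′; dec-true; dec-false; _⊎-dec_; _×-dec_)

≤-by : ∀ {a b c d} → a ≤ b → d - c ≡ b - a → c ≤ d
≤-by p e = ℤₚ.0≤i-j⇒j≤i (subst (0ℤ ≤_) (sym e) (ℤₚ.i≤j⇒0≤j-i p))

≤-by₂ : ∀ {a b a′ b′ c d} → a ≤ b → a′ ≤ b′ → d - c ≡ (b - a) + (b′ - a′) → c ≤ d
≤-by₂ p q e = ℤₚ.0≤i-j⇒j≤i (subst (0ℤ ≤_) (sym e) (ℤₚ.+-mono-≤ (ℤₚ.i≤j⇒0≤j-i p) (ℤₚ.i≤j⇒0≤j-i q)))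

<-by : ∀ {a b c d} → a < b → d - c ≡ b - a → c < d
<-by {a} {b} {c} {d} p e = ⇒< (≤-by (<⇒ p) (trans (l d c) (trans (cong (_- 1ℤ) e) (sym (l b a)))))
  where
  l : ∀ x y → x - (1ℤ + y) ≡ (x - y) - 1ℤ
  l = solve-∀

0≤+ : ∀ {m} → 0ℤ ≤ + m
0≤+ = +≤+ ℕ.z≤n

-- Residues modulo n and simple reflections

module Mod (n : ℕ) .{{nt : NonTrivial n}} where

  open Periodic n

  N : ℤ
  N = + n

  2≤N : 1ℤ + 1ℤ ≤ N
  2≤N = +≤+ (ℕₚ.≤-trans (ℕ.s≤s (ℕ.s≤s ℕ.z≤n)) (ℕ.nonTrivial⇒n>1 n))

  infix 4 _≋_
  record _≋_ (a b : ℤ) : Set where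
    constructor by
    field
      quotient : ℤ
      equality : a ≡ b + quotient * N

  ∣⇒≋ : ∀ {a b} → N ∣ℤ (a - b) → a ≋ b
  ∣⇒≋ {a} {b} (divides q e) = by q (trans (l a b) (cong (λ z → b + z) e))
    where
    l : ∀ a b → a ≡ b + (a - b)
    l = solve-∀

  ≋⇒∣ : ∀ {a b} → a ≋ b → N ∣ℤ (a - b)
  ≋⇒∣ {a} {b} (by q e) = divides q (trans (cong (_- b) e) (l b (q * N)))
    where
    l : ∀ b x → b + x - b ≡ x
    l = solve-∀

  ≋-dec : ∀ a b → Dec (a ≋ b)
  ≋-dec a b = map′ ∣⇒≋ ≋⇒∣ (N ∣? (a - b))

  ≋-refl : ∀ {a} → a ≋ a
  ≋-refl {a} = by 0ℤ (sym (ℤₚ.+-identityʳ a))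

  ≋-reflexive : ∀ {a b} → a ≡ b → a ≋ b
  ≋-reflexive refl = ≋-refl

  ≋-sym : ∀ {a b} → a ≋ b → b ≋ a
  ≋-sym {a} {b} (by m refl) = by (- m) (l b m N)
    where
    l : ∀ b m N → b ≡ b + m * N + - m * N
    l = solve-∀

  ≋-trans : ∀ {a b c} → a ≋ b → b ≋ c → a ≋ c
  ≋-trans {c = c} (by m refl) (by m′ refl) = by (m′ + m) (l c m m′ N)
    where
    l : ∀ c m m′ N → c + m′ * N + m * N ≡ c + (m′ + m) * N
    l = solve-∀

  ≋-+ : ∀ c {a b} → a ≋ b → c + a ≋ c + b
  ≋-+ c {b = b} (by m refl) = by m (sym (ℤₚ.+-assoc c b (m * N)))

  ≋-by : ∀ {a b c d} → a ≋ b → c - d ≡ a - b → c ≋ d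
  ≋-by {a} {b} {c} {d} p e = ∣⇒≋ (subst (N ∣ℤ_) (sym e) (≋⇒∣ p))

  ≋-shift : ∀ a m → a + m * N ≋ a
  ≋-shift a m = by m refl

  ≋-+N : ∀ a → a + N ≋ a
  ≋-+N a = by 1ℤ (cong (λ z → a + z) (sym (ℤₚ.*-identityˡ N)))

  1≤m⇒N≤m*N : ∀ m → 1ℤ ≤ m → N ≤ m * N
  1≤m⇒N≤m*N m 1≤m = subst (_≤ m * N) (ℤₚ.*-identityˡ N) (ℤₚ.*-monoʳ-≤-nonNeg N 1≤m)

  mult<N⇒≤0 : ∀ m → m * N < N → m ≤ 0ℤ
  mult<N⇒≤0 m p = ℤₚ.≮⇒≥ λ 0<m → ℤₚ.<⇒≱ p (1≤m⇒N≤m*N m (<⇒ 0<m))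

  ≋-unique : ∀ {a b} → a ≋ b → a - b < N → b - a < N → a ≡ b
  ≋-unique {a} {b} (by m refl) p q = trans (cong (λ z → b + z * N) m≡0) (trans (cong (λ z → b + z) (ℤₚ.*-zeroˡ N)) (ℤₚ.+-identityʳ b))
    where
    l₁ : ∀ b x → b + x - b ≡ x
    l₁ = solve-∀
    l₂ : ∀ b m N → b - (b + m * N) ≡ - m * N
    l₂ = solve-∀
    m≡0 : m ≡ 0ℤ
    m≡0 = ℤₚ.≤-antisym (mult<N⇒≤0 m (subst (_< N) (l₁ b (m * N)) p))
                       (ℤₚ.neg-cancel-≤ (mult<N⇒≤0 (- m) (subst (_< N) (l₂ b m N) q)))

  ≋-suc-absurd : ∀ {a b} → a ≋ b → a ≋ 1ℤ + b → ⊥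
  ≋-suc-absurd {a} {b} p q = contradiction (≋-unique (≋-trans (≋-sym q) p) (⇒< (≤-by 2≤N (l₁ N b))) (⇒< (≤-by₂ 2≤N (0≤+ {2}) (l₂ N b)))) (λ e → ℤₚ.<-irrefl (sym e) (⇒< ℤₚ.≤-refl))
    where
    l₁ : ∀ N b → N - (1ℤ + (1ℤ + b - b)) ≡ N - (1ℤ + 1ℤ)
    l₁ = solve-∀
    l₂ : ∀ N b → N - (1ℤ + (b - (1ℤ + b))) ≡ (N - (1ℤ + 1ℤ)) + (+ 2 - 0ℤ)
    l₂ = solve-∀

  data Place (q a : ℤ) : Set where
    low  : a ≋ q → s q a ≡ 1ℤ + a → Place q a
    high : a ≋ 1ℤ + q → s q a ≡ -1ℤ + a → Place q a
    away : ¬ a ≋ q → ¬ a ≋ 1ℤ + q → s q a ≡ a → Place q a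

  place : ∀ q a → Place q a
  place q a = go (N ∣? (a - q)) (N ∣? (a - suc q))
    where
    branch : Bool → Bool → ℤ
    branch x y = if x then suc a else if y then pred a else a
    go : Dec (N ∣ℤ (a - q)) → Dec (N ∣ℤ (a - suc q)) → Place q a
    go (yes p) _       = low (∣⇒≋ p) (cong (λ x → branch x (does (N ∣? (a - suc q)))) (dec-true (N ∣? (a - q)) p))
    go (no p)  (yes r) = high (∣⇒≋ r) (cong₂ branch (dec-false (N ∣? (a - q)) p) (dec-true (N ∣? (a - suc q)) r))
    go (no p)  (no r)  = away (p ∘ ≋⇒∣) (r ∘ ≋⇒∣) (cong₂ branch (dec-false (N ∣? (a - q)) p) (dec-false (N ∣? (a - suc q)) r))

  s-low : ∀ {q a} → a ≋ q → s q a ≡ 1ℤ + a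
  s-low {q} {a} p with place q a
  ... | low _ e    = e
  ... | high p′ _  = ⊥-elim (≋-suc-absurd p p′)
  ... | away p′ _ _ = contradiction p p′

  s-high : ∀ {q a} → a ≋ 1ℤ + q → s q a ≡ -1ℤ + a
  s-high {q} {a} p with place q a
  ... | low p′ e    = ⊥-elim (≋-suc-absurd p′ p)
  ... | high _ e  = e
  ... | away _ p′ _ = contradiction p p′

  s-away : ∀ {q a} → ¬ a ≋ q → ¬ a ≋ 1ℤ + q → s q a ≡ a
  s-away {q} {a} p r with place q a
  ... | low p′ e    = contradiction p′ p
  ... | high p′ e  = contradiction p′ r
  ... | away _ _ e = e

  s-self : ∀ q → s q q ≡ 1ℤ + q
  s-self q = s-low ≋-refl

  s-suc : ∀ q → s q (1ℤ + q) ≡ q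
  s-suc q = trans (s-high ≋-refl) (l q)
    where
    l : ∀ q → -1ℤ + (1ℤ + q) ≡ q
    l = solve-∀

  s-involutive : ∀ q a → s q (s q a) ≡ a
  s-involutive q a with place q a
  ... | low p e  = trans (cong (s q) e) (trans (s-high (≋-+ 1ℤ p)) (l a))
    where
    l : ∀ q → -1ℤ + (1ℤ + q) ≡ q
    l = solve-∀
  ... | high p e = trans (cong (s q) e) (trans (s-low (≋-by p (l′ a q))) (l a))
    where
    l : ∀ q → 1ℤ + (-1ℤ + q) ≡ q
    l = solve-∀
    l′ : ∀ a q → -1ℤ + a - q ≡ a - (1ℤ + q)
    l′ = solve-∀
  ... | away _ _ e = trans (cong (s q) e) e

  s-injective : ∀ q {a b} → s q a ≡ s q b → a ≡ b
  s-injective q {a} {b} e = trans (sym (s-involutive q a)) (trans (cong (s q) e) (s-involutive q b))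

  s-≋ : ∀ {q q′} a m → q ≋ q′ → s q (a + m * N) ≡ s q′ a + m * N
  s-≋ {q} {q′} a m r with place q′ a
  ... | low p e    = trans (s-low (≋-trans (≋-shift a m) (≋-trans p (≋-sym r)))) (trans (l a (m * N)) (cong (_+ m * N) (sym e)))
    where
    l : ∀ a x → 1ℤ + (a + x) ≡ 1ℤ + a + x
    l = solve-∀
  ... | high p e   = trans (s-high (≋-trans (≋-shift a m) (≋-trans p (≋-+ 1ℤ (≋-sym r))))) (trans (l a (m * N)) (cong (_+ m * N) (sym e)))
    where
    l : ∀ a x → -1ℤ + (a + x) ≡ -1ℤ + a + x
    l = solve-∀
  ... | away p p′ e = trans (s-away (λ t → p (≋-trans (≋-sym (≋-shift a m)) (≋-trans t r)))
                                    (λ t → p′ (≋-trans (≋-sym (≋-shift a m)) (≋-trans t (≋-+ 1ℤ r)))))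
                            (cong (_+ m * N) (sym e))

  s-shift : ∀ q a m → s q (a + m * N) ≡ s q a + m * N
  s-shift q a m = s-≋ a m ≋-refl

  s-cong : ∀ {q q′} a → q ≋ q′ → s q a ≡ s q′ a
  s-cong {q} {q′} a r = trans (cong (s q) (l₁ a)) (trans (s-≋ a 0ℤ r) (sym (l₁ (s q′ a))))
    where
    l₁ : ∀ a → a ≡ a + 0ℤ * N
    l₁ a = trans (sym (ℤₚ.+-identityʳ a)) (cong (λ z → a + z) (sym (ℤₚ.*-zeroˡ N)))

  pred≤s : ∀ q a → -1ℤ + a ≤ s q a
  pred≤s q a with place q a
  ... | high p e    = ℤₚ.≤-reflexive (sym e)
  ... | low p e   = subst (-1ℤ + a ≤_) (sym e) (ℤₚ.+-monoˡ-≤ a -≤+)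
  ... | away _ _ e = subst (-1ℤ + a ≤_) (sym e) (ℤₚ.i≤j⇒pred[i]≤j ℤₚ.≤-refl)

  Adj : ℤ → ℤ → ℤ → Set
  Adj q a b = a ≋ q × b ≡ 1ℤ + a

  s-mono : ∀ {q a b} → a < b → ¬ Adj q a b → s q a < s q b
  s-mono {q} {a} {b} a<b na with place q a
  ... | low p e with b ≟ 1ℤ + a
  ...   | yes eq = contradiction (p , eq) na
  ...   | no neq with place q b
  ...     | low p′ e′ = subst₂ _<_ (sym e) (sym e′) (ℤₚ.+-monoʳ-< 1ℤ a<b)
  ...     | away _ _ e′ = subst₂ _<_ (sym e) (sym e′) (ℤₚ.≤∧≢⇒< (<⇒ a<b) (neq ∘ sym))
  ...     | high p′ e′ = subst₂ _<_ (sym e) (sym e′) (ℤₚ.≤∧≢⇒< (≤-by (<⇒ (ℤₚ.≤∧≢⇒< (<⇒ a<b) (neq ∘ sym))) (l a b)) λ e → ≋-suc-absurd (≋-sym p) (≋-trans (≋-sym (≋-by p′ (l″ b q))) (≋-reflexive (sym e))))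
    where
    l : ∀ a b → -1ℤ + b - (1ℤ + a) ≡ b - (1ℤ + (1ℤ + a))
    l = solve-∀
    l″ : ∀ b q → -1ℤ + b - q ≡ b - (1ℤ + q)
    l″ = solve-∀
  s-mono {q} {a} {b} a<b na | high p e = ℤₚ.<-≤-trans (subst (_< -1ℤ + b) (sym e) (ℤₚ.+-monoʳ-< -1ℤ a<b)) (pred≤s q b)
  s-mono {q} {a} {b} a<b na | away p p′ e with place q b
  ... | low _ e′ = subst₂ _<_ (sym e) (sym e′) (ℤₚ.<-trans a<b (⇒< ℤₚ.≤-refl))
  ... | away _ _ e′ = subst₂ _<_ (sym e) (sym e′) a<b
  ... | high r e′ = subst₂ _<_ (sym e) (sym e′) (ℤₚ.≤∧≢⇒< (ℤₚ.i<j⇒i≤pred[j] a<b) λ eq → p (≋-trans (≋-reflexive eq) (≋-by r (l b q))))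
    where
    l : ∀ b q → -1ℤ + b - q ≡ b - (1ℤ + q)
    l = solve-∀

-- Words of simple reflections

module Words (n : ℕ) .{{nt : NonTrivial n}} where

  open Periodic n using (s)
  open Mod n

  move : Step → Tile → ℤ → ℤ → ℤ
  move R crossing q p = s q p
  move R elbow    q p = p
  move U c        q p = p

  move-involutive : ∀ x c q p → move x c q (move x c q p) ≡ p
  move-involutive R crossing q p = s-involutive q p
  move-involutive R elbow    q p = refl
  move-involutive U c        q p = refl

  move-shift : ∀ x c q p m → move x c q (p + m * N) ≡ move x c q p + m * N
  move-shift R crossing q p m = s-shift q p m
  move-shift R elbow    q p m = refl
  move-shift U c        q p m = refl

  weight : Step → Tile → ℕ
  weight R elbow    = 1
  weight R crossing = 0
  weight U c        = 0

  module Word (b : ℤ) (pr : ℕ → Step) where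

    pos : ℕ → ℤ
    pos t = b + + t

    -- ρ τ t p is the label of the strand at position p after t letters, and π τ t is the inverse of ρ τ t.
    ρ π : (ℕ → Tile) → ℕ → ℤ → ℤ
    ρ τ ℕ.zero    p = p
    ρ τ (ℕ.suc t) p = ρ τ t (move (pr t) (τ t) (pos t) p)
    π τ ℕ.zero    a = a
    π τ (ℕ.suc t) a = move (pr t) (τ t) (pos t) (π τ t a)

    Allowed : (ℕ → Tile) → ℕ → Set
    Allowed τ t = pr t ≡ R → τ t ≡ elbow → ρ τ t (pos t) < ρ τ t (1ℤ + pos t)

    Valid : (ℕ → Tile) → ℕ → Set
    Valid τ t = ∀ r → r ℕ.< t → Allowed τ r

    count : (ℕ → Tile) → ℕ → ℕ
    count τ ℕ.zero    = 0
    count τ (ℕ.suc t) = weight (pr t) (τ t) ℕ.+ count τ t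

    infix 4 _≈[_]_
    _≈[_]_ : (ℕ → Tile) → ℕ → (ℕ → Tile) → Set
    τ ≈[ t ] τ′ = ∀ r → r ℕ.< t → pr r ≡ R → τ r ≡ τ′ r

    ≈-pred : ∀ {t τ τ′} → τ ≈[ ℕ.suc t ] τ′ → τ ≈[ t ] τ′
    ≈-pred h r r<t = h r (ℕₚ.m<n⇒m<1+n r<t)

    ≈-sym : ∀ {t τ τ′} → τ ≈[ t ] τ′ → τ′ ≈[ t ] τ
    ≈-sym h r r<t e = sym (h r r<t e)

    ≈-snoc : ∀ {t τ τ′} → τ ≈[ t ] τ′ → (pr t ≡ R → τ t ≡ τ′ t) → τ ≈[ ℕ.suc t ] τ′
    ≈-snoc h e r r<1+t = [ h r , (λ { refl → e }) ]′ (ℕₚ.m<1+n⇒m<n∨m≡n r<1+t)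

    ρ-cong : ∀ {τ τ′} t → τ ≈[ t ] τ′ → ∀ p → ρ τ t p ≡ ρ τ′ t p
    ρ-cong ℕ.zero h p = refl
    ρ-cong {τ} {τ′} (ℕ.suc t) h p with pr t in e
    ... | U = ρ-cong t (≈-pred h) p
    ... | R = trans (ρ-cong t (≈-pred h) _) (cong (λ c → ρ τ′ t (move R c (pos t) p)) (h t ℕₚ.≤-refl e))

    count-cong : ∀ {τ τ′} t → τ ≈[ t ] τ′ → count τ t ≡ count τ′ t
    count-cong ℕ.zero h = refl
    count-cong (ℕ.suc t) h with pr t in e
    ... | U = count-cong t (≈-pred h)
    ... | R = cong₂ (λ c m → weight R c ℕ.+ m) (h t ℕₚ.≤-refl e) (count-cong t (≈-pred h))

    Valid-cong : ∀ {τ τ′} t → τ ≈[ t ] τ′ → Valid τ t → Valid τ′ t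
    Valid-cong t h v r r<t pR e =
      subst₂ _<_ (ρ-cong r h′ _) (ρ-cong r h′ _) (v r r<t pR (trans (h r r<t pR) e))
      where
      h′ : _ ≈[ r ] _
      h′ r′ r′<r = h r′ (ℕₚ.<-trans r′<r r<t)

    ρπ : ∀ τ t a → ρ τ t (π τ t a) ≡ a
    ρπ τ ℕ.zero    a = refl
    ρπ τ (ℕ.suc t) a = trans (cong (ρ τ t) (move-involutive (pr t) (τ t) (pos t) _)) (ρπ τ t a)

    πρ : ∀ τ t p → π τ t (ρ τ t p) ≡ p
    πρ τ ℕ.zero    p = refl
    πρ τ (ℕ.suc t) p = trans (cong (move (pr t) (τ t) (pos t)) (πρ τ t _)) (move-involutive (pr t) (τ t) (pos t) p)

    ρ-injective : ∀ τ t {p p′} → ρ τ t p ≡ ρ τ t p′ → p ≡ p′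
    ρ-injective τ t {p} {p′} e = trans (sym (πρ τ t p)) (trans (cong (π τ t) e) (πρ τ t p′))

    ρ-shift : ∀ τ t p m → ρ τ t (p + m * N) ≡ ρ τ t p + m * N
    ρ-shift τ ℕ.zero    p m = refl
    ρ-shift τ (ℕ.suc t) p m = trans (cong (ρ τ t) (move-shift (pr t) (τ t) (pos t) p m)) (ρ-shift τ t _ m)

    ρ-≋ : ∀ τ t {p p′} → p ≋ p′ → ρ τ t p ≋ ρ τ t p′
    ρ-≋ τ t {p′ = p′} (by m refl) = by m (ρ-shift τ t p′ m)

    ρ-≋⁻¹ : ∀ τ t {p p′} → ρ τ t p ≋ ρ τ t p′ → p ≋ p′
    ρ-≋⁻¹ τ t {p} {p′} (by m e) = by m (ρ-injective τ t (trans e (sym (ρ-shift τ t p′ m))))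

    ρ-succ : ∀ τ t {p} q → p ≋ q → ρ τ t (1ℤ + q) ≡ 1ℤ + ρ τ t q → ρ τ t (1ℤ + p) ≡ 1ℤ + ρ τ t p
    ρ-succ τ t {p} q (by m refl) e = trans (cong (ρ τ t) (l q (m * N))) (trans (ρ-shift τ t (1ℤ + q) m)
      (trans (cong (λ z → z + m * N) e) (trans (sym (l (ρ τ t q) (m * N))) (cong (λ z → 1ℤ + z) (sym (ρ-shift τ t q m))))))
      where
      l : ∀ a x → 1ℤ + (a + x) ≡ 1ℤ + a + x
      l = solve-∀

    ρ-pred : ∀ τ t {p} q → p ≋ q → ρ τ t q ≡ 1ℤ + ρ τ t (1ℤ + q) → ρ τ t p ≡ 1ℤ + ρ τ t (1ℤ + p)
    ρ-pred τ t {p} q (by m refl) e = trans (ρ-shift τ t q m) (trans (cong (λ z → z + m * N) e) (trans (sym (l (ρ τ t (1ℤ + q)) (m * N)))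
      (cong (λ z → 1ℤ + z) (trans (sym (ρ-shift τ t (1ℤ + q) m)) (cong (ρ τ t) (sym (l q (m * N))))))))
      where
      l : ∀ a x → 1ℤ + (a + x) ≡ 1ℤ + a + x
      l = solve-∀

    ρ-<-shift : ∀ τ t {p} q → p ≋ q → ρ τ t q < ρ τ t (1ℤ + q) ⇔ ρ τ t p < ρ τ t (1ℤ + p)
    ρ-<-shift τ t q (by m refl) = mk⇔ (λ lt → subst₂ _<_ e₀ e₁ (ℤₚ.+-monoˡ-< (m * N) lt))
                                      (λ lt → ℤₚ.≰⇒> λ le → ℤₚ.<⇒≱ lt (subst₂ _≤_ e₁ e₀ (ℤₚ.+-monoˡ-≤ (m * N) le)))
      where
      l : ∀ a x → 1ℤ + (a + x) ≡ 1ℤ + a + x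
      l = solve-∀
      e₀ = sym (ρ-shift τ t q m)
      e₁ = trans (sym (ρ-shift τ t (1ℤ + q) m)) (cong (ρ τ t) (sym (l q (m * N))))

  module Tail (b : ℤ) (pr : ℕ → Step) (τ : ℕ → Tile) (τ0 : τ 0 ≡ elbow) where
    private
      module W  = Word b pr
      module W′ = Word (1ℤ + b) (pr ∘ ℕ.suc)

    pos-tail : ∀ t → W.pos (ℕ.suc t) ≡ W′.pos t
    pos-tail t = l b (+ t)
      where
      l : ∀ b t → b + (1ℤ + t) ≡ 1ℤ + b + t
      l = solve-∀

    move-elbow : ∀ x q p → move x elbow q p ≡ p
    move-elbow R q p = refl
    move-elbow U q p = refl

    ρ-tail : ∀ t p → W.ρ τ (ℕ.suc t) p ≡ W′.ρ (τ ∘ ℕ.suc) t p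
    ρ-tail ℕ.zero p = trans (cong (λ c → move (pr 0) c (W.pos 0) p) τ0) (move-elbow (pr 0) (W.pos 0) p)
    ρ-tail (ℕ.suc t) p = trans (ρ-tail t _) (cong (λ q → W′.ρ (τ ∘ ℕ.suc) t (move (pr (ℕ.suc t)) (τ (ℕ.suc t)) q p)) (pos-tail t))

    count-tail : ∀ t → W.count τ (ℕ.suc t) ≡ W′.count (τ ∘ ℕ.suc) t ℕ.+ weight (pr 0) elbow
    count-tail ℕ.zero rewrite τ0 = ℕₚ.+-identityʳ _
    count-tail (ℕ.suc t) = trans (cong (weight (pr (ℕ.suc t)) (τ (ℕ.suc t)) ℕ.+_) (count-tail t)) (sym (ℕₚ.+-assoc (weight (pr (ℕ.suc t)) (τ (ℕ.suc t))) _ _))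

    Allowed-tail : ∀ r → W.Allowed τ (ℕ.suc r) ⇔ W′.Allowed (τ ∘ ℕ.suc) r
    Allowed-tail r = mk⇔ (λ a x y → subst₂ _<_ e₀ e₁ (a x y)) (λ a x y → subst₂ _<_ (sym e₀) (sym e₁) (a x y))
      where
      e₀ = trans (ρ-tail r _) (cong (W′.ρ (τ ∘ ℕ.suc) r) (pos-tail r))
      e₁ = trans (ρ-tail r _) (cong (λ q → W′.ρ (τ ∘ ℕ.suc) r (1ℤ + q)) (pos-tail r))

    Valid-tail : ∀ t → W.Valid τ (ℕ.suc t) ⇔ W′.Valid (τ ∘ ℕ.suc) t
    Valid-tail t = mk⇔ (λ v r r<t → Equivalence.to (Allowed-tail r) (v (ℕ.suc r) (ℕ.s≤s r<t))) back
      where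
      back : W′.Valid (τ ∘ ℕ.suc) t → W.Valid τ (ℕ.suc t)
      back v ℕ.zero    _ _ _ = ⇒< (ℤₚ.≤-refl)
      back v (ℕ.suc r) (ℕ.s≤s r<t) = Equivalence.from (Allowed-tail r) (v r r<t)

  module Transducer (i : ℤ) (b : ℤ) (pr : ℕ → Step) where
    open Word b pr

    Pair : ℤ → ℤ → Set
    Pair x y = Adj i x y ⊎ Adj i y x

    Meet : (ℤ → ℤ) → ℤ → Set
    Meet g q = Pair (g q) (g (1ℤ + q))

    Meet? : ∀ g q → Dec (Meet g q)
    Meet? g q = (≋-dec _ i ×-dec (_ ≟ _)) ⊎-dec (≋-dec _ i ×-dec (_ ≟ _))

    sw : Tile → ℤ → ℤ
    sw c = move R c i

    sw-pair : ∀ c {x y} → Pair x y → Pair (sw c x) (sw c y)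
    sw-pair elbow    h = h
    sw-pair crossing (inj₁ (p , refl)) = inj₂ (subst (_≋ i) (sym e) p , trans (s-low p) (cong (λ z → 1ℤ + z) (sym e)))
      where e = trans (s-high (≋-+ 1ℤ p)) (ℤₚ.pred-suc _)
    sw-pair crossing (inj₂ (p , refl)) = inj₁ (subst (_≋ i) (sym e) p , trans (s-low p) (cong (λ z → 1ℤ + z) (sym e)))
      where e = trans (s-high (≋-+ 1ℤ p)) (ℤₚ.pred-suc _)

    sw-pair⁻¹ : ∀ c {x y} → Pair (sw c x) (sw c y) → Pair x y
    sw-pair⁻¹ c h = subst₂ Pair (move-involutive R c i _) (move-involutive R c i _) (sw-pair c h)

    sw-mono : ∀ c {x y} → ¬ Pair x y → x < y → sw c x < sw c y
    sw-mono elbow    np lt = lt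
    sw-mono crossing np lt = s-mono lt (np ∘ inj₁)

    sw-mono⁻¹ : ∀ c {x y} → ¬ Pair x y → sw c x < sw c y → x < y
    sw-mono⁻¹ c np lt = subst₂ _<_ (move-involutive R c i _) (move-involutive R c i _) (sw-mono c (np ∘ sw-pair⁻¹ c) lt)

    -- Where two strands of labels i and i + 1 (up to translation) meet, exchanging positions is exchanging labels.
    ρ-conj : ∀ τ t q → Meet (ρ τ t) q → ∀ p → ρ τ t (s q p) ≡ s i (ρ τ t p)
    ρ-conj τ t q mt p with place q p
    ρ-conj τ t q (inj₁ (h , e)) p | low  a r = trans (trans (cong (ρ τ t) r) (ρ-succ τ t q a e)) (sym (s-low (≋-trans (ρ-≋ τ t a) h)))
    ρ-conj τ t q (inj₂ (h , e)) p | low  a r = trans (cong (ρ τ t) r) (trans (sym (ℤₚ.pred-suc _)) (trans (cong pred (sym e′)) (sym (s-high (≋-trans (≋-reflexive e′) (≋-+ 1ℤ (≋-trans (ρ-≋ τ t (≋-+ 1ℤ a)) h)))))))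
      where e′ = ρ-pred τ t q a e
    ρ-conj τ t q mt p | high a r = trans (cong (ρ τ t) r) (go mt)
      where
      p′ = -1ℤ + p
      a′ : p′ ≋ q
      a′ = ≋-by a (l p q)
        where
        l : ∀ p q → -1ℤ + p - q ≡ p - (1ℤ + q)
        l = solve-∀
      p≡ : 1ℤ + p′ ≡ p
      p≡ = ℤₚ.suc-pred p
      go : Meet (ρ τ t) q → ρ τ t p′ ≡ s i (ρ τ t p)
      go (inj₁ (h , e)) = trans (sym (ℤₚ.pred-suc _)) (trans (cong pred (sym e′)) (sym (s-high (≋-trans (≋-reflexive e′) (≋-+ 1ℤ (≋-trans (ρ-≋ τ t a′) h))))))
        where e′ = subst (λ z → ρ τ t z ≡ 1ℤ + ρ τ t p′) p≡ (ρ-succ τ t q a′ e)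
      go (inj₂ (h , e)) = trans e′ (sym (s-low (≋-trans (ρ-≋ τ t a) h)))
        where e′ = subst (λ z → ρ τ t p′ ≡ 1ℤ + ρ τ t z) p≡ (ρ-pred τ t q a′ e)
    ρ-conj τ t q (inj₁ (h , e)) p | away a a′ r = trans (cong (ρ τ t) r)
      (sym (s-away (λ z → a (ρ-≋⁻¹ τ t (≋-trans z (≋-sym h))))
                   (λ z → a′ (ρ-≋⁻¹ τ t (≋-trans z (≋-trans (≋-+ 1ℤ (≋-sym h)) (≋-reflexive (sym e))))))))
    ρ-conj τ t q (inj₂ (h , e)) p | away a a′ r = trans (cong (ρ τ t) r)
      (sym (s-away (λ z → a′ (ρ-≋⁻¹ τ t (≋-trans z (≋-sym h))))
                   (λ z → a (ρ-≋⁻¹ τ t (≋-trans z (≋-trans (≋-+ 1ℤ (≋-sym h)) (≋-reflexive (sym e))))))))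

    -- The tiles at the meetings of the strands i and i + 1 are delayed by one meeting; the index of Trans is the pending tile.
    data Trans (τ τ′ : ℕ → Tile) : ℕ → Tile → Set where
      start : Trans τ τ′ 0 elbow
      skip  : ∀ {t c} → Trans τ τ′ t c → pr t ≡ U → Trans τ τ′ (ℕ.suc t) c
      copy  : ∀ {t c} → Trans τ τ′ t c → pr t ≡ R → ¬ Meet (ρ τ′ t) (pos t) → τ t ≡ τ′ t → Trans τ τ′ (ℕ.suc t) c
      delay : ∀ {t c d} → Trans τ τ′ t c → pr t ≡ R → Meet (ρ τ′ t) (pos t) → τ′ t ≡ c → τ t ≡ d → Trans τ τ′ (ℕ.suc t) d

    Trans-ρ : ∀ {τ τ′ t c} → Trans τ τ′ t c → ∀ p → ρ τ t p ≡ sw c (ρ τ′ t p)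
    Trans-ρ start p = refl
    Trans-ρ {t = ℕ.suc t} (skip T u) p rewrite u = Trans-ρ T p
    Trans-ρ {τ} {τ′} {ℕ.suc t} (copy {c = c} T r _ e) p rewrite r = trans (Trans-ρ T _) (cong (λ d → sw c (ρ τ′ t (move R d (pos t) p))) e)
    Trans-ρ {τ} {τ′} {ℕ.suc t} (delay {c = c} {d} T r mt refl refl) p rewrite r = trans (Trans-ρ T _) (go (τ′ t) (τ t))
      where
      conj : ∀ c p → ρ τ′ t (move R c (pos t) p) ≡ sw c (ρ τ′ t p)
      conj elbow    p = refl
      conj crossing p = ρ-conj τ′ t (pos t) mt p
      comm : ∀ c d x → sw c (sw d x) ≡ sw d (sw c x)
      comm elbow d x = refl
      comm crossing elbow x = refl
      comm crossing crossing x = refl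
      go : ∀ c d → sw c (ρ τ′ t (move R d (pos t) p)) ≡ sw d (ρ τ′ t (move R c (pos t) p))
      go c d = trans (cong (sw c) (conj d p)) (trans (comm c d _) (cong (sw d) (sym (conj c p))))

    Ordered : (ℤ → ℤ) → Set
    Ordered g = ∀ p p′ → g p ≡ i → g p′ ≡ 1ℤ + i → p < p′

    meet-after : ∀ τ t → pr t ≡ R → Meet (ρ τ t) (pos t) → ∀ p → ρ τ (ℕ.suc t) p ≡ sw (τ t) (ρ τ t p)
    meet-after τ t r mt p rewrite r with τ t
    ... | elbow    = refl
    ... | crossing = ρ-conj τ t (pos t) mt p

    Meet-after : ∀ τ t → pr t ≡ R → Meet (ρ τ t) (pos t) → Meet (ρ τ (ℕ.suc t)) (pos t)
    Meet-after τ t r mt = subst₂ Pair (sym (meet-after τ t r mt _)) (sym (meet-after τ t r mt _)) (sw-pair (τ t) mt)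

    Ordered-meet : ∀ τ t q → Meet (ρ τ t) q → Ordered (ρ τ t) ⇔ ρ τ t q < ρ τ t (1ℤ + q)
    Ordered-meet τ t q (inj₁ (h , e)) = mk⇔ (λ _ → subst (ρ τ t q <_) (sym e) (⇒< ℤₚ.≤-refl)) (λ _ → ord)
      where
      ord : Ordered (ρ τ t)
      ord p p′ x x′ = subst (p <_) (ρ-injective τ t (trans (ρ-succ τ t q (ρ-≋⁻¹ τ t (≋-trans (≋-reflexive x) (≋-sym h))) e)
                                                      (trans (cong (λ z → 1ℤ + z) x) (sym x′)))) (⇒< ℤₚ.≤-refl)
    Ordered-meet τ t q (inj₂ (h , e)) = mk⇔ (λ o → ⊥-elim (bad o)) (λ lt → contradiction (subst (ρ τ t (1ℤ + q) <_) (sym e) (⇒< ℤₚ.≤-refl)) (ℤₚ.<-asym lt))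
      where
      p = π τ t i
      ρp = ρπ τ t i
      p₀≋q : -1ℤ + p ≋ q
      p₀≋q = ≋-by (ρ-≋⁻¹ τ t (≋-trans (≋-reflexive ρp) (≋-sym h))) (l p q)
        where
        l : ∀ p q → -1ℤ + p - q ≡ p - (1ℤ + q)
        l = solve-∀
      ρp₀ : ρ τ t (-1ℤ + p) ≡ 1ℤ + i
      ρp₀ = trans (ρ-pred τ t q p₀≋q e) (cong (λ z → 1ℤ + z) (trans (cong (ρ τ t) (ℤₚ.suc-pred p)) ρp))
      bad : ¬ Ordered (ρ τ t)
      bad o = ℤₚ.<-asym (o p (-1ℤ + p) ρp ρp₀) (ℤₚ.i≤pred[j]⇒i<j ℤₚ.≤-refl)

    ¬Meet⇒¬Adj : ∀ τ t q → ¬ Meet (ρ τ t) q → ∀ {a b} → ρ τ t a ≡ i → ρ τ t b ≡ 1ℤ + i → ¬ Adj q a b × ¬ Adj q b a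
    ¬Meet⇒¬Adj τ t q nm {a} {b} x y =
      (λ { (h , refl) → nm (inj₁ ( ≋-trans (ρ-≋ τ t (≋-sym h)) (≋-reflexive x)
                                 , ρ-succ τ t a (≋-sym h) (trans y (cong (λ z → 1ℤ + z) (sym x))))) }) ,
      (λ { (h , refl) → nm (inj₂ ( ≋-trans (ρ-≋ τ t (≋-+ 1ℤ (≋-sym h))) (≋-reflexive x)
                                 , ρ-pred τ t b (≋-sym h) (trans y (cong (λ z → 1ℤ + z) (sym x))))) })

    Ordered-¬meet : ∀ τ t → pr t ≡ R → ¬ Meet (ρ τ t) (pos t) → Ordered (ρ τ t) ⇔ Ordered (ρ τ (ℕ.suc t))
    Ordered-¬meet τ t r nm rewrite r with τ t
    ... | elbow    = mk⇔ id id
    ... | crossing = mk⇔ to from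
      where
      q = pos t
      to : Ordered (ρ τ t) → Ordered (λ p → ρ τ t (s q p))
      to o p p′ x x′ = subst₂ _<_ (s-involutive q p) (s-involutive q p′)
        (s-mono (o _ _ x x′) (proj₁ (¬Meet⇒¬Adj τ t q nm x x′)))
      from : Ordered (λ p → ρ τ t (s q p)) → Ordered (ρ τ t)
      from o p p′ x x′ = subst₂ _<_ (s-involutive q p) (s-involutive q p′)
        (s-mono (o (s q p) (s q p′) (trans (cong (ρ τ t) (s-involutive q p)) x) (trans (cong (ρ τ t) (s-involutive q p′)) x′)) λ { (h , e) →
          let p≡ = trans (sym (s-involutive q p)) (trans (s-low h) (sym e))
              p′≡ = trans (sym (s-involutive q p′)) (cong (s q) (sym p≡))
              h′ = subst (_≋ q) (sym p′≡) h
          in proj₂ (¬Meet⇒¬Adj τ t q nm x x′) (h′ , trans p≡ (s-low h′)) })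

    Valid-snoc : ∀ τ t → Valid τ (ℕ.suc t) ⇔ (Valid τ t × Allowed τ t)
    Valid-snoc τ t = mk⇔ (λ v → (λ r r<t → v r (ℕₚ.m<n⇒m<1+n r<t)) , v t ℕₚ.≤-refl)
                         (λ (v , a) r r<1+t → [ v r , (λ { refl → a }) ]′ (ℕₚ.m<1+n⇒m<n∨m≡n r<1+t))

    Trans-count : ∀ {τ τ′ t c} → Trans τ τ′ t c → count τ t ℕ.+ 1 ≡ count τ′ t ℕ.+ weight R c
    Trans-count start = refl
    Trans-count {t = ℕ.suc t} (skip T u) rewrite u = Trans-count T
    Trans-count {τ} {τ′} {ℕ.suc t} (copy {c = c} T r _ e) rewrite r | e =
      trans (ℕₚ.+-assoc (weight R (τ′ t)) _ _) (trans (cong (weight R (τ′ t) ℕ.+_) (Trans-count T)) (sym (ℕₚ.+-assoc (weight R (τ′ t)) _ _)))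
    Trans-count {τ} {τ′} {ℕ.suc t} (delay T r _ refl refl) rewrite r =
      trans (ℕₚ.+-assoc (weight R (τ t)) _ _) (trans (cong (weight R (τ t) ℕ.+_) (Trans-count T))
        (trans (ℕₚ.+-comm (weight R (τ t)) _) (cong (ℕ._+ weight R (τ t)) (ℕₚ.+-comm (count τ′ t) _))))

    Trans-valid : ∀ {τ τ′ t c} → Trans τ τ′ t c → Valid τ t ⇔ (Valid τ′ t × (c ≡ elbow → Ordered (ρ τ′ t)))
    Trans-valid start = mk⇔ (λ _ → (λ _ ()) , λ { _ p p′ refl refl → ⇒< ℤₚ.≤-refl }) (λ _ _ ())
    Trans-valid {τ} {τ′} {ℕ.suc t} (skip T u) = mk⇔
      (λ v → let v′ , o = Equivalence.to (Trans-valid T) (proj₁ (Equivalence.to (Valid-snoc τ t) v)) in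
             Equivalence.from (Valid-snoc τ′ t) (v′ , λ r → contradiction (trans (sym r) u) λ ()) ,
             λ e p p′ x x′ → o e p p′ (trans (sym (same p)) x) (trans (sym (same p′)) x′))
      (λ (v′ , o) → Equivalence.from (Valid-snoc τ t)
        ( Equivalence.from (Trans-valid T) (proj₁ (Equivalence.to (Valid-snoc τ′ t) v′) , λ e p p′ x x′ → o e p p′ (trans (same p) x) (trans (same p′) x′))
        , λ r → contradiction (trans (sym r) u) λ ()))
      where
      same : ∀ p → ρ τ′ (ℕ.suc t) p ≡ ρ τ′ t p
      same p rewrite u = refl
    Trans-valid {τ} {τ′} {ℕ.suc t} (copy {c = c} T r nm e) = mk⇔
      (λ v → let v₀ , a = Equivalence.to (Valid-snoc τ t) v
                 v′ , o = Equivalence.to (Trans-valid T) v₀ in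
             Equivalence.from (Valid-snoc τ′ t) (v′ , λ _ x → sw-mono⁻¹ c nm (subst₂ _<_ (Trans-ρ T _) (Trans-ρ T _) (a r (trans e x)))) ,
             λ x → Equivalence.to (Ordered-¬meet τ′ t r nm) (o x))
      (λ (v′ , o) → let v₀ , a = Equivalence.to (Valid-snoc τ′ t) v′ in
        Equivalence.from (Valid-snoc τ t)
          ( Equivalence.from (Trans-valid T) (v₀ , λ x → Equivalence.from (Ordered-¬meet τ′ t r nm) (o x))
          , λ _ x → subst₂ _<_ (sym (Trans-ρ T _)) (sym (Trans-ρ T _)) (sw-mono c nm (a r (trans (sym e) x)))))
    Trans-valid {τ} {τ′} {ℕ.suc t} (delay {c = c} {d} T r mt refl refl) = mk⇔
      (λ v → let v₀ , a = Equivalence.to (Valid-snoc τ t) v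
                 v′ , o = Equivalence.to (Trans-valid T) v₀ in
             Equivalence.from (Valid-snoc τ′ t) (v′ , λ _ x → Equivalence.to now (o x)) ,
             λ x → Equivalence.from later (subst₂ _<_ (same _) (same _) (a r x)))
      (λ (v′ , o) → let v₀ , a = Equivalence.to (Valid-snoc τ′ t) v′ in
        Equivalence.from (Valid-snoc τ t)
          ( Equivalence.from (Trans-valid T) (v₀ , λ x → Equivalence.from now (a r x))
          , λ _ x → subst₂ _<_ (sym (same _)) (sym (same _)) (Equivalence.to later (o x))))
      where
      now   = Ordered-meet τ′ t (pos t) mt
      later = Ordered-meet τ′ (ℕ.suc t) (pos t) (Meet-after τ′ t r mt)
      same : ∀ p → ρ τ t p ≡ ρ τ′ (ℕ.suc t) p
      same p = trans (Trans-ρ T p) (sym (meet-after τ′ t r mt p))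

    Meet-cong : ∀ {τ τ′} t → τ ≈[ t ] τ′ → Meet (ρ τ t) (pos t) → Meet (ρ τ′ t) (pos t)
    Meet-cong t h = subst₂ Pair (ρ-cong t h _) (ρ-cong t h _)

    Trans-resp : ∀ {τ₁ τ₂ τ₁′ τ₂′ t c} → τ₁ ≈[ t ] τ₂ → τ₁′ ≈[ t ] τ₂′ → Trans τ₁ τ₁′ t c → Trans τ₂ τ₂′ t c
    Trans-resp h h′ start = start
    Trans-resp h h′ (skip T u) = skip (Trans-resp (≈-pred h) (≈-pred h′) T) u
    Trans-resp {t = ℕ.suc t} h h′ (copy T r nm e) = copy (Trans-resp (≈-pred h) (≈-pred h′) T) r
      (nm ∘ Meet-cong t (≈-sym (≈-pred h′))) (trans (sym (h t ℕₚ.≤-refl r)) (trans e (h′ t ℕₚ.≤-refl r)))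
    Trans-resp {t = ℕ.suc t} h h′ (delay T r m e e′) = delay (Trans-resp (≈-pred h) (≈-pred h′) T) r
      (Meet-cong t (≈-pred h′) m) (trans (sym (h′ t ℕₚ.≤-refl r)) e) (trans (sym (h t ℕₚ.≤-refl r)) e′)

    R≢U : ∀ {t} → pr t ≡ R → ¬ pr t ≡ U
    R≢U r u = contradiction (trans (sym r) u) λ ()

    Trans-functional : ∀ {τ₁ τ₂ τ₁′ τ₂′ t c₁ c₂} → τ₁ ≈[ t ] τ₂ → Trans τ₁ τ₁′ t c₁ → Trans τ₂ τ₂′ t c₂ → τ₁′ ≈[ t ] τ₂′ × c₁ ≡ c₂
    Trans-functional h start start = (λ _ ()) , refl
    Trans-functional h (skip T₁ u) (skip T₂ _) = let h′ , e = Trans-functional (≈-pred h) T₁ T₂ in ≈-snoc h′ (λ r → contradiction u (R≢U r)) , e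
    Trans-functional h (skip T₁ u) (copy T₂ r _ _) = contradiction u (R≢U r)
    Trans-functional h (skip T₁ u) (delay T₂ r _ _ _) = contradiction u (R≢U r)
    Trans-functional h (copy T₁ r _ _) (skip T₂ u) = contradiction u (R≢U r)
    Trans-functional h (delay T₁ r _ _ _) (skip T₂ u) = contradiction u (R≢U r)
    Trans-functional {t = ℕ.suc t} h (copy T₁ r nm₁ e₁) (copy T₂ _ nm₂ e₂) = let h′ , e = Trans-functional (≈-pred h) T₁ T₂ in
      ≈-snoc h′ (λ _ → trans (sym e₁) (trans (h t ℕₚ.≤-refl r) e₂)) , e
    Trans-functional {t = ℕ.suc t} h (copy T₁ _ nm _) (delay T₂ _ m _ _) =
      contradiction (Meet-cong t (≈-sym (proj₁ (Trans-functional (≈-pred h) T₁ T₂))) m) nm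
    Trans-functional {t = ℕ.suc t} h (delay T₁ _ m _ _) (copy T₂ _ nm _) =
      contradiction (Meet-cong t (proj₁ (Trans-functional (≈-pred h) T₁ T₂)) m) nm
    Trans-functional {t = ℕ.suc t} h (delay T₁ r m₁ e₁ d₁) (delay T₂ _ m₂ e₂ d₂) = let h′ , e = Trans-functional (≈-pred h) T₁ T₂ in
      ≈-snoc h′ (λ _ → trans e₁ (trans e (sym e₂))) , trans (sym d₁) (trans (h t ℕₚ.≤-refl r) d₂)

    Trans-injective : ∀ {τ₁ τ₂ τ₁′ τ₂′ t c} → τ₁′ ≈[ t ] τ₂′ → Trans τ₁ τ₁′ t c → Trans τ₂ τ₂′ t c → τ₁ ≈[ t ] τ₂
    Trans-injective h start start = λ _ ()
    Trans-injective h (skip T₁ u) (skip T₂ _) = ≈-snoc (Trans-injective (≈-pred h) T₁ T₂) (λ r → contradiction u (R≢U r))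
    Trans-injective h (skip T₁ u) (copy T₂ r _ _) = contradiction u (R≢U r)
    Trans-injective h (skip T₁ u) (delay T₂ r _ _ _) = contradiction u (R≢U r)
    Trans-injective h (copy T₁ r _ _) (skip T₂ u) = contradiction u (R≢U r)
    Trans-injective h (delay T₁ r _ _ _) (skip T₂ u) = contradiction u (R≢U r)
    Trans-injective {t = ℕ.suc t} h (copy T₁ r nm₁ e₁) (copy T₂ _ nm₂ e₂) =
      ≈-snoc (Trans-injective (≈-pred h) T₁ T₂) (λ _ → trans e₁ (trans (h t ℕₚ.≤-refl r) (sym e₂)))
    Trans-injective {t = ℕ.suc t} h (copy T₁ _ nm _) (delay T₂ _ m _ _) = contradiction (Meet-cong t (≈-sym (≈-pred h)) m) nm
    Trans-injective {t = ℕ.suc t} h (delay T₁ _ m _ _) (copy T₂ _ nm _) = contradiction (Meet-cong t (≈-pred h) m) nm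
    Trans-injective {t = ℕ.suc t} h (delay T₁ r m₁ refl d₁) (delay T₂ _ m₂ e₂ d₂) with trans (sym e₂) (sym (h t ℕₚ.≤-refl r))
    ... | refl = ≈-snoc (Trans-injective (≈-pred h) T₁ T₂) (λ _ → trans d₁ (sym d₂))

    update : ℕ → Tile → (ℕ → Tile) → ℕ → Tile
    update t c τ r = if does (r ℕ.≟ t) then c else τ r

    update-at : ∀ t c τ → update t c τ t ≡ c
    update-at t c τ rewrite dec-true (t ℕ.≟ t) refl = refl

    update-other : ∀ {t r} c τ → r ≢ t → τ r ≡ update t c τ r
    update-other {t} {r} c τ r≢t rewrite dec-false (r ℕ.≟ t) r≢t = refl

    update-below : ∀ t c τ → τ ≈[ t ] update t c τ
    update-below t c τ r r<t _ = update-other c τ (ℕₚ.<⇒≢ r<t)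

    Trans-forward : ∀ τ t → ∃₂ λ τ′ c → Trans τ τ′ t c
    Trans-forward τ ℕ.zero = (λ _ → elbow) , elbow , start
    Trans-forward τ (ℕ.suc t) with Trans-forward τ t | pr t in e
    ... | τ′ , c , T | U = τ′ , c , skip T e
    ... | τ′ , c , T | R with Meet? (ρ τ′ t) (pos t)
    ...   | yes m = update t c τ′ , τ t ,
                    delay (Trans-resp (λ _ _ _ → refl) (update-below t c τ′) T) e (Meet-cong t (update-below t c τ′) m) (update-at t c τ′) refl
    ...   | no nm = update t (τ t) τ′ , c ,
                    copy (Trans-resp (λ _ _ _ → refl) (update-below t (τ t) τ′) T) e (nm ∘ Meet-cong t (≈-sym (update-below t (τ t) τ′))) (sym (update-at t (τ t) τ′))

    module _ (pr0 : pr 0 ≡ R) (b≡i : b ≡ i) (τ′ : ℕ → Tile) (τ′0 : τ′ 0 ≡ elbow) where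

      Meet0 : Meet (ρ τ′ 0) (pos 0)
      Meet0 = inj₁ (≋-reflexive (trans (ℤₚ.+-identityʳ b) b≡i) , refl)

      Trans-backward : ∀ t c → (t ≡ 0 → c ≡ elbow) → ∃ λ τ → Trans τ τ′ t c
      Trans-backward ℕ.zero c h rewrite h refl = (λ _ → elbow) , start
      Trans-backward (ℕ.suc t) c _ with pr t in e
      ... | U with Trans-backward t c (λ { refl → contradiction e (R≢U pr0) })
      ...   | τ , T = τ , skip T e
      Trans-backward (ℕ.suc t) c _ | R with Meet? (ρ τ′ t) (pos t)
      ... | yes m with Trans-backward t (τ′ t) (λ { refl → τ′0 })
      ...   | τ , T = update t c τ , delay (Trans-resp (update-below t c τ) (λ _ _ _ → refl) T) e m refl (update-at t c τ)
      Trans-backward (ℕ.suc t) c _ | R | no nm with Trans-backward t c (λ { refl → contradiction Meet0 nm })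
      ...   | τ , T = update t (τ′ t) τ , copy (Trans-resp (update-below t (τ′ t) τ) (λ _ _ _ → refl) T) e nm (update-at t (τ′ t) τ)

-- Lattice paths and strands

module ℤ-group = Algebra.Properties.AbelianGroup ℤₚ.+-0-abelianGroup

ℤ-ind : (Q : ℤ → Set) → Q 0ℤ → (∀ j → Q j → Q (1ℤ + j)) → (∀ j → Q (1ℤ + j) → Q j) → ∀ j → Q j
ℤ-ind Q q up down (+ ℕ.zero) = q
ℤ-ind Q q up down (+ ℕ.suc m) = up (+ m) (ℤ-ind Q q up down (+ m))
ℤ-ind Q q up down -[1+ ℕ.zero ] = down -[1+ 0 ] q
ℤ-ind Q q up down -[1+ ℕ.suc m ] = down -[1+ ℕ.suc m ] (ℤ-ind Q q up down -[1+ m ])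

≤⇒+ : ∀ {a b} → a ≤ b → ∃[ m ] b ≡ a + + m
≤⇒+ {a} {b} p = ∣ b - a ∣ , trans (l a b) (cong (λ z → a + z) (sym (ℤₚ.0≤i⇒+∣i∣≡i (ℤₚ.i≤j⇒0≤j-i p))))
  where
  l : ∀ a b → b ≡ a + (b - a)
  l = solve-∀

module Residues (n : ℕ) .{{nt : NonTrivial n}} where

  open Mod n
  open Periodic n using (index)

  private instance
    n≢0 : NonZero n
    n≢0 = nonTrivial⇒nonZero n

  ≋-% : ∀ a → a ≋ + (a %ℕ n)
  ≋-% a = by (a /ℕ n) (a≡a%ℕn+[a/ℕn]*n a n)

  ≋⇒≡ℕ : ∀ {r r′} → + r ≋ + r′ → r ℕ.< n → r′ ℕ.< n → r ≡ r′
  ≋⇒≡ℕ {r} {r′} p r<n r′<n = ℤₚ.+-injective (≋-unique p (small r r′ r<n) (small r′ r r′<n))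
    where
    l : ∀ x y N → N - (1ℤ + (x - y)) ≡ (N - (1ℤ + x)) + (y - 0ℤ)
    l = solve-∀
    small : ∀ x y → x ℕ.< n → + x - + y < N
    small x y x<n = ⇒< (≤-by₂ (+≤+ x<n) (0≤+ {y}) (l (+ x) (+ y) N))

  %-cong : ∀ {a b} → a ≋ b → a %ℕ n ≡ b %ℕ n
  %-cong {a} {b} p = ≋⇒≡ℕ (≋-trans (≋-sym (≋-% a)) (≋-trans p (≋-% b))) (n%ℕd<d a n) (n%ℕd<d b n)

  %-unique : ∀ {a r} → a ≋ + r → r ℕ.< n → a %ℕ n ≡ r
  %-unique {a} p r<n = ≋⇒≡ℕ (≋-trans (≋-sym (≋-% a)) p) (n%ℕd<d a n) r<n

  index-cong : ∀ {a b} → a ≋ b → index a ≡ index b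
  index-cong p = Finₚ.fromℕ<-cong _ _ (%-cong (≋-+ -1ℤ p)) _ _

  index-injective : ∀ {a b} → index a ≡ index b → a ≋ b
  index-injective {a} {b} e = subst₂ _≋_ (ℤₚ.suc-pred a) (ℤₚ.suc-pred b) (≋-+ 1ℤ (≋-trans (≋-% (pred a)) (≋-trans (≋-reflexive (cong +_ e′)) (≋-sym (≋-% (pred b))))))
    where
    e′ : pred a %ℕ n ≡ pred b %ℕ n
    e′ = trans (sym (Finₚ.toℕ-fromℕ< (n%ℕd<d (pred a) n))) (trans (cong toℕ e) (Finₚ.toℕ-fromℕ< (n%ℕd<d (pred b) n)))

  index-toℕ : ∀ a → index (1ℤ + + toℕ a) ≡ a
  index-toℕ a = trans (Finₚ.fromℕ<-cong _ _ (%-unique (≋-reflexive (ℤₚ.pred-suc (+ toℕ a))) (Finₚ.toℕ<n a)) _ (Finₚ.toℕ<n a)) (Finₚ.fromℕ<-toℕ a _)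

module Paths (n : ℕ) .{{nt : NonTrivial n}} {k : ℕ} (P : Periodic.𝒫 n k) where

  open Mod n
  open Residues n
  open Periodic n

  step-cong : ∀ {a b} → a ≋ b → P ⟦ a ⟧ ≡ P ⟦ b ⟧
  step-cong p = cong (𝒫.step P) (index-cong p)

  module Coordinate (co : Point → ℤ) (d : Step → ℤ) (D : ℤ)
    (co-⊕ : ∀ v x → co (v ⊕ direction x) ≡ co v + d x)
    (co-⊖ : ∀ v x → co (v ⊖ direction x) ≡ co v - d x)
    (co-0 : co (0ℤ , 0ℤ) ≡ 0ℤ)
    (d≥0 : ∀ x → 0ℤ ≤ d x)
    (total : sum (d ∘ 𝒫.step P) ≡ D)
    where

    Z : ℤ → ℤ
    Z j = co (vertex P j)

    Z-suc : ∀ j → Z (1ℤ + j) ≡ Z j + d (P ⟦ 1ℤ + j ⟧)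
    Z-suc (+ m) = co-⊕ _ _
    Z-suc -[1+ ℕ.zero ] = sym (trans (cong (_+ d (P ⟦ 0ℤ ⟧)) (co-⊖ (0ℤ , 0ℤ) (P ⟦ 0ℤ ⟧))) (l _ _))
      where
      l : ∀ x y → x - y + y ≡ x
      l = solve-∀
    Z-suc -[1+ ℕ.suc m ] = sym (trans (cong (_+ d (P ⟦ -[1+ m ] ⟧)) (co-⊖ (vertex P -[1+ m ]) (P ⟦ -[1+ m ] ⟧))) (l _ _))
      where
      l : ∀ x y → x - y + y ≡ x
      l = solve-∀

    Z-pred : ∀ j → Z j ≡ Z (pred j) + d (P ⟦ j ⟧)
    Z-pred j = subst (λ z → Z z ≡ Z (pred j) + d (P ⟦ z ⟧)) (ℤₚ.suc-pred j) (Z-suc (pred j))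

    Z-mono : ∀ {a b} → a ≤ b → Z a ≤ Z b
    Z-mono {a} p with ≤⇒+ p
    ... | m , refl = go m
      where
      go : ∀ m → Z a ≤ Z (a + + m)
      go ℕ.zero = ℤₚ.≤-reflexive (cong Z (sym (ℤₚ.+-identityʳ a)))
      go (ℕ.suc m) = ℤₚ.≤-trans (go m) (subst (Z (a + + m) ≤_) (trans (sym (Z-suc (a + + m))) (cong Z (l a (+ m))))
        (subst (_≤ Z (a + + m) + d (P ⟦ 1ℤ + (a + + m) ⟧)) (ℤₚ.+-identityʳ _) (ℤₚ.+-monoʳ-≤ (Z (a + + m)) (d≥0 _))))
        where
        l : ∀ a m → 1ℤ + (a + m) ≡ a + (1ℤ + m)
        l = solve-∀

    Z-sum : ∀ m → sum {m} (λ a → d (P ⟦ 1ℤ + + toℕ a ⟧)) ≡ Z (+ m)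
    Z-sum ℕ.zero = sym co-0
    Z-sum (ℕ.suc m) = trans (Sumℤ.sum-init-last {m} (λ a → d (P ⟦ 1ℤ + + toℕ a ⟧)))
      (trans (cong₂ _+_ (trans (Sumℤ.sum-cong-≗ {m} (λ a → cong (λ z → d (P ⟦ 1ℤ + + z ⟧)) (Finₚ.toℕ-inject₁ a))) (Z-sum m))
                        (cong (λ z → d (P ⟦ 1ℤ + + z ⟧)) (Finₚ.toℕ-fromℕ m)))
             (sym (Z-suc (+ m))))

    Z-N : Z N ≡ D
    Z-N = trans (sym (Z-sum n)) (trans (Sumℤ.sum-cong-≗ {n} (λ a → cong (d ∘ 𝒫.step P) (index-toℕ a))) total)

    Z-+N : ∀ j → Z (j + N) ≡ Z j + D
    Z-+N = ℤ-ind (λ j → Z (j + N) ≡ Z j + D)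
      (trans (cong Z (ℤₚ.+-identityˡ N)) (trans Z-N (sym (trans (cong (_+ D) co-0) (ℤₚ.+-identityˡ D)))))
      (λ j h → trans (next j) (trans (cong (_+ d (P ⟦ 1ℤ + j ⟧)) h) (trans (l (Z j) D (d (P ⟦ 1ℤ + j ⟧))) (cong (_+ D) (sym (Z-suc j))))))
      (λ j h → ℤ-group.∙-cancelʳ _ _ _ (trans (sym (next j)) (trans h (trans (cong (_+ D) (Z-suc j)) (l (Z j) (d (P ⟦ 1ℤ + j ⟧)) D)))))
      where
      l : ∀ a b c → a + b + c ≡ a + c + b
      l = solve-∀
      next : ∀ j → Z (1ℤ + j + N) ≡ Z (j + N) + d (P ⟦ 1ℤ + j ⟧)
      next j = trans (cong Z (ℤₚ.+-assoc 1ℤ j N)) (trans (Z-suc (j + N)) (cong (λ x → Z (j + N) + d x)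
        (step-cong (≋-+ 1ℤ (≋-+N j)))))

    Z-shift : ∀ j m → Z (j + m * N) ≡ Z j + m * D
    Z-shift j = ℤ-ind (λ m → Z (j + m * N) ≡ Z j + m * D)
      (trans (cong Z (z j N)) (sym (z (Z j) D)))
      (λ m h → trans (trans (cong Z (s′ j m N)) (Z-+N (j + m * N))) (trans (cong (_+ D) h) (sym (s′ (Z j) m D))))
      (λ m h → ℤ-group.∙-cancelʳ D _ _ (trans (trans (sym (Z-+N (j + m * N))) (cong Z (sym (s′ j m N)))) (trans h (s′ (Z j) m D))))
      where
      z : ∀ a x → a + 0ℤ * x ≡ a
      z a x = trans (cong (λ t → a + t) (ℤₚ.*-zeroˡ x)) (ℤₚ.+-identityʳ a)
      s′ : ∀ a m x → a + (1ℤ + m) * x ≡ a + m * x + x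
      s′ = solve-∀

  private
    0≤1 : 0ℤ ≤ 1ℤ
    0≤1 = +≤+ ℕ.z≤n
    dx≥0 : ∀ x → 0ℤ ≤ dx x
    dx≥0 R = 0≤1
    dx≥0 U = ℤₚ.≤-refl
    dy≥0 : ∀ x → 0ℤ ≤ dy x
    dy≥0 U = 0≤1
    dy≥0 R = ℤₚ.≤-refl

  open Coordinate proj₁ dx (+ n - + k) (λ _ _ → refl) (λ _ _ → refl) refl dx≥0 (𝒫.endX P) public
    using () renaming (Z to X; Z-suc to X-suc; Z-pred to X-pred; Z-mono to X-mono; Z-shift to X-shift)
  open Coordinate proj₂ dy (+ k) (λ _ _ → refl) (λ _ _ → refl) refl dy≥0 (𝒫.endY P) public
    using () renaming (Z to Y; Z-suc to Y-suc; Z-pred to Y-pred; Z-mono to Y-mono; Z-shift to Y-shift)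

  dx+dy : ∀ x → dx x + dy x ≡ 1ℤ
  dx+dy R = refl
  dx+dy U = refl

  X+Y : ∀ j → X j + Y j ≡ j
  X+Y = ℤ-ind (λ j → X j + Y j ≡ j) refl
    (λ j h → trans (next j) (cong (λ z → 1ℤ + z) h))
    (λ j h → trans (sym (ℤₚ.pred-suc _)) (trans (cong pred (trans (sym (next j)) h)) (ℤₚ.pred-suc j)))
    where
    l : ∀ a b c d → a + c + (b + d) ≡ (c + d) + (a + b)
    l = solve-∀
    next : ∀ j → X (1ℤ + j) + Y (1ℤ + j) ≡ 1ℤ + (X j + Y j)
    next j = trans (cong₂ _+_ (X-suc j) (Y-suc j)) (trans (l (X j) (Y j) (dx (P ⟦ 1ℤ + j ⟧)) (dy (P ⟦ 1ℤ + j ⟧))) (cong (_+ (X j + Y j)) (dx+dy (P ⟦ 1ℤ + j ⟧))))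

  X-R : ∀ {j} → P ⟦ j ⟧ ≡ R → X j ≡ X (pred j) + 1ℤ
  X-R {j} e = trans (X-pred j) (cong (λ x → X (pred j) + dx x) e)

  Y-U : ∀ {j} → P ⟦ j ⟧ ≡ U → Y j ≡ Y (pred j) + 1ℤ
  Y-U {j} e = trans (Y-pred j) (cong (λ x → Y (pred j) + dy x) e)

  X-after : ∀ {c j} → P ⟦ c ⟧ ≡ R → X (pred c) ≡ X j → j ≤ pred c
  X-after {c} {j} e x = ℤₚ.≮⇒≥ λ lt → ℤₚ.<-irrefl x (⇒< (subst (_≤ X j) (trans (X-R {c} e) (ℤₚ.+-comm (X (pred c)) 1ℤ)) (X-mono (subst (_≤ j) (ℤₚ.suc-pred c) (<⇒ lt)))))

infix 4 _≟ₛ_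
_≟ₛ_ : (x y : Step) → Dec (x ≡ y)
R ≟ₛ R = yes refl
R ≟ₛ U = no λ ()
U ≟ₛ R = no λ ()
U ≟ₛ U = yes refl

module _ {A : Set} {T : A → A → Set} where

  Star-deterministic : (∀ {a b c} → T a b → T a c → b ≡ c) → ∀ {a b c} → Star T a b → Star T a c → (∀ {d} → ¬ T b d) → (∀ {d} → ¬ T c d) → b ≡ c
  Star-deterministic det ε ε _ _ = refl
  Star-deterministic det ε (x ◅ _) ¬b _ = contradiction x ¬b
  Star-deterministic det (x ◅ _) ε _ ¬c = contradiction x ¬c
  Star-deterministic det (x ◅ t) (y ◅ u) ¬b ¬c with det x y
  ... | refl = Star-deterministic det t u ¬b ¬c

module Boxes (n : ℕ) .{{nt : NonTrivial n}} {k : ℕ} (P : Periodic.𝒫 n k) where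

  open Periodic n
  open Paths n P

  open Box

  horizontal′ : (b : Box P) → P ⟦ column b ⟧ ≡ R
  horizontal′ (box c h _) = recompute (P ⟦ c ⟧ ≟ₛ R) h

  box-≡ : {b b′ : Box P} → column b ≡ column b′ → height b ≡ height b′ → b ≡ b′
  box-≡ {box c _ h} {box .c _ .h} refl refl = refl

  cornerX : ∀ b → proj₁ (corner b) ≡ X (pred (column b))
  cornerX b = ℤₚ.+-identityʳ _

  corner-sum : ∀ b → proj₁ (corner b) + proj₂ (corner b) ≡ pred (column b) + + toℕ (height b)
  corner-sum b = trans (l (X c) (Y c) (+ toℕ (height b))) (cong (_+ + toℕ (height b)) (X+Y c))
    where
    c = pred (column b)
    l : ∀ a b h → a + 0ℤ + (b + h) ≡ a + b + h
    l = solve-∀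

  corner-injective : ∀ {b b′} → corner b ≡ corner b′ → b ≡ b′
  corner-injective {b} {b′} e = box-≡ c≡ (Finₚ.toℕ-injective (ℤₚ.+-injective (ℤ-group.∙-cancelˡ (pred (column b)) _ _ s≡)))
    where
    x≡ : X (pred (column b)) ≡ X (pred (column b′))
    x≡ = trans (sym (cornerX b)) (trans (cong proj₁ e) (cornerX b′))
    p≡ : pred (column b) ≡ pred (column b′)
    p≡ = ℤₚ.≤-antisym (X-after {column b′} (horizontal′ b′) (sym x≡)) (X-after {column b} (horizontal′ b) x≡)
    c≡ : column b ≡ column b′
    c≡ = trans (sym (ℤₚ.suc-pred _)) (trans (cong suc p≡) (ℤₚ.suc-pred _))
    s≡ : pred (column b) + + toℕ (height b) ≡ pred (column b) + + toℕ (height b′)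
    s≡ = trans (sym (corner-sum b)) (trans (cong (λ v → proj₁ v + proj₂ v) e) (trans (corner-sum b′) (cong (_+ _) (sym p≡))))

  vertex-sum : Point → ℤ
  vertex-sum (x , y) = x + y

  sum-⊕ : ∀ v w → vertex-sum (v ⊕ w) ≡ vertex-sum v + vertex-sum w
  sum-⊕ (a , b) (c , d) = l a b c d
    where
    l : ∀ a b c d → a + c + (b + d) ≡ a + b + (c + d)
    l = solve-∀

  south-injective : ∀ {i j} → south P i ≡ south P j → i ≡ j
  south-injective {i} {j} e = trans (sym (ℤₚ.suc-pred i)) (trans (cong suc (trans (sym (X+Y (pred i))) (trans (cong (vertex-sum ∘ proj₁) e) (X+Y (pred j))))) (ℤₚ.suc-pred j))

  north-sum : ∀ j → vertex-sum (proj₁ (north P j)) ≡ pred j + + k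
  north-sum j = trans (sum-⊕ (vertex P (pred j)) (0ℤ , + k)) (cong₂ _+_ (X+Y (pred j)) (ℤₚ.+-identityˡ (+ k)))

  north-injective : ∀ {i j} → north P i ≡ north P j → i ≡ j
  north-injective {i} {j} e = trans (sym (ℤₚ.suc-pred i)) (trans (cong suc (ℤ-group.∙-cancelʳ (+ k) (pred i) (pred j)
    (trans (sym (north-sum i)) (trans (cong (vertex-sum ∘ proj₁) e) (north-sum j))))) (ℤₚ.suc-pred j))

  height< : ∀ (b : Box P) → 1ℤ + + toℕ (height b) ≤ + k
  height< b = +≤+ (Finₚ.toℕ<n (height b))

  south≢entry : ∀ b en j → entry P b en ≢ south P j
  south≢entry b fromLeft j e = contradiction (trans (sym (horizontal′ b)) (trans (cong (P ⟦_⟧) c≡j) (sym (cong proj₂ e)))) λ ()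
    where
    sums : pred (column b) + + toℕ (height b) ≡ pred j
    sums = trans (sym (corner-sum b)) (trans (cong (vertex-sum ∘ proj₁) e) (X+Y (pred j)))
    j≤c : pred j ≤ pred (column b)
    j≤c = X-after {column b} (horizontal′ b) (trans (sym (cornerX b)) (cong (proj₁ ∘ proj₁) e))
    c≡j : column b ≡ j
    c≡j = trans (sym (ℤₚ.suc-pred _)) (trans (cong suc (ℤₚ.≤-antisym (subst (pred (column b) ≤_) sums (ℤₚ.i≤i+j _ (+ toℕ (height b)))) j≤c)) (ℤₚ.suc-pred j))
  south≢entry b fromTop j e = ℤₚ.<⇒≱ (⇒< (subst (1ℤ + pred (column b) ≤_) sums (≤-by (0≤+ {toℕ (height b)}) (l (pred (column b)) (+ toℕ (height b)))))) j≤c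
    where
    l : ∀ c h → c + h + 1ℤ - (1ℤ + c) ≡ h - 0ℤ
    l = solve-∀
    sums : pred (column b) + + toℕ (height b) + 1ℤ ≡ pred j
    sums = trans (sym (trans (sum-⊕ (corner b) (0ℤ , 1ℤ)) (cong (_+ 1ℤ) (corner-sum b)))) (trans (cong (vertex-sum ∘ proj₁) e) (X+Y (pred j)))
    j≤c : pred j ≤ pred (column b)
    j≤c = X-after {column b} (horizontal′ b) (trans (sym (trans (ℤₚ.+-identityʳ _) (cornerX b))) (cong (proj₁ ∘ proj₁) e))

  north≢exit : ∀ b ex j → exit P b ex ≢ north P j
  north≢exit b toBottom j e = ℤₚ.<-irrefl sums (⇒< (≤-by₂ {pred (column b)} {pred j} c≤j (height< b) (l (pred (column b)) (+ toℕ (height b)) (pred j) (+ k))))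
    where
    l : ∀ c h j k → j + k - (1ℤ + (c + h)) ≡ (j - c) + (k - (1ℤ + h))
    l = solve-∀
    sums : pred (column b) + + toℕ (height b) ≡ pred j + + k
    sums = trans (sym (corner-sum b)) (trans (cong (vertex-sum ∘ proj₁) e) (north-sum j))
    c≤j : pred (column b) ≤ pred j
    c≤j = X-after {j} (sym (cong proj₂ e)) (trans (sym (trans (cong (proj₁ ∘ proj₁) e) (ℤₚ.+-identityʳ _))) (cornerX b))
  north≢exit b toRight j e = ℤₚ.<-irrefl sums (⇒< (≤-by₂ c≤j (height< b) (l (pred (column b)) (+ toℕ (height b)) (pred j) (+ k))))
    where
    l : ∀ c h j k → j + k - (1ℤ + (c + h + 1ℤ)) ≡ (j - (1ℤ + c)) + (k - (1ℤ + h))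
    l = solve-∀
    c = pred (column b)
    sums : c + + toℕ (height b) + 1ℤ ≡ pred j + + k
    sums = trans (sym (trans (sum-⊕ (corner b) (1ℤ , 0ℤ)) (cong (_+ 1ℤ) (corner-sum b)))) (trans (cong (vertex-sum ∘ proj₁) e) (north-sum j))
    x≡ : X c + 1ℤ ≡ X (pred j)
    x≡ = trans (sym (cong (_+ 1ℤ) (cornerX b))) (trans (cong (proj₁ ∘ proj₁) e) (ℤₚ.+-identityʳ _))
    c≤j : 1ℤ + c ≤ pred j
    c≤j = <⇒ (ℤₚ.≰⇒> λ le → ℤₚ.<⇒≱ (⇒< {X c} (ℤₚ.≤-reflexive (trans (ℤₚ.+-comm 1ℤ (X c)) x≡))) (X-mono {pred j} {c} le))

  ⊕-cancelʳ : ∀ v w u → v ⊕ u ≡ w ⊕ u → v ≡ w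
  ⊕-cancelʳ (a , b) (c , d) (x , y) e = cong₂ _,_ (ℤ-group.∙-cancelʳ x a c (cong proj₁ e)) (ℤ-group.∙-cancelʳ y b d (cong proj₂ e))

  entry-injective : ∀ {b en b′ en′} → entry P b en ≡ entry P b′ en′ → b ≡ b′ × en ≡ en′
  entry-injective {en = fromLeft} {en′ = fromLeft} e = corner-injective (cong proj₁ e) , refl
  entry-injective {en = fromLeft} {en′ = fromTop}  e = contradiction (cong proj₂ e) λ ()
  entry-injective {en = fromTop}  {en′ = fromLeft} e = contradiction (cong proj₂ e) λ ()
  entry-injective {en = fromTop}  {en′ = fromTop}  e = corner-injective (⊕-cancelʳ _ _ _ (cong proj₁ e)) , refl

  exit-injective : ∀ {b ex b′ ex′} → exit P b ex ≡ exit P b′ ex′ → b ≡ b′ × ex ≡ ex′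
  exit-injective {ex = toRight}  {ex′ = toRight}  e = corner-injective (⊕-cancelʳ _ _ _ (cong proj₁ e)) , refl
  exit-injective {ex = toRight}  {ex′ = toBottom} e = contradiction (cong proj₂ e) λ ()
  exit-injective {ex = toBottom} {ex′ = toRight}  e = contradiction (cong proj₂ e) λ ()
  exit-injective {ex = toBottom} {ex′ = toBottom} e = corner-injective (cong proj₁ e) , refl

  route-injective : ∀ c {en en′} → route c en ≡ route c en′ → en ≡ en′
  route-injective crossing {fromLeft} {fromLeft} _ = refl
  route-injective crossing {fromTop}  {fromTop}  _ = refl
  route-injective elbow    {fromLeft} {fromLeft} _ = refl
  route-injective elbow    {fromTop}  {fromTop}  _ = refl

module Strands (n : ℕ) .{{nt : NonTrivial n}} {k : ℕ} {P : Periodic.𝒫 n k} (F : Periodic.Filling n P) where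

  open Periodic n
  open Paths n P
  open Boxes n P
  open Filling F

  Pass-view : ∀ {e e′} → Pass F e e′ → ∃₂ λ b en → e ≡ entry P b en × e′ ≡ exit P b (route (tile b) en)
  Pass-view (pass b en) = b , en , refl , refl

  Pass-deterministic : ∀ {a b c} → Pass F a b → Pass F a c → b ≡ c
  Pass-deterministic p q with Pass-view p | Pass-view q
  ... | b , en , refl , refl | b′ , en′ , e , refl with entry-injective {b} {en} {b′} {en′} e
  ... | refl , refl = refl

  Pass-codeterministic : ∀ {a b c} → Pass F b a → Pass F c a → b ≡ c
  Pass-codeterministic p q with Pass-view p | Pass-view q
  ... | b , en , refl , refl | b′ , en′ , refl , e with exit-injective {b} {_} {b′} e
  ... | refl , e′ with route-injective (tile b) e′
  ... | refl = refl

  south-last : ∀ {j e} → ¬ Pass F (south P j) e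
  south-last {j} p with Pass-view p
  ... | b , en , e , _ = south≢entry b en j (sym e)

  north-first : ∀ {j e} → ¬ Pass F e (north P j)
  north-first {j} p with Pass-view p
  ... | b , en , _ , e = north≢exit b _ j (sym e)

  target-unique : ∀ {i j j′} → Strand F (north P i) (south P j) → Strand F (north P i) (south P j′) → j ≡ j′
  target-unique {j = j} {j′} t u = south-injective (Star-deterministic Pass-deterministic t u (south-last {j}) (south-last {j′}))

  source-unique : ∀ {e i i′} → Strand F (north P i) e → Strand F (north P i′) e → i ≡ i′
  source-unique {i = i} {i′} t u = north-injective (Star-deterministic Pass-codeterministic (rev t) (rev u) (north-first {i}) (north-first {i′}))
    where
    rev : ∀ {e e′} → Strand F e e′ → Star (flip (Pass F)) e′ e
    rev = reverse id

  -- lev numbers the antidiagonals and drops by one in every box; wid is twice the abscissa of the midpoint of an edge.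
  lev wid : Edge → ℤ
  lev ((x , y) , s) = y - x - dx s
  wid ((x , y) , s) = x + x + dx s

  level : Point → ℤ
  level (x , y) = y - x

  lev-entry : ∀ b en → lev (entry P b en) ≡ level (Box.corner b)
  lev-entry b fromLeft = l (proj₁ (Box.corner b)) (proj₂ (Box.corner b))
    where
    l : ∀ x y → y - x - 0ℤ ≡ y - x
    l = solve-∀
  lev-entry b fromTop = l (proj₁ (Box.corner b)) (proj₂ (Box.corner b))
    where
    l : ∀ x y → y + 1ℤ - (x + 0ℤ) - 1ℤ ≡ y - x
    l = solve-∀

  lev-exit : ∀ b ex → lev (exit P b ex) ≡ level (Box.corner b) - 1ℤ
  lev-exit b toBottom = refl
  lev-exit b toRight = l (proj₁ (Box.corner b)) (proj₂ (Box.corner b))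
    where
    l : ∀ x y → y + 0ℤ - (x + 1ℤ) - 0ℤ ≡ y - x - 1ℤ
    l = solve-∀

  entryWid : Entry → ℤ
  entryWid fromLeft = 0ℤ
  entryWid fromTop = 1ℤ

  exitWid : Exit → ℤ
  exitWid toBottom = 1ℤ
  exitWid toRight = + 2

  wid-entry : ∀ b en → wid (entry P b en) ≡ proj₁ (Box.corner b) + proj₁ (Box.corner b) + entryWid en
  wid-entry b fromLeft = refl
  wid-entry b fromTop = l (proj₁ (Box.corner b))
    where
    l : ∀ x → x + 0ℤ + (x + 0ℤ) + 1ℤ ≡ x + x + 1ℤ
    l = solve-∀

  wid-exit : ∀ b ex → wid (exit P b ex) ≡ proj₁ (Box.corner b) + proj₁ (Box.corner b) + exitWid ex
  wid-exit b toBottom = refl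
  wid-exit b toRight = l (proj₁ (Box.corner b))
    where
    l : ∀ x → x + 1ℤ + (x + 1ℤ) + 0ℤ ≡ x + x + + 2
    l = solve-∀

-- Parity of crossings

module Parity (n : ℕ) .{{nt : NonTrivial n}} {k : ℕ} {P : Periodic.𝒫 n k} (F : Periodic.Filling n P) where

  open Periodic n
  open Paths n P
  open Boxes n P
  open Filling F
  open Strands n F

  common : List Point → List Point → ℕ
  common xs ys = length (filter (λ p → member? _≟ₚ_ p ys) xs)

  common-∷ˡ-∉ : ∀ {p xs} ys → p ∉ ys → common (p ∷ xs) ys ≡ common xs ys
  common-∷ˡ-∉ ys h = cong length (filter-reject (λ p → member? _≟ₚ_ p ys) h)

  common-∷ˡ-∈ : ∀ {p xs} ys → p ∈ ys → common (p ∷ xs) ys ≡ ℕ.suc (common xs ys)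
  common-∷ˡ-∈ ys h = cong length (filter-accept (λ p → member? _≟ₚ_ p ys) h)

  common-∷ʳ : ∀ {p} xs ys → p ∉ xs → common xs (p ∷ ys) ≡ common xs ys
  common-∷ʳ [] ys h = refl
  common-∷ʳ {p} (x ∷ xs) ys h = go (member? _≟ₚ_ x ys)
    where
    ih : common xs (p ∷ ys) ≡ common xs ys
    ih = common-∷ʳ xs ys (h ∘ there)
    go : Dec (x ∈ ys) → common (x ∷ xs) (p ∷ ys) ≡ common (x ∷ xs) ys
    go (yes m) = trans (common-∷ˡ-∈ {x} {xs} (p ∷ ys) (there m)) (trans (cong ℕ.suc ih) (sym (common-∷ˡ-∈ {x} {xs} ys m)))
    go (no m)  = trans (common-∷ˡ-∉ {x} {xs} (p ∷ ys) λ { (here refl) → h (here refl) ; (there t) → m t }) (trans ih (sym (common-∷ˡ-∉ {x} {xs} ys m)))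

  -1< : ∀ x → x - 1ℤ < x
  -1< x = ℤₚ.i≤pred[j]⇒i<j (ℤₚ.≤-reflexive (ℤₚ.+-comm x -1ℤ))

  lev-step : ∀ b en ex → lev (exit P b ex) < lev (entry P b en)
  lev-step b en ex = subst₂ _<_ (sym (lev-exit b ex)) (sym (lev-entry b en)) (-1< (level (Box.corner b)))

  Strand-lev : ∀ {e e′} → Strand F e e′ → lev e′ ≤ lev e
  Strand-lev ε = ℤₚ.≤-refl
  Strand-lev (pass b en ◅ t) = ℤₚ.≤-trans (Strand-lev t) (ℤₚ.<⇒≤ (lev-step b en (route (tile b) en)))

  Below : ℤ → List Point → Set
  Below m = All (λ p → level p ≤ m)

  crossings-below : ∀ {e e′ m} (t : Strand F e e′) → lev e ≤ m → Below m (crossings F t)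
  crossings-below ε h = []
  crossings-below {m = m} (pass b en ◅ t) h = record-below (tile b)
    (crossings-below t (ℤₚ.≤-trans (ℤₚ.<⇒≤ (lev-step b en (route (tile b) en))) h))
    where
    record-below : ∀ c {ps} → Below m ps → Below m (recordCrossing F b c ps)
    record-below crossing h′ = subst (_≤ m) (lev-entry b en) h ∷ h′
    record-below elbow    h′ = h′

  below⇒∉ : ∀ {p m ps} → Below m ps → m < level p → p ∉ ps
  below⇒∉ h lt p∈ = ℤₚ.<⇒≱ lt (All.lookup h p∈)

  after-box : ∀ {b ex e} (t : Strand F (exit P b ex) e) → Box.corner b ∉ crossings F t
  after-box {b} {ex} t = below⇒∉ (crossings-below t ℤₚ.≤-refl) (subst (_< level (Box.corner b)) (sym (lev-exit b ex)) (-1< (level (Box.corner b))))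

  -- Side true e e′ says that e comes first along the antidiagonal containing both edges.
  Side : Bool → Edge → Edge → Set
  Side true  e e′ = wid e < wid e′
  Side false e e′ = wid e′ < wid e

  flips : ℕ → Bool → Bool
  flips ℕ.zero    x = x
  flips (ℕ.suc m) x = flips m (not x)

  turn : Tile → Bool → Bool
  turn crossing x = not x
  turn elbow    x = x

  side-entries : ∀ b {x} → Side x (entry P b fromLeft) (entry P b fromTop) → x ≡ true
  side-entries b {true} _ = refl
  side-entries b {false} lt = contradiction (subst₂ _<_ (wid-entry b fromTop) (wid-entry b fromLeft) lt) (ℤₚ.≤⇒≯ (ℤₚ.+-monoʳ-≤ (proj₁ (Box.corner b) + proj₁ (Box.corner b)) {0ℤ} {1ℤ} 0≤+))

  sides-entries : ∀ b {x} → Side x (entry P b fromTop) (entry P b fromLeft) → x ≡ false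
  sides-entries b {false} _ = refl
  sides-entries b {true} lt = contradiction (subst₂ _<_ (wid-entry b fromTop) (wid-entry b fromLeft) lt) (ℤₚ.≤⇒≯ (ℤₚ.+-monoʳ-≤ (proj₁ (Box.corner b) + proj₁ (Box.corner b)) {0ℤ} {1ℤ} 0≤+))

  exits< : ∀ b → wid (exit P b toBottom) < wid (exit P b toRight)
  exits< b = subst₂ _<_ (sym (wid-exit b toBottom)) (sym (wid-exit b toRight)) (ℤₚ.+-monoʳ-< (proj₁ (Box.corner b) + proj₁ (Box.corner b)) {1ℤ} {+ 2} (+<+ (ℕ.s≤s (ℕ.s≤s ℕ.z≤n))))

  Side-irrefl : ∀ x e → ¬ Side x e e
  Side-irrefl true  e = ℤₚ.<-irrefl refl
  Side-irrefl false e = ℤₚ.<-irrefl refl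

  same-box : ∀ b c en en′ {x} → Side x (entry P b en) (entry P b en′) → Side (turn c x) (exit P b (route c en)) (exit P b (route c en′))
  same-box b c fromLeft fromLeft {x} h = contradiction h (Side-irrefl x (entry P b fromLeft))
  same-box b c fromTop  fromTop  {x} h = contradiction h (Side-irrefl x (entry P b fromTop))
  same-box b c fromLeft fromTop  {x} h with side-entries b {x} h
  same-box b crossing fromLeft fromTop h | refl = exits< b
  same-box b elbow    fromLeft fromTop h | refl = exits< b
  same-box b c fromTop fromLeft  {x} h with sides-entries b {x} h
  same-box b crossing fromTop fromLeft h | refl = exits< b
  same-box b elbow    fromTop fromLeft h | refl = exits< b

  entry≥ : ∀ b en → proj₁ (Box.corner b) + proj₁ (Box.corner b) ≤ wid (entry P b en)
  entry≥ b en = subst (_ ≤_) (sym (wid-entry b en)) (subst (_≤ proj₁ (Box.corner b) + proj₁ (Box.corner b) + entryWid en) (ℤₚ.+-identityʳ _) (ℤₚ.+-monoʳ-≤ (proj₁ (Box.corner b) + proj₁ (Box.corner b)) (go en)))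
    where
    go : ∀ en → 0ℤ ≤ entryWid en
    go fromLeft = 0≤+
    go fromTop = 0≤+

  entry≤ : ∀ b en → wid (entry P b en) ≤ proj₁ (Box.corner b) + proj₁ (Box.corner b) + 1ℤ
  entry≤ b en = subst (_≤ _) (sym (wid-entry b en)) (ℤₚ.+-monoʳ-≤ (proj₁ (Box.corner b) + proj₁ (Box.corner b)) (go en))
    where
    go : ∀ en → entryWid en ≤ 1ℤ
    go fromLeft = 0≤+
    go fromTop = ℤₚ.≤-refl

  exit≥ : ∀ b ex → proj₁ (Box.corner b) + proj₁ (Box.corner b) + 1ℤ ≤ wid (exit P b ex)
  exit≥ b ex = subst (_ ≤_) (sym (wid-exit b ex)) (ℤₚ.+-monoʳ-≤ (proj₁ (Box.corner b) + proj₁ (Box.corner b)) (go ex))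
    where
    go : ∀ ex → 1ℤ ≤ exitWid ex
    go toRight = +≤+ (ℕ.s≤s ℕ.z≤n)
    go toBottom = ℤₚ.≤-refl

  exit≤ : ∀ b ex → wid (exit P b ex) ≤ proj₁ (Box.corner b) + proj₁ (Box.corner b) + + 2
  exit≤ b ex = subst (_≤ _) (sym (wid-exit b ex)) (ℤₚ.+-monoʳ-≤ (proj₁ (Box.corner b) + proj₁ (Box.corner b)) (go ex))
    where
    go : ∀ ex → exitWid ex ≤ + 2
    go toRight = ℤₚ.≤-refl
    go toBottom = +≤+ (ℕ.s≤s ℕ.z≤n)

  pass-wid : ∀ b en ex → wid (entry P b en) ≤ wid (exit P b ex) × wid (exit P b ex) ≤ wid (entry P b en) + + 2
  pass-wid b en ex = ℤₚ.≤-trans (entry≤ b en) (exit≥ b ex) , ℤₚ.≤-trans (exit≤ b ex) (ℤₚ.+-monoˡ-≤ (+ 2) (entry≥ b en))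

  -- On a common antidiagonal distinct boxes have distinct abscissas.
  order-boxes : ∀ b b′ en en′ ex ex′ → level (Box.corner b) ≡ level (Box.corner b′) → Box.corner b ≢ Box.corner b′ →
    wid (entry P b en) < wid (entry P b′ en′) → wid (exit P b ex) < wid (exit P b′ ex′)
  order-boxes b b′ en en′ ex ex′ l≡ c≢ lt = ⇒< (ℤₚ.≤-trans (ℤₚ.+-monoʳ-≤ 1ℤ (exit≤ b ex)) (ℤₚ.≤-trans (≤-by₂ x<x′ x<x′ (l x x′)) (exit≥ b′ ex′)))
    where
    x  = proj₁ (Box.corner b)
    x′ = proj₁ (Box.corner b′)
    l : ∀ x x′ → x′ + x′ + 1ℤ - (1ℤ + (x + x + + 2)) ≡ (x′ - (1ℤ + x)) + (x′ - (1ℤ + x))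
    l = solve-∀
    x≢ : x ≢ x′
    x≢ e = c≢ (cong₂ _,_ e (ℤ-group.∙-cancelʳ (- x) (proj₂ (Box.corner b)) (proj₂ (Box.corner b′)) (trans l≡ (cong (λ z → proj₂ (Box.corner b′) - z) (sym e)))))
    2x≤ : x + x ≤ x′ + x′
    2x≤ = ≤-by {1ℤ + (x + x)} {x′ + x′ + 1ℤ} (ℤₚ.≤-trans (ℤₚ.+-monoʳ-≤ 1ℤ (entry≥ b en)) (ℤₚ.≤-trans (<⇒ lt) (entry≤ b′ en′))) (l₂ (x + x) (x′ + x′))
      where
      l₂ : ∀ a b → b - a ≡ b + 1ℤ - (1ℤ + a)
      l₂ = solve-∀
    x<x′ : 1ℤ + x ≤ x′
    x<x′ = <⇒ (ℤₚ.≤∧≢⇒< (ℤₚ.≮⇒≥ λ gt → ℤₚ.<⇒≱ (ℤₚ.+-mono-< {x′} {x} {x′} {x} gt gt) 2x≤) x≢)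

  order-boxes′ : ∀ x b b′ en en′ ex ex′ → level (Box.corner b) ≡ level (Box.corner b′) → Box.corner b ≢ Box.corner b′ →
    Side x (entry P b en) (entry P b′ en′) → Side x (exit P b ex) (exit P b′ ex′)
  order-boxes′ true  b b′ en en′ ex ex′ l≡ c≢ = order-boxes b b′ en en′ ex ex′ l≡ c≢
  order-boxes′ false b b′ en en′ ex ex′ l≡ c≢ = order-boxes b′ b en′ en ex′ ex (sym l≡) (c≢ ∘ sym)

  flips-same : ∀ b c {xs ys} x → Box.corner b ∉ xs → flips (common (recordCrossing F b c xs) (recordCrossing F b c ys)) x ≡ flips (common xs ys) (turn c x)
  flips-same b elbow x h = refl
  flips-same b crossing {xs} {ys} x h = cong (λ m → flips m x) (trans (common-∷ˡ-∈ {Box.corner b} {xs} (Box.corner b ∷ ys) (here refl)) (cong ℕ.suc (common-∷ʳ xs ys h)))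

  common-recordˡ : ∀ b c {xs ys} → Box.corner b ∉ ys → common (recordCrossing F b c xs) ys ≡ common xs ys
  common-recordˡ b crossing {ys = ys} h = common-∷ˡ-∉ ys h
  common-recordˡ b elbow h = refl

  common-recordʳ : ∀ b c {xs ys} → Box.corner b ∉ xs → common xs (recordCrossing F b c ys) ≡ common xs ys
  common-recordʳ b crossing {xs} {ys} h = common-∷ʳ xs ys h
  common-recordʳ b elbow h = refl

  ∉-record : ∀ {b p xs} c → p ≢ Box.corner b → p ∉ xs → p ∉ recordCrossing F b c xs
  ∉-record crossing p≢ p∉ (here e) = p≢ e
  ∉-record crossing p≢ p∉ (there m) = p∉ m
  ∉-record elbow    p≢ p∉ m = p∉ m

  in-step : ∀ {e₁ e₁′ e₂ e₂′} (t : Strand F e₁ e₁′) (u : Strand F e₂ e₂′) → lev e₁ ≡ lev e₂ → lev e₁′ ≡ lev e₂′ →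
    ∀ x → Side x e₁ e₂ → Side (flips (commonCrossings F t u) x) e₁′ e₂′
  in-step ε ε _ _ x h = h
  in-step ε (pass b en ◅ u) l l′ x h = contradiction (trans (sym l′) l) (ℤₚ.<⇒≢ (ℤₚ.≤-<-trans (Strand-lev u) (lev-step b en (route (tile b) en))))
  in-step (pass b en ◅ t) ε l l′ x h = contradiction (trans l′ (sym l)) (ℤₚ.<⇒≢ (ℤₚ.≤-<-trans (Strand-lev t) (lev-step b en (route (tile b) en))))
  in-step {e₁′ = e₁′} {e₂′ = e₂′} (pass b en ◅ t) (pass b′ en′ ◅ u) l l′ x h with Box.corner b ≟ₚ Box.corner b′
  ... | yes e with corner-injective {b} {b′} e
  ...   | refl = subst (λ y → Side y e₁′ e₂′) (sym (flips-same b (tile b) x (after-box {b} {route (tile b) en} t)))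
                   (in-step t u (trans (lev-exit b (route (tile b) en)) (sym (lev-exit b (route (tile b) en′)))) l′ (turn (tile b) x) (same-box b (tile b) en en′ h))
  in-step {e₁′ = e₁′} {e₂′ = e₂′} (pass b en ◅ t) (pass b′ en′ ◅ u) l l′ x h | no ne =
    subst (λ m → Side (flips m x) e₁′ e₂′)
      (sym (trans (common-recordˡ b (tile b) b∉u′) (common-recordʳ b′ (tile b′) b′∉t)))
      (in-step t u (trans (lev-exit b (route (tile b) en)) (trans (cong (_- 1ℤ) lv) (sym (lev-exit b′ (route (tile b′) en′))))) l′ x (order-boxes′ x b b′ en en′ (route (tile b) en) (route (tile b′) en′) lv ne h))
    where
    lv : level (Box.corner b) ≡ level (Box.corner b′)
    lv = trans (sym (lev-entry b en)) (trans l (lev-entry b′ en′))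
    below : ∀ b b′ ex {e} → level (Box.corner b) ≡ level (Box.corner b′) → (t : Strand F (exit P b ex) e) → Box.corner b′ ∉ crossings F t
    below b b′ ex lv t = below⇒∉ (crossings-below t ℤₚ.≤-refl) (subst₂ _<_ (sym (lev-exit b ex)) lv (-1< (level (Box.corner b))))
    b′∉t : Box.corner b′ ∉ crossings F t
    b′∉t = below b b′ (route (tile b) en) lv t
    b∉u′ : Box.corner b ∉ recordCrossing F b′ (tile b′) (crossings F u)
    b∉u′ = ∉-record (tile b′) ne (below b′ b (route (tile b′) en′) (sym lv) u)

  Bounds : Bool → ℤ → ℤ → ℤ → ℤ → Set
  Bounds true  w l v m = w ≤ v × w + (l + l) ≤ v + (m + m)
  Bounds false w l v m = v ≤ w × v + (m + m) ≤ w + (l + l)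

  -- Within true e e′ says that e lies weakly southwest of e′.
  Within : Bool → Edge → Edge → Set
  Within x e e′ = Bounds x (wid e) (lev e) (wid e′) (lev e′)

  edge-≡ : ∀ {e e′} → wid e ≡ wid e′ → lev e ≡ lev e′ → e ≡ e′
  edge-≡ {(x , y) , s} {(x′ , y′) , s′} w l = go s s′ w l
    where
    double : ∀ x x′ → x + x ≡ x′ + x′ → x ≡ x′
    double x x′ e = ℤₚ.*-cancelʳ-≡ x x′ (+ 2) (trans (l₁ x) (trans e (sym (l₁ x′))))
      where
      l₁ : ∀ x → x * + 2 ≡ x + x
      l₁ = solve-∀
    odd : ∀ x x′ → ¬ x + x + 1ℤ ≡ x′ + x′ + 0ℤ
    odd x x′ e = contradiction (ℕ∣.∣⇒≤ (ℕ∣.divides ∣ x′ - x ∣ (trans (cong ∣_∣ 1≡) (ℤₚ.abs-* (x′ - x) (+ 2))))) λ { (ℕ.s≤s ()) }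
      where
      l₁ : ∀ x x′ → (x′ - x) * + 2 ≡ x′ + x′ + 0ℤ - (x + x)
      l₁ = solve-∀
      l₂ : ∀ x → x + x + 1ℤ - (x + x) ≡ 1ℤ
      l₂ = solve-∀
      1≡ : 1ℤ ≡ (x′ - x) * + 2
      1≡ = sym (trans (l₁ x x′) (trans (cong (_- (x + x)) (sym e)) (l₂ x)))
    same : ∀ s → x + x + dx s ≡ x′ + x′ + dx s → y - x - dx s ≡ y′ - x′ - dx s → ((x , y) , s) ≡ ((x′ , y′) , s)
    same s w l with double x x′ (ℤ-group.∙-cancelʳ (dx s) (x + x) (x′ + x′) w)
    ... | refl with ℤ-group.∙-cancelʳ (- x) y y′ (ℤ-group.∙-cancelʳ (- dx s) (y - x) (y′ - x) l)
    ...   | refl = refl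
    go : ∀ s s′ → x + x + dx s ≡ x′ + x′ + dx s′ → y - x - dx s ≡ y′ - x′ - dx s′ → ((x , y) , s) ≡ ((x′ , y′) , s′)
    go R R = same R
    go U U = same U
    go R U w l = contradiction w (odd x x′)
    go U R w l = contradiction (sym w) (odd x′ x)

  Within⇒Side : ∀ x {e e′} → lev e ≡ lev e′ → e ≢ e′ → Within x e e′ → Side x e e′
  Within⇒Side true  l ne (h , _) = ℤₚ.≤∧≢⇒< h λ w → ne (edge-≡ w l)
  Within⇒Side false l ne (h , _) = ℤₚ.≤∧≢⇒< h λ w → ne (edge-≡ (sym w) l)

  Within-flip : ∀ x {e e′} → Within x e e′ → Within (not x) e′ e
  Within-flip true  h = h
  Within-flip false h = h

  Within-step : ∀ x b en ex {e} → lev e < lev (entry P b en) → Within x (entry P b en) e → Within x (exit P b ex) e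
  Within-step x b en ex {e} lt = go x {wid (entry P b en)} {wid (exit P b ex)} {lev (entry P b en)} {lev (exit P b ex)} {wid e} {lev e} (<⇒ lt) (pass-wid b en ex) (trans (lev-exit b ex) (cong (_- 1ℤ) (sym (lev-entry b en))))
    where
    go : ∀ x {w w′ l l′ v m} → 1ℤ + m ≤ l → w ≤ w′ × w′ ≤ w + + 2 → l′ ≡ l - 1ℤ →
         Bounds x w l v m → Bounds x w′ l′ v m
    go true {w} {w′} {l} {_} {v} {m} m<l (w≤w′ , w′≤w+2) refl (_ , h) =
      ≤-by₂ (ℤₚ.≤-trans (ℤₚ.+-monoˡ-≤ (l + l) w′≤w+2) (ℤₚ.≤-trans (ℤₚ.≤-reflexive (l₁ w l)) (ℤₚ.+-monoˡ-≤ (+ 2) h))) (ℤₚ.+-mono-≤ m<l m<l) (l₂ w′ l v m) ,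
      ≤-by₂ w′≤w+2 h (l₃ w w′ l v m)
      where
      l₁ : ∀ w l → w + + 2 + (l + l) ≡ w + (l + l) + + 2
      l₁ = solve-∀
      l₂ : ∀ w′ l v m → v - w′ ≡ (v + (m + m) + + 2 - (w′ + (l + l))) + (l + l - (1ℤ + m + (1ℤ + m)))
      l₂ = solve-∀
      l₃ : ∀ w w′ l v m → v + (m + m) - (w′ + (l - 1ℤ + (l - 1ℤ))) ≡ (w + + 2 - w′) + (v + (m + m) - (w + (l + l)))
      l₃ = solve-∀
    go false {w} {w′} {l} {_} {v} {m} m<l (w≤w′ , w′≤w+2) refl (h , _) =
      ℤₚ.≤-trans h w≤w′ ,
      ≤-by₂ (ℤₚ.≤-trans h w≤w′) (ℤₚ.+-mono-≤ m<l m<l) (l₁ w′ l v m)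
      where
      l₁ : ∀ w′ l v m → w′ + (l - 1ℤ + (l - 1ℤ)) - (v + (m + m)) ≡ (w′ - v) + (l + l - (1ℤ + m + (1ℤ + m)))
      l₁ = solve-∀

  -- The strand entering on the higher antidiagonal is followed until both are level; it stays on its side of the other's entry.
  catch-upˡ : ∀ {e₁ e₁′ e₂ e₂′} (t : Strand F e₁ e₁′) (u : Strand F e₂ e₂′) → lev e₂ ≤ lev e₁ → lev e₁′ ≡ lev e₂′ →
    (∀ {a} → ¬ Pass F a e₂) → e₁ ≢ e₂ → ∀ x → Within x e₁ e₂ → Side (flips (commonCrossings F t u) x) e₁′ e₂′
  catch-upˡ {e₁} {e₁′} {e₂} {e₂′} t u le l′ src ne x h with lev e₁ ≟ lev e₂
  catch-upˡ t u le l′ src ne x h | yes l = in-step t u l l′ x (Within⇒Side x l ne h)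
  catch-upˡ {e₁} {e₂ = e₂} ε u le l′ src ne x h | no nl = contradiction (ℤₚ.≤-antisym (subst (_≤ lev e₂) (sym l′) (Strand-lev u)) le) nl
  catch-upˡ {e₁′ = e₁′} {e₂} {e₂′} (pass b en ◅ t) u le l′ src ne x h | no nl =
    subst (λ m → Side (flips m x) e₁′ e₂′) (sym (common-recordˡ b (tile b) b∉u))
      (catch-upˡ t u lev′ l′ src (λ { refl → src (pass b en) }) x (Within-step x b en (route (tile b) en) {e₂} lt h))
    where
    lt : lev e₂ < lev (entry P b en)
    lt = ℤₚ.≤∧≢⇒< le (nl ∘ sym)
    lev′ : lev e₂ ≤ lev (exit P b (route (tile b) en))
    lev′ = subst (lev e₂ ≤_) (trans (ℤₚ.+-comm -1ℤ (lev (entry P b en))) (trans (cong (_- 1ℤ) (lev-entry b en)) (sym (lev-exit b (route (tile b) en))))) (ℤₚ.i<j⇒i≤pred[j] lt)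
    b∉u : Box.corner b ∉ crossings F u
    b∉u = below⇒∉ (crossings-below u ℤₚ.≤-refl) (subst (lev e₂ <_) (lev-entry b en) lt)

  catch-upʳ : ∀ {e₁ e₁′ e₂ e₂′} (t : Strand F e₁ e₁′) (u : Strand F e₂ e₂′) → lev e₁ ≤ lev e₂ → lev e₁′ ≡ lev e₂′ →
    (∀ {a} → ¬ Pass F a e₁) → e₁ ≢ e₂ → ∀ x → Within x e₁ e₂ → Side (flips (commonCrossings F t u) x) e₁′ e₂′
  catch-upʳ {e₁} {e₁′} {e₂} {e₂′} t u le l′ src ne x h with lev e₁ ≟ lev e₂
  catch-upʳ t u le l′ src ne x h | yes l = in-step t u l l′ x (Within⇒Side x l ne h)
  catch-upʳ {e₁} t ε le l′ src ne x h | no nl = contradiction (ℤₚ.≤-antisym le (subst (_≤ lev e₁) l′ (Strand-lev t))) nl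
  catch-upʳ {e₁} {e₁′} {e₂′ = e₂′} t (pass b en ◅ u) le l′ src ne x h | no nl =
    subst (λ m → Side (flips m x) e₁′ e₂′) (sym (common-recordʳ b (tile b) b∉t))
      (catch-upʳ t u lev′ l′ src (λ { refl → src (pass b en) }) x within)
    where
    lt : lev e₁ < lev (entry P b en)
    lt = ℤₚ.≤∧≢⇒< le nl
    not-not : ∀ x {e e′} → Within (not (not x)) e e′ → Within x e e′
    not-not true h = h
    not-not false h = h
    within : Within x e₁ (exit P b (route (tile b) en))
    within = not-not x {e₁} {exit P b (route (tile b) en)} (Within-flip (not x) {exit P b (route (tile b) en)} {e₁}
      (Within-step (not x) b en (route (tile b) en) {e₁} lt (Within-flip x {e₁} {entry P b en} h)))
    lev′ : lev e₁ ≤ lev (exit P b (route (tile b) en))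
    lev′ = subst (lev e₁ ≤_) (trans (ℤₚ.+-comm -1ℤ (lev (entry P b en))) (trans (cong (_- 1ℤ) (lev-entry b en)) (sym (lev-exit b (route (tile b) en))))) (ℤₚ.i<j⇒i≤pred[j] lt)
    b∉t : Box.corner b ∉ crossings F t
    b∉t = below⇒∉ (crossings-below t ℤₚ.≤-refl) (subst (lev e₁ <_) (lev-entry b en) lt)

  wid-north : ∀ j → wid (north P j) ≡ X (pred j) + X j
  wid-north j = trans (l (X (pred j)) (dx (P ⟦ j ⟧))) (cong (λ z → X (pred j) + z) (sym (X-pred j)))
    where
    l : ∀ a d → a + 0ℤ + (a + 0ℤ) + d ≡ a + (a + d)
    l = solve-∀

  wid+lev-north : ∀ j → wid (north P j) + (lev (north P j) + lev (north P j)) ≡ Y (pred j) + Y j + (+ k + + k - 1ℤ)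
  wid+lev-north j = trans (trans (l₁ (X (pred j)) (Y (pred j)) (dx (P ⟦ j ⟧)) (+ k)) (cong (λ d → Y (pred j) + (Y (pred j) + (d - dx (P ⟦ j ⟧) - 1ℤ)) + (+ k + + k)) (sym (dx+dy (P ⟦ j ⟧)))))
    (trans (l₂ (Y (pred j)) (dx (P ⟦ j ⟧)) (dy (P ⟦ j ⟧)) (+ k)) (cong (λ z → Y (pred j) + z + (+ k + + k - 1ℤ)) (sym (Y-pred j))))
    where
    l₁ : ∀ x y d k → x + 0ℤ + (x + 0ℤ) + d + (y + k - (x + 0ℤ) - d + (y + k - (x + 0ℤ) - d)) ≡ y + (y + (1ℤ - d - 1ℤ)) + (k + k)
    l₁ = solve-∀
    l₂ : ∀ y d c k → y + (y + (d + c - d - 1ℤ)) + (k + k) ≡ y + (y + c) + (k + k - 1ℤ)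
    l₂ = solve-∀

  within-north : ∀ {i j} → i < j → Within true (north P i) (north P j)
  within-north {i} {j} lt =
    subst₂ _≤_ (sym (wid-north i)) (sym (wid-north j)) (ℤₚ.+-mono-≤ (X-mono pi≤pj) (X-mono i≤j)) ,
    subst₂ _≤_ (sym (wid+lev-north i)) (sym (wid+lev-north j)) (ℤₚ.+-monoˡ-≤ (+ k + + k - 1ℤ) (ℤₚ.+-mono-≤ (Y-mono pi≤pj) (Y-mono i≤j)))
    where
    i≤j = ℤₚ.<⇒≤ lt
    pi≤pj = ℤₚ.pred-mono i≤j

  same-lev : ∀ {e a b} → Strand F e a → Strand F e b → lev a ≡ lev b → a ≡ b
  same-lev ε ε l = refl
  same-lev ε (pass b en ◅ u) l = contradiction (sym l) (ℤₚ.<⇒≢ (ℤₚ.≤-<-trans (Strand-lev u) (lev-step b en (route (tile b) en))))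
  same-lev (pass b en ◅ t) ε l = contradiction l (ℤₚ.<⇒≢ (ℤₚ.≤-<-trans (Strand-lev t) (lev-step b en (route (tile b) en))))
  same-lev (p ◅ t) (q ◅ u) l with Pass-deterministic p q
  ... | refl = same-lev t u l

  flips-even : ∀ m → flips m true ≡ true → 2 ∣ℕ m
  flips-odd : ∀ m → flips m false ≡ true → ¬ 2 ∣ℕ m
  flips-even ℕ.zero e = 2 ℕ∣.∣0
  flips-even (ℕ.suc (ℕ.suc m)) e = ℕ∣.∣m∣n⇒∣m+n (ℕ∣.divides 1 refl) (flips-even m e)
  flips-odd (ℕ.suc ℕ.zero) e d = contradiction (ℕ∣.∣⇒≤ d) λ { (ℕ.s≤s ()) }
  flips-odd (ℕ.suc (ℕ.suc m)) e d = flips-odd m e (ℕ∣.∣m+n∣m⇒∣n d (ℕ∣.divides 1 refl))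

  parity : ∀ {i j} b (t : Strand F (north P i) (entry P b fromLeft)) (u : Strand F (north P j) (entry P b fromTop)) →
    2 ∣ℕ commonCrossings F t u ⇔ i < j
  parity {i} {j} b t u with ℤₚ.<-cmp i j
  ... | tri≈ _ refl _ = contradiction (cong proj₂ (same-lev t u l′)) λ ()
    where
    l′ = trans (lev-entry b fromLeft) (sym (lev-entry b fromTop))
  ... | tri< lt ne _ = mk⇔ (λ _ → lt) (λ _ → flips-even (commonCrossings F t u) (side-entries b (both (ℤₚ.≤-total (lev (north P i)) (lev (north P j))))))
    where
    l′ = trans (lev-entry b fromLeft) (sym (lev-entry b fromTop))
    both : lev (north P i) ≤ lev (north P j) ⊎ lev (north P j) ≤ lev (north P i) → Side (flips (commonCrossings F t u) true) (entry P b fromLeft) (entry P b fromTop)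
    both (inj₁ le) = catch-upʳ t u le l′ (north-first {i}) (ne ∘ north-injective) true (within-north lt)
    both (inj₂ le) = catch-upˡ t u le l′ (north-first {j}) (ne ∘ north-injective) true (within-north lt)
  ... | tri> ¬lt ne gt = mk⇔ (λ d → contradiction d (flips-odd (commonCrossings F t u) (side-entries b (both (ℤₚ.≤-total (lev (north P i)) (lev (north P j))))))) (λ lt → contradiction lt ¬lt)
    where
    l′ = trans (lev-entry b fromLeft) (sym (lev-entry b fromTop))
    both : lev (north P i) ≤ lev (north P j) ⊎ lev (north P j) ≤ lev (north P i) → Side (flips (commonCrossings F t u) false) (entry P b fromLeft) (entry P b fromTop)
    both (inj₁ le) = catch-upʳ t u le l′ (north-first {i}) (ne ∘ north-injective) false (within-north gt)
    both (inj₂ le) = catch-upˡ t u le l′ (north-first {j}) (ne ∘ north-injective) false (within-north gt)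

-- Reading a strip as a word

infix 4 _≟ₜ_
_≟ₜ_ : (x y : Tile) → Dec (x ≡ y)
crossing ≟ₜ crossing = yes refl
crossing ≟ₜ elbow    = no λ ()
elbow    ≟ₜ crossing = no λ ()
elbow    ≟ₜ elbow    = yes refl

module Timed (n : ℕ) .{{nt : NonTrivial n}} {k : ℕ} (P : Periodic.𝒫 n k) (u : ℤ) (P-u : Periodic._⟦_⟧ n P u ≡ U) where

  open Periodic n
  open Mod n
  open Residues n
  open Words n
  open Paths n P
  open Boxes n P

  private instance
    n≢0 : NonZero n
    n≢0 = nonTrivial⇒nonZero n

  M : ℕ
  M = ℕ.pred n

  1+M : ℕ.suc M ≡ n
  1+M = ℕₚ.suc-pred n

  N≡ : N ≡ 1ℤ + + M
  N≡ = cong +_ (sym 1+M)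

  private instance
    M≢0 : NonZero M
    M≢0 = ℕ.>-nonZero (ℕₚ.≤-pred (subst (2 ℕ.≤_) (sym 1+M) (ℕ.nonTrivial⇒n>1 n)))

  k≥1 : 1 ℕ.≤ k
  k≥1 = ℤₚ.drop‿+≤+ (≤-by {Y (u + -1ℤ * N)} {Y (pred u)} (Y-mono {u + -1ℤ * N} {pred u} (≤-by {1ℤ} {N} (+≤+ (ℕ.>-nonZero⁻¹ n)) (l₁ u N)))
        (trans (l₂ (+ k) (Y (pred u))) (cong (λ z → Y (pred u) - z) (sym (trans (Y-shift u -1ℤ) (cong (λ z → z + -1ℤ * + k) (Y-U {u} P-u)))))))
    where
    l₁ : ∀ u N → -1ℤ + u - (u + -1ℤ * N) ≡ N - 1ℤ
    l₁ = solve-∀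
    l₂ : ∀ k y → k - 1ℤ ≡ y - (y + 1ℤ + -1ℤ * k)
    l₂ = solve-∀

  K : ℕ
  K = k ℕ.* M

  -- Time d + L M treats the d-th column to the right of the vertical step u, at height k - 1 - L.
  time : ℕ → ℕ → ℕ
  time L d = d ℕ.+ L ℕ.* M

  layer depth : ℕ → ℕ
  layer t = t ℕ./ M
  depth t = t ℕ.% M

  time-layer-depth : ∀ t → time (layer t) (depth t) ≡ t
  time-layer-depth t = sym (ℕ%.m≡m%n+[m/n]*n t M)

  layer-time : ∀ L {d} → d ℕ.< M → layer (time L d) ≡ L
  layer-time L {d} d<M = trans (ℕ%.+-distrib-/-∣ʳ d {L ℕ.* M} {M} (ℕ∣.divides L refl)) (cong₂ ℕ._+_ (ℕ%.m<n⇒m/n≡0 d<M) (ℕ%.m*n/n≡m L M))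

  depth< : ∀ t → depth t ℕ.< M
  depth< t = ℕ%.m%n<n t M

  layer<k : ∀ {t} → t ℕ.< K → layer t ℕ.< k
  layer<k {t} = ℕ%.m<n*o⇒m/o<n {t} {k} {M}

  time<K : ∀ {L d} → L ℕ.< k → d ℕ.< M → time L d ℕ.< K
  time<K {L} {d} L<k d<M = ℕₚ.<-≤-trans (ℕₚ.+-monoˡ-< (L ℕ.* M) d<M) (ℕₚ.*-monoˡ-≤ M L<k)

  M<n : M ℕ.< n
  M<n = ℕₚ.≤-reflexive 1+M

  pos : ℕ → ℤ
  pos t = u + + t

  column : ℕ → ℤ
  column t = 1ℤ + (pos t + + layer t)

  pr : ℕ → Step
  pr t = P ⟦ column t ⟧

  open Word u pr hiding (pos)

  top : ℕ → ℕ
  top L = k ℕ.∸ ℕ.suc L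

  top<k : ∀ L → top L ℕ.< k
  top<k L = ℕₚ.m<n+o⇒m∸n<o k (ℕ.suc L) {k} {{ℕ.>-nonZero k≥1}} (ℕₚ.m<n+m k ℕ.z<s)

  level-height : ℕ → ℤ
  level-height L = + k - 1ℤ - + L

  +top : ∀ {L} → L ℕ.< k → + top L ≡ level-height L
  +top {L} L<k = trans (sym (trans (ℤₚ.m-n≡m⊖n k (ℕ.suc L)) (ℤₚ.⊖-≥ L<k))) (l (+ k) (+ L))
    where
    l : ∀ k L → k - (1ℤ + L) ≡ k - 1ℤ - L
    l = solve-∀

  boxAt : ∀ L c → .(P ⟦ c ⟧ ≡ R) → Box P
  boxAt L c r = box c r (fromℕ< (top<k L))

  lift : ℤ → ℤ → Point
  lift x h = vertex P x ⊕ (0ℤ , h)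

  corner-boxAt : ∀ {L} x .(r : P ⟦ 1ℤ + x ⟧ ≡ R) → L ℕ.< k → Box.corner (boxAt L (1ℤ + x) r) ≡ lift x (level-height L)
  corner-boxAt {L} x r L<k = cong₂ lift (ℤₚ.pred-suc x) (trans (cong +_ (Finₚ.toℕ-fromℕ< (top<k L))) (+top L<k))

  lift-R : ∀ x h → P ⟦ 1ℤ + x ⟧ ≡ R → lift (1ℤ + x) h ≡ lift x h ⊕ (1ℤ , 0ℤ)
  lift-R x h r = cong₂ _,_ (trans (cong (_+ 0ℤ) (trans (X-suc x) (cong (λ s → X x + dx s) r))) (l₁ (X x)))
                           (trans (cong (_+ h) (trans (Y-suc x) (cong (λ s → Y x + dy s) r))) (l₂ (Y x) h))
    where
    l₁ : ∀ a → a + 1ℤ + 0ℤ ≡ a + 0ℤ + 1ℤ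
    l₁ = solve-∀
    l₂ : ∀ a h → a + 0ℤ + h ≡ a + h + 0ℤ
    l₂ = solve-∀

  lift-U : ∀ x h → P ⟦ 1ℤ + x ⟧ ≡ U → lift (1ℤ + x) h ≡ lift x (1ℤ + h)
  lift-U x h r = cong₂ _,_ (cong (_+ 0ℤ) (trans (X-suc x) (trans (cong (λ s → X x + dx s) r) (ℤₚ.+-identityʳ (X x)))))
                           (trans (cong (_+ h) (trans (Y-suc x) (cong (λ s → Y x + dy s) r))) (ℤₚ.+-assoc (Y x) 1ℤ h))

  lift-⊕ : ∀ x h → lift x h ⊕ (0ℤ , 1ℤ) ≡ lift x (1ℤ + h)
  lift-⊕ x h = cong₂ _,_ (ℤₚ.+-identityʳ _) (l (Y x) h)
    where
    l : ∀ a h → a + h + 1ℤ ≡ a + (1ℤ + h)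
    l = solve-∀

  -- The edge at position p of the path separating the boxes treated before time L, d from the others, where x = p + L.
  data Cut (L d : ℕ) (x : ℤ) : Edge → Set where
    done : ∀ {j e} → j ℕ.< d → x ≋ u + + j → e ≡ (lift x (level-height L) , P ⟦ 1ℤ + x ⟧) → Cut L d x e
    mark : ∀ {e} → x ≋ u + + d → e ≡ (lift x (level-height L) , U) → Cut L d x e
    todo : ∀ {j e} → d ℕ.< j → j ℕ.< n → x ≋ u + + j → e ≡ (lift (pred x) (1ℤ + level-height L) , P ⟦ x ⟧) → Cut L d x e

  pos-≋ : ∀ L d p → p ≋ pos (time L d) ⇔ p + + L ≋ u + + d
  pos-≋ L d p = mk⇔ to from
    where
    e : ∀ z → z - pos (time L d) ≡ (z + + L) - (u + + d + + L * N)
    e z = trans (cong (λ y → z - (u + y)) (trans (ℤₚ.pos-+ d (L ℕ.* M)) (cong (λ y → + d + y) (ℤₚ.pos-* L M)))) (trans (l z u (+ d) (+ L) (+ M)) (cong (λ y → z + + L - (u + + d + + L * y)) (sym N≡)))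
      where
      l : ∀ z u d L M → z - (u + (d + L * M)) ≡ (z + L) - (u + d + L * (1ℤ + M))
      l = solve-∀
    to : p ≋ pos (time L d) → p + + L ≋ u + + d
    to h = ≋-trans (≋-by h (sym (e p))) (≋-shift (u + + d) (+ L))
    from : p + + L ≋ u + + d → p ≋ pos (time L d)
    from h = ≋-by (≋-trans h (≋-sym (≋-shift (u + + d) (+ L)))) (e p)

  u-unique : ∀ {x i j} → x ≋ u + + i → x ≋ u + + j → i ℕ.< n → j ℕ.< n → i ≡ j
  u-unique {x} {i} {j} h h′ = ≋⇒≡ℕ (≋-by (≋-trans (≋-sym h) h′) (l (+ i) (+ j) u))
    where
    l : ∀ i j u → i - j ≡ u + i - (u + j)
    l = solve-∀

  column-≋ : ∀ L d x → d ℕ.< M → x ≋ u + + d → 1ℤ + x ≋ column (time L d)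
  column-≋ L d x d<M h = ≋-+ 1ℤ (≋-trans h (≋-sym (≋-trans (≋-reflexive (cong (λ z → pos (time L d) + + z) (layer-time L d<M)))
    (Equivalence.to (pos-≋ L d (pos (time L d))) ≋-refl))))

  pr-≋ : ∀ L d x → d ℕ.< M → x ≋ u + + d → P ⟦ 1ℤ + x ⟧ ≡ pr (time L d)
  pr-≋ L d x d<M h = step-cong (column-≋ L d x d<M h)

  module Cuts (F : Filling P) where

    open Filling F
    open Strands n F

    tile-shift : ∀ {c c′ h} .(r : P ⟦ c ⟧ ≡ R) .(r′ : P ⟦ c′ ⟧ ≡ R) → c′ ≋ c → tile (box c′ r′ h) ≡ tile (box c r h)
    tile-shift {c} {h = h} r r′ (by m refl) = trans (sym zero-shift) (same (trans (cong (λ z → c + z) (ℤₚ.*-zeroˡ N)) (ℤₚ.+-identityʳ c)))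
      where
      r₀ : P ⟦ c ⟧ ≡ R
      r₀ = recompute (P ⟦ c ⟧ ≟ₛ R) r
      T : ∀ m → Tile
      T m = tile (box (c + m * N) (trans (step-cong (≋-shift c m)) r₀) h)
      same : ∀ {c₁ c₂} .{r₁ : P ⟦ c₁ ⟧ ≡ R} .{r₂ : P ⟦ c₂ ⟧ ≡ R} → c₁ ≡ c₂ → tile (box c₁ r₁ h) ≡ tile (box c₂ r₂ h)
      same refl = refl
      next : ∀ m → T (1ℤ + m) ≡ T m
      next m = periodic _ _ (cong₂ _,_
        (trans (cong (_+ 0ℤ) (trans (cong X (l₁ c m N)) (X-shift (pred (c + m * N)) 1ℤ))) (l₂ (X (pred (c + m * N))) (+ n - + k)))
        (trans (cong (_+ + toℕ h) (trans (cong Y (l₁ c m N)) (Y-shift (pred (c + m * N)) 1ℤ))) (l₃ (Y (pred (c + m * N))) (+ k) (+ toℕ h))))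
        where
        l₁ : ∀ c m N → -1ℤ + (c + (1ℤ + m) * N) ≡ -1ℤ + (c + m * N) + 1ℤ * N
        l₁ = solve-∀
        l₂ : ∀ x d → x + 1ℤ * d + 0ℤ ≡ x + 0ℤ + d
        l₂ = solve-∀
        l₃ : ∀ x d h → x + 1ℤ * d + h ≡ x + h + d
        l₃ = solve-∀
      zero-shift : T 0ℤ ≡ T m
      zero-shift = ℤ-ind (λ m → T 0ℤ ≡ T m) refl (λ m e → trans e (sym (next m))) (λ m e → trans e (next m)) m

    tileIf : ∀ t → Dec (pr t ≡ R) → Tile
    tileIf t (yes r) = tile (boxAt (layer t) (column t) r)
    tileIf t (no _)  = crossing

    tileAt : ℕ → Tile
    tileAt t = tileIf t (pr t ≟ₛ R)

    tileIf-R : ∀ t d (r : pr t ≡ R) → tileIf t d ≡ tile (boxAt (layer t) (column t) r)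
    tileIf-R t (yes _) r = refl
    tileIf-R t (no ¬r) r = contradiction r ¬r

    tileAt-R : ∀ t (r : pr t ≡ R) → tileAt t ≡ tile (boxAt (layer t) (column t) r)
    tileAt-R t r = tileIf-R t (pr t ≟ₛ R) r

    tile-boxAt : ∀ {L d} x (r : P ⟦ 1ℤ + x ⟧ ≡ R) → d ℕ.< M → x ≋ u + + d → tile (boxAt L (1ℤ + x) r) ≡ tileAt (time L d)
    tile-boxAt {L} {d} x r d<M h = trans (tile-shift r′ r (column-≋ L d x d<M h))
      (trans (cong (λ L → tile (boxAt L (column (time L₀ d)) r′)) (sym (layer-time L₀ d<M))) (sym (tileAt-R (time L₀ d) r′)))
      where
      L₀ = L
      r′ : pr (time L d) ≡ R
      r′ = trans (sym (pr-≋ L d x d<M h)) r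

    through : ∀ b en {c e a} → tile b ≡ c → e ≡ exit P b (route c en) → Strand F a (entry P b en) → Strand F a e
    through b en refl refl t = t ◅◅ (pass b en ◅ ε)

    Reach : ℕ → ℕ → Set
    Reach L d = ∀ p e → Cut L d (p + + L) e → Strand F (north P (ρ tileAt (time L d) p)) e

    move-away : ∀ s c {q p} → ¬ p ≋ q → ¬ p ≋ 1ℤ + q → move s c q p ≡ p
    move-away R crossing h h′ = s-away h h′
    move-away R elbow    h h′ = refl
    move-away U c        h h′ = refl

    at-left : ∀ {L} x (r : P ⟦ 1ℤ + x ⟧ ≡ R) → L ℕ.< k → (lift x (level-height L) , U) ≡ entry P (boxAt L (1ℤ + x) r) fromLeft
    at-left x r L<k = cong (_, U) (sym (corner-boxAt x r L<k))

    at-bottom : ∀ {L} x (r : P ⟦ 1ℤ + x ⟧ ≡ R) → L ℕ.< k → (lift x (level-height L) , P ⟦ 1ℤ + x ⟧) ≡ exit P (boxAt L (1ℤ + x) r) toBottom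
    at-bottom x r L<k = cong₂ _,_ (sym (corner-boxAt x r L<k)) r

    at-top : ∀ {L} x (r : P ⟦ 1ℤ + x ⟧ ≡ R) → L ℕ.< k → (lift (pred (1ℤ + x)) (1ℤ + level-height L) , P ⟦ 1ℤ + x ⟧) ≡ entry P (boxAt L (1ℤ + x) r) fromTop
    at-top {L} x r L<k = cong₂ _,_ (trans (cong (λ z → lift z (1ℤ + level-height L)) (ℤₚ.pred-suc x)) (trans (sym (lift-⊕ x (level-height L)))
                                          (cong (_⊕ (0ℤ , 1ℤ)) (sym (corner-boxAt x r L<k))))) r

    at-right : ∀ {L} x (r : P ⟦ 1ℤ + x ⟧ ≡ R) → L ℕ.< k → (lift (1ℤ + x) (level-height L) , U) ≡ exit P (boxAt L (1ℤ + x) r) toRight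
    at-right {L} x r L<k = cong (_, U) (trans (lift-R x (level-height L) r) (cong (_⊕ (1ℤ , 0ℤ)) (sym (corner-boxAt x r L<k))))

    start-reach : Reach 0 0
    start-reach p e (mark h e≡) = subst (Strand F (north P p)) (trans north≡ (sym e≡)) ε
      where
      x = p + + 0
      x≡ : x ≡ p
      x≡ = ℤₚ.+-identityʳ p
      xU : P ⟦ x ⟧ ≡ U
      xU = trans (step-cong (≋-trans h (≋-reflexive (ℤₚ.+-identityʳ u)))) P-u
      north≡ : north P p ≡ (lift x (level-height 0) , U)
      north≡ = subst (λ z → north P z ≡ (lift x (level-height 0) , U)) x≡
        (cong₂ _,_ (sym (trans (cong (λ z → lift z (level-height 0)) (sym (ℤₚ.suc-pred x)))
                        (trans (lift-U (pred x) (level-height 0) (trans (cong (P ⟦_⟧) (ℤₚ.suc-pred x)) xU)) (cong (lift (pred x)) (l (+ k)))))) xU)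
        where
        l : ∀ k → 1ℤ + (k - 1ℤ - 0ℤ) ≡ k
        l = solve-∀
    start-reach p e (todo _ _ h e≡) = subst (Strand F (north P p)) (trans north≡ (sym e≡)) ε
      where
      x = p + + 0
      l : ∀ k → k ≡ 1ℤ + (k - 1ℤ - 0ℤ)
      l = solve-∀
      north≡ : north P p ≡ (lift (pred x) (1ℤ + level-height 0) , P ⟦ x ⟧)
      north≡ = cong₂ _,_ (cong₂ lift (cong pred (sym (ℤₚ.+-identityʳ p))) (l (+ k))) (cong (P ⟦_⟧) (sym (ℤₚ.+-identityʳ p)))

    turnover : ∀ {L} → Reach L M → Reach (ℕ.suc L) 0
    turnover {L} S p e (mark h e≡) = S p e (mark x≋ (trans e≡ (cong (_, U) (trans (cong (λ z → lift z (level-height (ℕ.suc L))) (l p (+ L)))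
        (trans (lift-U x (level-height (ℕ.suc L)) xU) (cong (lift x) (l₂ (+ k) (+ L))))))))
      where
      x = p + + L
      l : ∀ p L → p + (1ℤ + L) ≡ 1ℤ + (p + L)
      l = solve-∀
      l₂ : ∀ k L → 1ℤ + (k - 1ℤ - (1ℤ + L)) ≡ k - 1ℤ - L
      l₂ = solve-∀
      l₃ : ∀ p L u M → p + L - (u + M) ≡ p + (1ℤ + L) - (u + 0ℤ + 1ℤ * (1ℤ + M))
      l₃ = solve-∀
      x≋ : x ≋ u + + M
      x≋ = ≋-by (≋-trans h (≋-sym (≋-shift (u + + 0) 1ℤ))) (trans (l₃ p (+ L) u (+ M)) (cong (λ z → p + + ℕ.suc L - (u + + 0 + 1ℤ * z)) (sym N≡)))
      xU : P ⟦ 1ℤ + x ⟧ ≡ U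
      xU = trans (step-cong (≋-trans (≋-reflexive (sym (l p (+ L)))) (≋-trans h (≋-reflexive (ℤₚ.+-identityʳ u))))) P-u
    turnover {L} S p e (todo {ℕ.suc j} _ j<n h e≡) = S p e (done (ℕₚ.≤-pred (subst (ℕ.suc j ℕ.<_) (sym 1+M) j<n)) (≋-by h (l₃ p (+ L) u (+ j)))
        (trans e≡ (cong₂ _,_ (cong₂ lift (l p (+ L)) (l₂ (+ k) (+ L))) (cong (P ⟦_⟧) (l₁ p (+ L))))))
      where
      l : ∀ p L → -1ℤ + (p + (1ℤ + L)) ≡ p + L
      l = solve-∀
      l₁ : ∀ p L → p + (1ℤ + L) ≡ 1ℤ + (p + L)
      l₁ = solve-∀
      l₂ : ∀ k L → 1ℤ + (k - 1ℤ - (1ℤ + L)) ≡ k - 1ℤ - L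
      l₂ = solve-∀
      l₃ : ∀ p L u j → p + L - (u + j) ≡ p + (1ℤ + L) - (u + (1ℤ + j))
      l₃ = solve-∀

    module Advance {L d : ℕ} (L<k : L ℕ.< k) (d<M : d ℕ.< M) (S : Reach L d) where

      t = time L d
      q = pos t
      c = tileAt t

      d<n : d ℕ.< n
      d<n = ℕₚ.<-trans d<M M<n

      1+d<n : ℕ.suc d ℕ.< n
      1+d<n = ℕₚ.≤-<-trans d<M M<n

      at-q : ∀ {p j} → p + + L ≋ u + + j → j ≢ d → j ℕ.< n → ¬ p ≋ q
      at-q {p} h j≢d j<n h′ = j≢d (u-unique h (Equivalence.to (pos-≋ L d p) h′) j<n d<n)

      at-1+q : ∀ {p j} → p + + L ≋ u + + j → j ≢ ℕ.suc d → j ℕ.< n → ¬ p ≋ 1ℤ + q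
      at-1+q {p} {j} h j≢ j<n h′ = j≢ (u-unique h (≋-by (Equivalence.to (pos-≋ L d (pred p)) (≋-by h′ (l₁ p q))) (l₂ p (+ L) u (+ d))) j<n 1+d<n)
        where
        l₁ : ∀ p q → -1ℤ + p - q ≡ p - (1ℤ + q)
        l₁ = solve-∀
        l₂ : ∀ p L u d → p + L - (u + (1ℤ + d)) ≡ -1ℤ + p + L - (u + d)
        l₂ = solve-∀

      from : ∀ {p} p₀ {e} → move (pr t) c q p ≡ p₀ → Strand F (north P (ρ tileAt t p₀)) e → Strand F (north P (ρ tileAt (ℕ.suc t) p)) e
      from p₀ {e} m≡ = subst (λ z → Strand F (north P (ρ tileAt t z)) e) (sym m≡)

      move-U : ∀ {s p} → s ≡ U → move s c q p ≡ p
      move-U refl = refl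

      move-R : ∀ {s c′ p} → s ≡ R → c ≡ c′ → move s c q p ≡ move R c′ q p
      move-R refl refl = refl

      step-low : ∀ p e → p + + L ≋ u + + d → e ≡ (lift (p + + L) (level-height L) , P ⟦ 1ℤ + (p + + L) ⟧) → Strand F (north P (ρ tileAt (ℕ.suc t) p)) e
      step-low p e h e≡ = go (P ⟦ 1ℤ + x ⟧) refl c refl
        where
        x = p + + L
        p≋q : p ≋ q
        p≋q = Equivalence.from (pos-≋ L d p) h
        go : ∀ s → P ⟦ 1ℤ + x ⟧ ≡ s → ∀ c′ → c ≡ c′ → Strand F (north P (ρ tileAt (ℕ.suc t) p)) e
        go U s≡ _ _ = from p (move-U (trans (sym (pr-≋ L d x d<M h)) s≡)) (S p e (mark h (trans e≡ (cong (lift x (level-height L) ,_) s≡))))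
        go R r elbow c≡ = from p (move-R (trans (sym (pr-≋ L d x d<M h)) r) c≡)
          (through (boxAt L (1ℤ + x) r) fromLeft (trans (tile-boxAt x r d<M h) c≡) (trans e≡ (at-bottom x r L<k)) (S p _ (mark h (sym (at-left x r L<k)))))
        go R r crossing c≡ = from (1ℤ + p) (trans (move-R (trans (sym (pr-≋ L d x d<M h)) r) c≡) (s-low p≋q))
          (through (boxAt L (1ℤ + x) r) fromTop (trans (tile-boxAt x r d<M h) c≡) (trans e≡ (at-bottom x r L<k))
            (S (1ℤ + p) _ (todo {j = ℕ.suc d} ℕₚ.≤-refl 1+d<n (≋-by h (l₂ p (+ L) u (+ d)))
              (trans (sym (at-top x r L<k)) (cong (λ z → lift (pred z) (1ℤ + level-height L) , P ⟦ z ⟧) (sym (ℤₚ.+-assoc 1ℤ p (+ L))))))))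
          where
          l₂ : ∀ p L u d → 1ℤ + p + L - (u + (1ℤ + d)) ≡ p + L - (u + d)
          l₂ = solve-∀

      step-high : ∀ p e → 1ℤ + p + + L ≋ u + + ℕ.suc d → e ≡ (lift (1ℤ + p + + L) (level-height L) , U) → Strand F (north P (ρ tileAt (ℕ.suc t) (1ℤ + p))) e
      step-high p e h′ e≡ = go (P ⟦ 1ℤ + x ⟧) refl c refl
        where
        x = p + + L
        h : x ≋ u + + d
        h = ≋-by h′ (l p (+ L) u (+ d))
          where
          l : ∀ p L u d → p + L - (u + d) ≡ 1ℤ + p + L - (u + (1ℤ + d))
          l = solve-∀
        p≋q : p ≋ q
        p≋q = Equivalence.from (pos-≋ L d p) h
        1+x≡ : 1ℤ + p + + L ≡ 1ℤ + x
        1+x≡ = ℤₚ.+-assoc 1ℤ p (+ L)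
        e≡′ : e ≡ (lift (1ℤ + x) (level-height L) , U)
        e≡′ = trans e≡ (cong (λ z → lift z (level-height L) , U) 1+x≡)
        go : ∀ s → P ⟦ 1ℤ + x ⟧ ≡ s → ∀ c′ → c ≡ c′ → Strand F (north P (ρ tileAt (ℕ.suc t) (1ℤ + p))) e
        go U s≡ _ _ = from (1ℤ + p) (move-U (trans (sym (pr-≋ L d x d<M h)) s≡))
          (S (1ℤ + p) e (todo {j = ℕ.suc d} ℕₚ.≤-refl 1+d<n h′ (trans e≡′ (cong₂ _,_ (trans (lift-U x (level-height L) s≡)
            (cong (λ z → lift z (1ℤ + level-height L)) (trans (sym (ℤₚ.pred-suc x)) (cong pred (sym 1+x≡))))) (trans (sym s≡) (cong (P ⟦_⟧) (sym 1+x≡)))))))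
        go R r crossing c≡ = from p (trans (move-R (trans (sym (pr-≋ L d x d<M h)) r) c≡) (trans (s-high (≋-+ 1ℤ p≋q)) (ℤₚ.pred-suc p)))
          (through (boxAt L (1ℤ + x) r) fromLeft (trans (tile-boxAt x r d<M h) c≡) (trans e≡′ (at-right x r L<k)) (S p _ (mark h (sym (at-left x r L<k)))))
        go R r elbow c≡ = from (1ℤ + p) (move-R (trans (sym (pr-≋ L d x d<M h)) r) c≡)
          (through (boxAt L (1ℤ + x) r) fromTop (trans (tile-boxAt x r d<M h) c≡) (trans e≡′ (at-right x r L<k))
            (S (1ℤ + p) _ (todo {j = ℕ.suc d} ℕₚ.≤-refl 1+d<n h′
              (trans (sym (at-top x r L<k)) (cong (λ z → lift (pred z) (1ℤ + level-height L) , P ⟦ z ⟧) (sym 1+x≡))))))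

      advance : Reach L (ℕ.suc d)
      advance p e (done {j} j<1+d h e≡) with j ℕ.≟ d
      ... | yes refl = step-low p e h e≡
      ... | no j≢d = from p (move-away (pr t) c (at-q {p} h j≢d j<n) (at-1+q {p} h (ℕₚ.<⇒≢ j<1+d) j<n)) (S p e (done (ℕₚ.≤∧≢⇒< (ℕₚ.≤-pred j<1+d) j≢d) h e≡))
        where
        j<n = ℕₚ.≤-<-trans (ℕₚ.≤-pred j<1+d) d<n
      advance p e (mark h e≡) = subst (λ z → Strand F (north P (ρ tileAt (ℕ.suc t) z)) e) (ℤₚ.suc-pred p)
        (step-high (pred p) e (subst (λ z → z + + L ≋ u + + ℕ.suc d) (sym (ℤₚ.suc-pred p)) h) (trans e≡ (cong (λ z → lift (z + + L) (level-height L) , U) (sym (ℤₚ.suc-pred p)))))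
      advance p e (todo {j} 1+d<j j<n h e≡) = from p (move-away (pr t) c (at-q {p} h (ℕₚ.>⇒≢ d<j) j<n) (at-1+q {p} h (ℕₚ.>⇒≢ 1+d<j) j<n)) (S p e (todo d<j j<n h e≡))
        where
        d<j = ℕₚ.<-trans ℕₚ.≤-refl 1+d<j

    reach : ∀ L d → L ℕ.≤ k → d ℕ.≤ M → (L ≡ k → d ≡ 0) → Reach L d
    reach ℕ.zero ℕ.zero _ _ _ = start-reach
    reach (ℕ.suc L) ℕ.zero L<k _ _ = turnover (reach L M (ℕₚ.<⇒≤ L<k) ℕₚ.≤-refl λ { refl → contradiction L<k (ℕₚ.<-irrefl refl) })
    reach L (ℕ.suc d) L≤k d<M L≡k = Advance.advance (ℕₚ.≤∧≢⇒< L≤k λ e → contradiction (L≡k e) λ ()) d<M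
      (reach L d L≤k (ℕₚ.<⇒≤ d<M) λ e → contradiction (L≡k e) λ ())

    height-final : 1ℤ + level-height k ≡ 0ℤ
    height-final = l (+ k)
      where
      l : ∀ k → 1ℤ + (k - 1ℤ - k) ≡ 0ℤ
      l = solve-∀

    final-cut : ∀ x → Cut k 0 x (south P x)
    final-cut x with (x - u) %ℕ n in e
    ... | ℕ.zero = mark x≋u (cong₂ _,_ (sym (trans (cong (λ z → lift z (level-height k)) (sym (ℤₚ.suc-pred x)))
                     (trans (lift-U (pred x) (level-height k) (trans (cong (P ⟦_⟧) (ℤₚ.suc-pred x)) xU))
                       (trans (cong (lift (pred x)) height-final) (cong₂ _,_ (ℤₚ.+-identityʳ _) (ℤₚ.+-identityʳ _)))))) xU)
      where
      l : ∀ x u → x - (u + 0ℤ) ≡ x - u - 0ℤ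
      l = solve-∀
      x≋u : x ≋ u + + 0
      x≋u = ≋-by (subst (λ z → x - u ≋ + z) e (≋-% (x - u))) (l x u)
      xU : P ⟦ x ⟧ ≡ U
      xU = trans (step-cong (≋-trans x≋u (≋-reflexive (ℤₚ.+-identityʳ u)))) P-u
    ... | ℕ.suc j = todo {j = ℕ.suc j} ℕ.z<s (subst (ℕ._< n) e (n%ℕd<d (x - u) n)) (≋-by (subst (λ z → x - u ≋ + z) e (≋-% (x - u))) (l x u (+ ℕ.suc j)))
                      (cong (_, P ⟦ x ⟧) (sym (trans (cong (lift (pred x)) height-final) (cong₂ _,_ (ℤₚ.+-identityʳ _) (ℤₚ.+-identityʳ _)))))
      where
      l : ∀ x u j → x - (u + j) ≡ x - u - j
      l = solve-∀

    full-strand : ∀ p → Strand F (north P (ρ tileAt K p)) (south P (p + + k))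
    full-strand p = reach k 0 ℕₚ.≤-refl ℕ.z≤n (λ _ → refl) p _ (final-cut (p + + k))

    strandPermutation-⇔ : ∀ f → HasStrandPermutation F f ⇔ (∀ p → f (ρ tileAt K p) ≡ p + + k)
    strandPermutation-⇔ f = mk⇔
      (λ h p → target-unique {i = ρ tileAt K p} (h (ρ tileAt K p)) (full-strand p))
      (λ h i → subst₂ (λ a b → Strand F (north P a) (south P b)) (ρπ tileAt K i)
                 (trans (sym (h (π tileAt K i))) (cong f (ρπ tileAt K i))) (full-strand (π tileAt K i)))

    module AtBox {L d : ℕ} (L<k : L ℕ.< k) (d<M : d ℕ.< M) (p : ℤ) (h : p + + L ≋ u + + d) (r : P ⟦ 1ℤ + (p + + L) ⟧ ≡ R) where

      b : Box P
      b = boxAt L (1ℤ + (p + + L)) r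

      private
        reach-L : Reach L d
        reach-L = reach L d (ℕₚ.<⇒≤ L<k) (ℕₚ.<⇒≤ d<M) λ e → contradiction L<k (ℕₚ.<-irrefl e)

      strandLeft : Strand F (north P (ρ tileAt (time L d) p)) (entry P b fromLeft)
      strandLeft = reach-L p _ (mark h (sym (at-left (p + + L) r L<k)))

      strandTop : Strand F (north P (ρ tileAt (time L d) (1ℤ + p))) (entry P b fromTop)
      strandTop = reach-L (1ℤ + p) _ (todo {j = ℕ.suc d} ℕₚ.≤-refl (ℕₚ.≤-<-trans d<M M<n) (≋-by h (l p (+ L) u (+ d)))
          (trans (sym (at-top (p + + L) r L<k)) (cong (λ z → lift (pred z) (1ℤ + level-height L) , P ⟦ z ⟧) (sym (ℤₚ.+-assoc 1ℤ p (+ L))))))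
        where
        l : ∀ p L u d → 1ℤ + p + L - (u + (1ℤ + d)) ≡ p + L - (u + d)
        l = solve-∀

  layerOf depthOf timeOf : Box P → ℕ
  layerOf b = k ℕ.∸ ℕ.suc (toℕ (Box.height b))
  depthOf b = (pred (Box.column b) - u) %ℕ n
  timeOf b = time (layerOf b) (depthOf b)

  layerOf<k : ∀ b → layerOf b ℕ.< k
  layerOf<k b = top<k (toℕ (Box.height b))

  depthOf-≋ : ∀ b → pred (Box.column b) ≋ u + + depthOf b
  depthOf-≋ b = ≋-by (≋-% (pred (Box.column b) - u)) (l (pred (Box.column b)) u (+ depthOf b))
    where
    l : ∀ x u j → x - (u + j) ≡ x - u - j
    l = solve-∀

  depthOf<M : ∀ b → depthOf b ℕ.< M
  depthOf<M b = ℕₚ.≤∧≢⇒< (ℕₚ.≤-pred (subst (depthOf b ℕ.<_) (sym 1+M) (n%ℕd<d (pred (Box.column b) - u) n))) λ e →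
    contradiction (trans (sym (horizontal′ b)) (trans (step-cong (column≋u e)) P-u)) λ ()
    where
    l : ∀ c u M → c - (u + 1ℤ * (1ℤ + M)) ≡ -1ℤ + c - (u + M)
    l = solve-∀
    column≋u : depthOf b ≡ M → Box.column b ≋ u
    column≋u e = ≋-trans (≋-by (subst (λ z → pred (Box.column b) ≋ u + + z) e (depthOf-≋ b))
      (trans (cong (λ z → Box.column b - (u + 1ℤ * z)) N≡) (l (Box.column b) u (+ M)))) (≋-shift u 1ℤ)

  timeOf<K : ∀ b → timeOf b ℕ.< K
  timeOf<K b = time<K {layerOf b} (layerOf<k b) (depthOf<M b)

  top-involutive : ∀ {h} → h ℕ.< k → top (top h) ≡ h
  top-involutive {h} h<k = ℤₚ.+-injective (trans (+top (top<k h)) (trans (cong (λ z → + k - 1ℤ - z) (+top h<k)) (l (+ k) (+ h))))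
    where
    l : ∀ k h → k - 1ℤ - (k - 1ℤ - h) ≡ h
    l = solve-∀

  boxAt-layerOf : ∀ b .(r : P ⟦ Box.column b ⟧ ≡ R) → boxAt (layerOf b) (Box.column b) r ≡ b
  boxAt-layerOf b r = box-≡ refl (Finₚ.toℕ-injective (trans (Finₚ.toℕ-fromℕ< (top<k (layerOf b))) (top-involutive (Finₚ.toℕ<n (Box.height b)))))

  layerOf-boxAt : ∀ {L c} .(r : P ⟦ c ⟧ ≡ R) → L ℕ.< k → layerOf (boxAt L c r) ≡ L
  layerOf-boxAt {L} r L<k = trans (cong top (Finₚ.toℕ-fromℕ< (top<k L))) (top-involutive L<k)

  depthOf-boxAt : ∀ {L d c} .(r : P ⟦ c ⟧ ≡ R) → d ℕ.< M → pred c ≋ u + + d → depthOf (boxAt L c r) ≡ d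
  depthOf-boxAt {L} {d} {c} r d<M h = %-unique {pred c - u} (≋-by h (l (pred c) u (+ d))) (ℕₚ.<-trans d<M M<n)
    where
    l : ∀ x u j → x - u - j ≡ x - (u + j)
    l = solve-∀

  pred-column-≋ : ∀ t → pred (column t) ≋ u + + depth t
  pred-column-≋ t = ≋-trans (≋-reflexive (ℤₚ.pred-suc (pos t + + layer t)))
    (Equivalence.to (pos-≋ (layer t) (depth t) (pos t)) (≋-reflexive (cong pos (sym (time-layer-depth t)))))

  timeOf-boxAt : ∀ {t} .(r : pr t ≡ R) → t ℕ.< K → timeOf (boxAt (layer t) (column t) r) ≡ t
  timeOf-boxAt {t} r t<K = trans (cong₂ time (layerOf-boxAt {layer t} {column t} r (layer<k t<K))
    (depthOf-boxAt {layer t} {depth t} {column t} r (depth< t) (pred-column-≋ t))) (time-layer-depth t)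

  column-timeOf-≋ : ∀ b → Box.column b ≋ column (timeOf b)
  column-timeOf-≋ b = ≋-trans (≋-reflexive (sym (ℤₚ.suc-pred (Box.column b)))) (column-≋ (layerOf b) (depthOf b) (pred (Box.column b)) (depthOf<M b) (depthOf-≋ b))

  pr-timeOf : ∀ b → pr (timeOf b) ≡ R
  pr-timeOf b = trans (sym (step-cong (column-timeOf-≋ b))) (horizontal′ b)

  timeOf-shift : ∀ b b′ → Box.column b′ ≋ Box.column b → Box.height b′ ≡ Box.height b → timeOf b′ ≡ timeOf b
  timeOf-shift b b′ h e = cong₂ time (cong (λ z → k ℕ.∸ ℕ.suc (toℕ z)) e) (%-cong {pred (Box.column b′) - u} {pred (Box.column b) - u} (≋-by h (l (Box.column b′) (Box.column b) u)))
    where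
    l : ∀ c′ c u → -1ℤ + c′ - u - (-1ℤ + c - u) ≡ c′ - c
    l = solve-∀

  fill : (ℕ → Tile) → Filling P
  fill τ = record
    { tile     = λ b → τ (timeOf b)
    ; periodic = λ b b′ e → cong τ (same b b′ e)
    }
    where
    same : ∀ b b′ → Box.corner b′ ≡ Box.corner b ⊕ (+ n - + k , + k) → timeOf b′ ≡ timeOf b
    same b b′ e = timeOf-shift b b′ (≋-trans (≋-reflexive (cong Box.column b′≡)) (≋-+N (Box.column b))) (cong Box.height b′≡)
      where
      b₊ : Box P
      b₊ = box (Box.column b + N) (trans (step-cong (≋-+N (Box.column b))) (horizontal′ b)) (Box.height b)
      l₁ : ∀ c N → -1ℤ + (c + N) ≡ -1ℤ + c + 1ℤ * N
      l₁ = solve-∀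
      l₂ : ∀ x d → x + 1ℤ * d + 0ℤ ≡ x + 0ℤ + d
      l₂ = solve-∀
      l₃ : ∀ x d h → x + 1ℤ * d + h ≡ x + h + d
      l₃ = solve-∀
      c = pred (Box.column b)
      b′≡ : b′ ≡ b₊
      b′≡ = corner-injective (trans e (sym (cong₂ _,_
        (trans (cong (_+ 0ℤ) (trans (cong X (l₁ (Box.column b) N)) (X-shift c 1ℤ))) (l₂ (X c) (+ n - + k)))
        (trans (cong (_+ + toℕ (Box.height b)) (trans (cong Y (l₁ (Box.column b) N)) (Y-shift c 1ℤ))) (l₃ (Y c) (+ k) (+ toℕ (Box.height b)))))))

  tileAt-fill : ∀ τ → Cuts.tileAt (fill τ) ≈[ K ] τ
  tileAt-fill τ t t<K r = trans (Cuts.tileAt-R (fill τ) t r) (cong τ (timeOf-boxAt {t} r t<K))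

  tile-timeOf : ∀ (F : Filling P) b → Filling.tile F b ≡ Cuts.tileAt F (timeOf b)
  tile-timeOf F b = trans (cong (Filling.tile F) (sym (boxAt-layerOf b (horizontal′ b)))) (trans (sym (Cuts.tile-shift F {Box.column b} {column (timeOf b)} (horizontal′ b) (pr-timeOf b) (≋-sym (column-timeOf-≋ b))))
    (trans (cong (λ L → Filling.tile F (boxAt L (column (timeOf b)) (pr-timeOf b))) (sym (layer-time (layerOf b) (depthOf<M b)))) (sym (Cuts.tileAt-R F (timeOf b) (pr-timeOf b)))))

module Distinction (n : ℕ) .{{nt : NonTrivial n}} {k : ℕ} (P : Periodic.𝒫 n k) (u : ℤ) (P-u : Periodic._⟦_⟧ n P u ≡ U) where

  open Periodic n
  open Mod n
  open Words n
  open Boxes n P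
  open Timed n P u P-u hiding (top)
  open Word u pr hiding (pos)

  module Distinguish (F : Filling P) where

    open Filling F
    open Cuts F
    open Strands n F
    open Parity n F using (parity)

    record BoxStrands (b : Box P) : Set where
      field
        p      : ℤ
        p-≋    : p ≋ pos (timeOf b)
        left   : Strand F (north P (ρ tileAt (timeOf b) p)) (entry P b fromLeft)
        top    : Strand F (north P (ρ tileAt (timeOf b) (1ℤ + p))) (entry P b fromTop)

    boxStrands : ∀ b → BoxStrands b
    boxStrands b = record
      { p    = p
      ; p-≋  = Equivalence.from (pos-≋ (layerOf b) (depthOf b) p) h
      ; left = subst (λ b₁ → Strand F (north P (ρ tileAt (timeOf b) p)) (entry P b₁ fromLeft)) b≡ At.strandLeft
      ; top  = subst (λ b₁ → Strand F (north P (ρ tileAt (timeOf b) (1ℤ + p))) (entry P b₁ fromTop)) b≡ At.strandTop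
      }
      where
      p : ℤ
      p = pred (Box.column b) - + layerOf b
      x≡ : p + + layerOf b ≡ pred (Box.column b)
      x≡ = l (pred (Box.column b)) (+ layerOf b)
        where
        l : ∀ c L → c - L + L ≡ c
        l = solve-∀
      c≡ : 1ℤ + (p + + layerOf b) ≡ Box.column b
      c≡ = trans (cong suc x≡) (ℤₚ.suc-pred (Box.column b))
      h : p + + layerOf b ≋ u + + depthOf b
      h = ≋-trans (≋-reflexive x≡) (depthOf-≋ b)
      module At = AtBox {layerOf b} {depthOf b} (layerOf<k b) (depthOf<M b) p h (trans (cong (P ⟦_⟧) c≡) (horizontal′ b))
      b≡ : At.b ≡ b
      b≡ = trans (box-≡ c≡ refl) (boxAt-layerOf b (horizontal′ b))

    Sorted : ℕ → Set
    Sorted t = ρ tileAt t (pos t) < ρ tileAt t (1ℤ + pos t)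

    sorted-⇔ : ∀ b → BoxStrands b → Sorted (timeOf b) ⇔ (∀ i j (t : Strand F (north P i) (entry P b fromLeft)) (v : Strand F (north P j) (entry P b fromTop)) → 2 ∣ℕ commonCrossings F t v)
    sorted-⇔ b S = mk⇔ to from
      where
      open BoxStrands S
      sorted-p : Sorted (timeOf b) ⇔ ρ tileAt (timeOf b) p < ρ tileAt (timeOf b) (1ℤ + p)
      sorted-p = ρ-<-shift tileAt (timeOf b) (pos (timeOf b)) p-≋
      to : Sorted (timeOf b) → ∀ i j (t : Strand F (north P i) (entry P b fromLeft)) (v : Strand F (north P j) (entry P b fromTop)) → 2 ∣ℕ commonCrossings F t v
      to lt i j t v = Equivalence.from (parity {i} {j} b t v) (subst₂ _<_ (source-unique {i = ρ tileAt (timeOf b) p} {i} left t)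
        (source-unique {i = ρ tileAt (timeOf b) (1ℤ + p)} {j} top v) (Equivalence.to sorted-p lt))
      from : (∀ i j (t : Strand F (north P i) (entry P b fromLeft)) (v : Strand F (north P j) (entry P b fromTop)) → 2 ∣ℕ commonCrossings F t v) → Sorted (timeOf b)
      from h = Equivalence.from sorted-p (Equivalence.to (parity {ρ tileAt (timeOf b) p} {ρ tileAt (timeOf b) (1ℤ + p)} b left top) (h (ρ tileAt (timeOf b) p) (ρ tileAt (timeOf b) (1ℤ + p)) left top))

    distinguished⇒valid : Distinguished F → Valid tileAt K
    distinguished⇒valid D t t<K r e = subst Sorted (timeOf-boxAt {t} r t<K)
      (Equivalence.from (sorted-⇔ b (boxStrands b)) (D b (trans (sym (tileAt-R t r)) e)))
      where
      b : Box P
      b = boxAt (layer t) (column t) r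

    valid⇒distinguished : Valid tileAt K → Distinguished F
    valid⇒distinguished V b e = Equivalence.to (sorted-⇔ b (boxStrands b)) (V (timeOf b) (timeOf<K b) (pr-timeOf b) (trans (sym (tile-timeOf F b)) e))

module Elbows (n : ℕ) .{{nt : NonTrivial n}} {k : ℕ} (P : Periodic.𝒫 n k) (u : ℤ) (P-u : Periodic._⟦_⟧ n P u ≡ U) where

  open Periodic n
  open Mod n
  open Residues n
  open Words n
  open Paths n P
  open Boxes n P
  open Timed n P u P-u
  open Word u pr hiding (pos)

  private instance
    n≢0 : NonZero n
    n≢0 = nonTrivial⇒nonZero n

  Elbow : (ℕ → Tile) → ℕ → Set
  Elbow τ t = Σ[ r ∈ ℕ ] (r ℕ.< t × pr r ≡ R × τ r ≡ elbow)

  Elbow-≡ : ∀ {τ t} {a b : Elbow τ t} → proj₁ a ≡ proj₁ b → a ≡ b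
  Elbow-≡ {a = r , x , y , z} {.r , x′ , y′ , z′} refl
    with ℕₚ.<-irrelevant x x′ | Decidable⇒UIP.≡-irrelevant _≟ₛ_ y y′ | Decidable⇒UIP.≡-irrelevant _≟ₜ_ z z′
  ... | refl | refl | refl = refl

  Elbow-suc : ∀ τ t → (pr t ≡ R × τ t ≡ elbow) → Elbow τ (ℕ.suc t) ↔ (⊤ ⊎ Elbow τ t)
  Elbow-suc τ t (x , y) = mk↔ₛ′ to from to-from from-to
    where
    to : Elbow τ (ℕ.suc t) → ⊤ ⊎ Elbow τ t
    to (r , r<1+t , h) with r ℕ.≟ t
    ... | yes _ = inj₁ _
    ... | no r≢t = inj₂ (r , ℕₚ.≤∧≢⇒< (ℕₚ.≤-pred r<1+t) r≢t , h)
    from : ⊤ ⊎ Elbow τ t → Elbow τ (ℕ.suc t)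
    from (inj₁ _) = t , ℕₚ.≤-refl , x , y
    from (inj₂ (r , r<t , h)) = r , ℕₚ.m<n⇒m<1+n r<t , h
    to-from : ∀ a → to (from a) ≡ a
    to-from (inj₁ _) with t ℕ.≟ t
    ... | yes _ = refl
    ... | no ne = contradiction refl ne
    to-from (inj₂ (r , r<t , h)) with r ℕ.≟ t
    ... | yes e = contradiction r<t (ℕₚ.<-irrefl e)
    ... | no _ = cong inj₂ (Elbow-≡ refl)
    from-to : ∀ a → from (to a) ≡ a
    from-to (r , r<1+t , h) with r ℕ.≟ t
    ... | yes refl = Elbow-≡ refl
    ... | no _ = Elbow-≡ refl

  Elbow-skip : ∀ τ t → ¬ (pr t ≡ R × τ t ≡ elbow) → Elbow τ (ℕ.suc t) ↔ Elbow τ t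
  Elbow-skip τ t nx = mk↔ₛ′ to (λ (r , r<t , h) → r , ℕₚ.m<n⇒m<1+n r<t , h) (λ _ → Elbow-≡ refl) (λ _ → Elbow-≡ refl)
    where
    to : Elbow τ (ℕ.suc t) → Elbow τ t
    to (r , r<1+t , h) = r , ℕₚ.≤∧≢⇒< (ℕₚ.≤-pred r<1+t) (λ { refl → nx h }) , h

  Elbow-count : ∀ τ t → Elbow τ t ↔ Fin (count τ t)
  Elbow-count τ ℕ.zero = mk↔ₛ′ (λ ()) (λ ()) (λ ()) (λ ())
  Elbow-count τ (ℕ.suc t) with pr t in e₁ | τ t in e₂
  ... | U | c        = Elbow-count τ t ↔-∘ Elbow-skip τ t (λ (h , _) → contradiction (trans (sym e₁) h) λ ())
  ... | R | crossing = Elbow-count τ t ↔-∘ Elbow-skip τ t (λ (_ , h) → contradiction (trans (sym e₂) h) λ ())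
  ... | R | elbow    = ↔-sym Finₚ.+↔⊎ ↔-∘ ((↔-sym Finₚ.1↔⊤ ⊎-↔ Elbow-count τ t) ↔-∘ Elbow-suc τ t (e₁ , e₂))

  representative : ℤ → ℤ
  representative c = 1ℤ + + (pred c %ℕ n)

  representative-≋ : ∀ c → representative c ≋ c
  representative-≋ c = ≋-trans (≋-+ 1ℤ (≋-sym (≋-% (pred c)))) (≋-reflexive (ℤₚ.suc-pred c))

  representative-∈ : ∀ c → representative c ∈[n]
  representative-∈ c = +≤+ (ℕ.s≤s ℕ.z≤n) , +≤+ (n%ℕd<d (pred c) n)

  ∈[n]-unique : ∀ {a b} → a ∈[n] → b ∈[n] → a ≋ b → a ≡ b
  ∈[n]-unique {a} {b} (1≤a , a≤n) (1≤b , b≤n) h = ≋-unique h (⇒< (≤-by₂ a≤n 1≤b (l N a b))) (⇒< (≤-by₂ b≤n 1≤a (l N b a)))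
    where
    l : ∀ N a b → N - (1ℤ + (a - b)) ≡ (N - a) + (b - 1ℤ)
    l = solve-∀

  ∈[n]-irrelevant : ∀ {a} (x y : a ∈[n]) → x ≡ y
  ∈[n]-irrelevant (x , y) (x′ , y′) = cong₂ _,_ (ℤₚ.≤-irrelevant x x′) (ℤₚ.≤-irrelevant y y′)

  module Count (F : Filling P) where

    open Filling F
    open Cuts F

    ElbowMod-≡ : {a b : ElbowModTranslation F} → proj₁ a ≡ proj₁ b → a ≡ b
    ElbowMod-≡ {b , x , y} {.b , x′ , y′} refl = cong (b ,_) (cong₂ _,_ (∈[n]-irrelevant x x′) (Decidable⇒UIP.≡-irrelevant _≟ₜ_ y y′))

    boxFor : ∀ t → pr t ≡ R → Box P
    boxFor t r = box (representative (column t)) (trans (step-cong (representative-≋ (column t))) r) (Box.height (boxAt (layer t) (column t) r))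

    tile-boxFor : ∀ t (r : pr t ≡ R) → tile (boxFor t r) ≡ tileAt t
    tile-boxFor t r = trans (tile-shift r (trans (step-cong (representative-≋ (column t))) r) (representative-≋ (column t))) (sym (tileAt-R t r))

    timeOf-boxFor : ∀ t (r : pr t ≡ R) → t ℕ.< K → timeOf (boxFor t r) ≡ t
    timeOf-boxFor t r t<K = trans (timeOf-shift (boxAt (layer t) (column t) r) (boxFor t r) (representative-≋ (column t)) refl) (timeOf-boxAt {t} r t<K)

    boxFor-timeOf : ∀ b (r : pr (timeOf b) ≡ R) → Box.column b ∈[n] → boxFor (timeOf b) r ≡ b
    boxFor-timeOf b r b∈ = box-≡ (∈[n]-unique (representative-∈ (column (timeOf b))) b∈ (≋-trans (representative-≋ (column (timeOf b))) (≋-sym (column-timeOf-≋ b))))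
      (trans (cong (λ L → fromℕ< (top<k L)) (layer-time (layerOf b) (depthOf<M b))) (cong Box.height (boxAt-layerOf b (horizontal′ b))))

    elbows-↔ : ElbowModTranslation F ↔ Elbow tileAt K
    elbows-↔ = mk↔ₛ′
      (λ (b , _ , e) → timeOf b , timeOf<K b , pr-timeOf b , trans (sym (tile-timeOf F b)) e)
      (λ (t , t<K , r , e) → boxFor t r , representative-∈ (column t) , trans (tile-boxFor t r) e)
      (λ (t , t<K , r , e) → Elbow-≡ (timeOf-boxFor t r t<K))
      (λ (b , b∈ , e) → ElbowMod-≡ (boxFor-timeOf b (pr-timeOf b) b∈))

    elbows-count : HasCardinality (ElbowModTranslation F) (count tileAt K)
    elbows-count = Elbow-count tileAt K ↔-∘ elbows-↔

    elbows-⇔ : ∀ r → (∃[ m ] (+ m ≡ r × HasCardinality (ElbowModTranslation F) m)) ⇔ (+ count tileAt K ≡ r)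
    elbows-⇔ r = mk⇔
      (λ (m , e , h) → trans (cong +_ (↔⇒≡ (h ↔-∘ ↔-sym elbows-count))) e)
      (λ e → count tileAt K , e , elbows-count)

-- Lengths

module Lengths (n : ℕ) .{{nt : NonTrivial n}} where

  open Periodic n
  open Mod n

  private instance
    n≢0 : NonZero n
    n≢0 = nonTrivial⇒nonZero n

  Shifts : (ℤ → ℤ) → Set
  Shifts f = ∀ a m → f (a + m * N) ≡ f a + m * N

  affine-shifts : ∀ {f} → IsAffinePermutation f → Shifts f
  affine-shifts {f} A a = ℤ-ind (λ m → f (a + m * N) ≡ f a + m * N)
    (trans (cong f (z a)) (sym (z (f a))))
    (λ m h → trans (cong f (s′ a m)) (trans (periodic (a + m * N)) (trans (cong (_+ N) h) (sym (s′ (f a) m)))))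
    (λ m h → ℤ-group.∙-cancelʳ N _ _ (trans (sym (periodic (a + m * N))) (trans (cong f (sym (s′ a m))) (trans h (s′ (f a) m)))))
    where
    open IsAffinePermutation A
    z : ∀ a → a + 0ℤ * N ≡ a
    z a = trans (cong (λ t → a + t) (ℤₚ.*-zeroˡ N)) (ℤₚ.+-identityʳ a)
    s″ : ∀ a m x → a + (1ℤ + m) * x ≡ a + m * x + x
    s″ = solve-∀
    s′ : ∀ a m → a + (1ℤ + m) * N ≡ a + m * N + N
    s′ a m = s″ a m N

  Inversion-≡ : ∀ {f} {x y : Inversion f} → proj₁ x ≡ proj₁ y → x ≡ y
  Inversion-≡ {x = (a , b) , (p , q) , r , t} {.(a , b) , (p′ , q′) , r′ , t′} refl
    with ℤₚ.≤-irrelevant p p′ | ℤₚ.≤-irrelevant q q′ | ℤₚ.<-irrelevant r r′ | ℤₚ.<-irrelevant t t′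
  ... | refl | refl | refl | refl = refl

  length-≤ : ∀ {f g l m} → HasLength f l → HasLength g m → (φ : Inversion f → Inversion g) → (∀ {x y} → φ x ≡ φ y → x ≡ y) → l ℕ.≤ m
  length-≤ F G φ φ-inj = Finₚ.injective⇒≤ {f = Inverse.to G ∘ φ ∘ Inverse.from F} λ e → inj-from (φ-inj (inj-to e))
    where
    inj-to : ∀ {x y} → Inverse.to G x ≡ Inverse.to G y → x ≡ y
    inj-to {x} {y} e = trans (sym (Inverse.strictlyInverseʳ G x)) (trans (cong (Inverse.from G) e) (Inverse.strictlyInverseʳ G y))
    inj-from : ∀ {x y} → Inverse.from F x ≡ Inverse.from F y → x ≡ y
    inj-from {x} {y} e = trans (sym (Inverse.strictlyInverseˡ F x)) (trans (cong (Inverse.to F) e) (Inverse.strictlyInverseˡ F y))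

  right-ascent : ∀ {i f} → IsAffinePermutation f → f · s i ≻ f → ∀ {a b} → f a ≡ i → f b ≡ 1ℤ + i → a < b
  right-ascent {i} {f} A (l , m , Hf , Hfs , l<m) {a} {b} fa fb = ℤₚ.≰⇒> λ b≤a →
    ℕₚ.<⇒≱ l<m (length-≤ Hfs Hf (λ ((x , y) , x∈ , x<y , inv) → (x , y) , x∈ , x<y , keep b≤a x<y inv) λ e → Inversion-≡ (cong proj₁ e))
    where
    open IsAffinePermutation A
    f-injective : ∀ {x y} → f x ≡ f y → x ≡ y
    f-injective = proj₁ bijective
    keep : ∀ {x y} → b ≤ a → x < y → s i (f y) < s i (f x) → f y < f x
    keep {x} {y} b≤a x<y inv = ℤₚ.≰⇒> λ le → ℤₚ.<-asym inv
      (s-mono (ℤₚ.≤∧≢⇒< le (λ e → ℤₚ.<⇒≢ x<y (f-injective e))) λ { (by m e , e′) →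
        ℤₚ.<⇒≱ (subst₂ _<_
          (f-injective (trans e (trans (cong (_+ m * N) (sym fa)) (sym (affine-shifts A a m)))))
          (f-injective (trans e′ (trans (cong (λ z → 1ℤ + z) e) (trans (l₁ i (m * N)) (trans (cong (_+ m * N) (sym fb)) (sym (affine-shifts A b m)))))))
          x<y) (ℤₚ.+-monoˡ-≤ (m * N) b≤a) })
      where
      l₁ : ∀ i x → 1ℤ + (i + x) ≡ 1ℤ + i + x
      l₁ = solve-∀

  left-≤ : ∀ {i g h} → Shifts g → Shifts h → (∀ x → h (s i x) ≡ g x) → g i < g (1ℤ + i) → ∀ {l m} → HasLength g l → HasLength h m → l ℕ.≤ m
  left-≤ {i} {g} {h} Sg Sh h∘s asc G H = length-≤ G H φ φ-injective
    where
    q : ℤ → ℤ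
    q x = - (pred (s i x) /ℕ n)
    normal : ∀ x → 1ℤ + + (pred (s i x) %ℕ n) ≡ s i x + q x * N
    normal x = trans (cong (λ z → 1ℤ + z) (l₁ (+ (pred (s i x) %ℕ n)) (pred (s i x) /ℕ n) N))
      (trans (cong (λ z → 1ℤ + (z + q x * N)) (sym (a≡a%ℕn+[a/ℕn]*n (pred (s i x)) n))) (l₂ (s i x) (q x * N)))
      where
      l₁ : ∀ r q N → r ≡ r + q * N + - q * N
      l₁ = solve-∀
      l₂ : ∀ s t → 1ℤ + (-1ℤ + s + t) ≡ s + t
      l₂ = solve-∀
    x<y⇒ : ∀ {x y} → x < y → g y < g x → s i x < s i y
    x<y⇒ {x} {y} x<y inv = s-mono x<y λ { (by m refl , refl) → ℤₚ.<-asym inv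
      (subst₂ _<_ (sym (Sg i m)) (sym (trans (cong g (l₁ i (m * N))) (Sg (1ℤ + i) m))) (ℤₚ.+-monoˡ-< (m * N) asc)) }
      where
      l₁ : ∀ i x → 1ℤ + (i + x) ≡ 1ℤ + i + x
      l₁ = solve-∀
    value : ∀ x m → h (s i x + m * N) ≡ g x + m * N
    value x m = trans (Sh (s i x) m) (cong (_+ m * N) (h∘s x))
    φ : Inversion g → Inversion h
    φ ((x , y) , _ , x<y , inv) = (s i x + q x * N , s i y + q x * N) ,
      subst _∈[n] (normal x) (+≤+ (ℕ.s≤s ℕ.z≤n) , +≤+ (n%ℕd<d (pred (s i x)) n)) ,
      ℤₚ.+-monoˡ-< (q x * N) (x<y⇒ x<y inv) ,
      subst₂ _<_ (sym (value y (q x))) (sym (value x (q x))) (ℤₚ.+-monoˡ-< (q x * N) inv)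
    φ-injective : ∀ {a b} → φ a ≡ φ b → a ≡ b
    φ-injective {(x , y) , (1≤x , x≤n) , _} {(x′ , y′) , (1≤x′ , x′≤n) , _} e = Inversion-≡ (cong₂ _,_ x≡ y≡)
      where
      e₁ : s i x + q x * N ≡ s i x′ + q x′ * N
      e₁ = cong (proj₁ ∘ proj₁) e
      sx≋ : s i x ≋ s i x′
      sx≋ = ≋-trans (≋-sym (≋-shift (s i x) (q x))) (≋-trans (≋-reflexive e₁) (≋-shift (s i x′) (q x′)))
      x≋ : x ≋ x′
      x≋ with sx≋
      ... | by m e′ = by m (s-injective i (trans e′ (sym (s-shift i x′ m))))
      l : ∀ N a b → N - (1ℤ + (a - b)) ≡ (N - a) + (b - 1ℤ)
      l = solve-∀
      x≡ : x ≡ x′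
      x≡ = ≋-unique x≋ (⇒< (≤-by₂ x≤n 1≤x′ (l N x x′))) (⇒< (≤-by₂ x′≤n 1≤x (l N x′ x)))
      y≡ : y ≡ y′
      y≡ = s-injective i (ℤ-group.∙-cancelʳ (q x * N) (s i y) (s i y′) (trans (cong (proj₂ ∘ proj₁) e) (cong (λ z → s i y′ + q z * N) (sym x≡))))

  i<1+i : ∀ i → i < 1ℤ + i
  i<1+i i = ⇒< ℤₚ.≤-refl

  s·-shifts : ∀ {i f} → Shifts f → Shifts (s i · f)
  s·-shifts {i} {f} S a m = trans (cong f (s-shift i a m)) (S (s i a) m)

  left-descent : ∀ {i f} → IsAffinePermutation f → s i · f ≺ f → f (1ℤ + i) < f i
  left-descent {i} {f} A (l , m , Hsf , Hf , l<m) = ℤₚ.≰⇒> λ le → ℕₚ.<⇒≱ l<m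
    (left-≤ {i} {f} {s i · f} (affine-shifts A) (s·-shifts {i} {f} (affine-shifts A)) (λ x → cong f (s-involutive i x))
      (ℤₚ.≤∧≢⇒< le λ e → ℤₚ.<⇒≢ (i<1+i i) (proj₁ (IsAffinePermutation.bijective A) e)) Hf Hsf)

  left-ascent : ∀ {i f} → IsAffinePermutation f → s i · f ≻ f → f i < f (1ℤ + i)
  left-ascent {i} {f} A (l , m , Hf , Hsf , l<m) = ℤₚ.≰⇒> λ le → ℕₚ.<⇒≱ l<m
    (left-≤ {i} {s i · f} {f} (s·-shifts {i} {f} (affine-shifts A)) (affine-shifts A) (λ x → refl)
      (subst₂ _<_ (cong f (sym (s-self i))) (cong f (sym (s-suc i)))
        (ℤₚ.≤∧≢⇒< le λ e → ℤₚ.<⇒≢ (i<1+i i) (sym (proj₁ (IsAffinePermutation.bijective A) e)))) Hsf Hf)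

-- The two strips

module Relabel (n : ℕ) .{{nt : NonTrivial n}} (b : ℤ) {pr pr′ : ℕ → Step} (pr≡ : ∀ t → pr t ≡ pr′ t) where

  open Words n
  private
    module W  = Word b pr
    module W′ = Word b pr′

  ρ-relabel : ∀ τ t p → W.ρ τ t p ≡ W′.ρ τ t p
  ρ-relabel τ ℕ.zero    p = refl
  ρ-relabel τ (ℕ.suc t) p = trans (ρ-relabel τ t _) (cong (λ x → W′.ρ τ t (move x (τ t) (b + + t) p)) (pr≡ t))

  count-relabel : ∀ τ t → W.count τ t ≡ W′.count τ t
  count-relabel τ ℕ.zero    = refl
  count-relabel τ (ℕ.suc t) = cong₂ ℕ._+_ (cong (λ x → weight x (τ t)) (pr≡ t)) (count-relabel τ t)

  Valid-relabel : ∀ τ t → W.Valid τ t ⇔ W′.Valid τ t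
  Valid-relabel τ t = mk⇔
    (λ v r r<t x y → subst₂ _<_ (ρ-relabel τ r _) (ρ-relabel τ r _) (v r r<t (trans (pr≡ r) x) y))
    (λ v r r<t x y → subst₂ _<_ (sym (ρ-relabel τ r _)) (sym (ρ-relabel τ r _)) (v r r<t (trans (sym (pr≡ r)) x) y))

module Admissible (n : ℕ) .{{nt : NonTrivial n}} (b : ℤ) (pr : ℕ → Step) where

  open Words n
  open Word b pr

  record Good (K : ℕ) (r : ℤ) (f : ℤ → ℤ) (c : ℤ) (τ : ℕ → Tile) : Set where
    constructor mkGood
    field
      valid  : Valid τ K
      labels : ∀ p → f (ρ τ K p) ≡ p + c
      total  : + count τ K ≡ r

  Good-cong : ∀ {K r f c τ τ′} → τ ≈[ K ] τ′ → Good K r f c τ → Good K r f c τ′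
  Good-cong {K} {f = f} h (mkGood v l c) = mkGood (Valid-cong K h v) (λ p → trans (cong f (sym (ρ-cong K h p))) (l p)) (trans (cong +_ (sym (count-cong K h))) c)

module Coding (n : ℕ) .{{nt : NonTrivial n}} {k : ℕ} (P : Periodic.𝒫 n k) (u : ℤ) (P-u : Periodic._⟦_⟧ n P u ≡ U) where

  open Periodic n
  open Words n
  open Timed n P u P-u
  open Word u pr hiding (pos)
  open Distinction n P u P-u
  open Elbows n P u P-u

  code : Filling P → ℕ → Tile
  code F = Cuts.tileAt F

  open Admissible n u pr

  good : ∀ {r f} (D : Deogram r f P) → Good K r f (+ k) (code (Deogram.filling D))
  good {r} {f} D = mkGood (Distinguish.distinguished⇒valid F distinguished) (Equivalence.to (Cuts.strandPermutation-⇔ F f) strandPermutation)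
    (Equivalence.to (Count.elbows-⇔ F r) elbows)
    where
    open Deogram D
    F = filling

  deogram : ∀ {r f τ} → Good K r f (+ k) τ → Deogram r f P
  deogram {r} {f} {τ} g = record
    { filling           = fill τ
    ; strandPermutation = Equivalence.from (Cuts.strandPermutation-⇔ (fill τ) f) labels
    ; distinguished     = Distinguish.valid⇒distinguished (fill τ) valid
    ; elbows            = Equivalence.from (Count.elbows-⇔ (fill τ) r) total
    }
    where
    open Good (Good-cong (≈-sym (tileAt-fill τ)) g)

  code-cong : ∀ (F G : Filling P) → (∀ b → Filling.tile F b ≡ Filling.tile G b) → code F ≈[ K ] code G
  code-cong F G h t t<K r = trans (Cuts.tileAt-R F t r) (trans (h _) (sym (Cuts.tileAt-R G t r)))

  code-injective : ∀ (F G : Filling P) → code F ≈[ K ] code G → ∀ b → Filling.tile F b ≡ Filling.tile G b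
  code-injective F G h b = trans (tile-timeOf F b) (trans (h (timeOf b) (timeOf<K b) (pr-timeOf b)) (sym (tile-timeOf G b)))

module Swaps (n : ℕ) .{{nt : NonTrivial n}} {k : ℕ} (P : Periodic.𝒫 n k) (i : ℤ)
  (P-i : Periodic._⟦_⟧ n P i ≡ U) (P-1+i : Periodic._⟦_⟧ n P (1ℤ + i) ≡ R) where

  open Periodic n
  open Mod n
  open Residues n
  open Paths n P

  P′ : 𝒫 k
  P′ = swap i P

  transpose-at₁ : ∀ {m} (a b : Fin m) → PC.transpose a b a ≡ b
  transpose-at₁ a b rewrite dec-true (a Finₚ.≟ a) refl = refl

  transpose-at₂ : ∀ {m} (a b : Fin m) → b ≢ a → PC.transpose a b b ≡ a
  transpose-at₂ a b b≢a rewrite dec-false (b Finₚ.≟ a) b≢a | dec-true (b Finₚ.≟ b) refl = refl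

  transpose-other : ∀ {m} (a b c : Fin m) → c ≢ a → c ≢ b → PC.transpose a b c ≡ c
  transpose-other a b c c≢a c≢b rewrite dec-false (c Finₚ.≟ a) c≢a | dec-false (c Finₚ.≟ b) c≢b = refl

  P′-low : ∀ {j} → j ≋ i → P′ ⟦ j ⟧ ≡ R
  P′-low {j} h = trans (cong (𝒫.step P) (trans (cong (PC.transpose (index i) (index (1ℤ + i))) (index-cong h)) (transpose-at₁ (index i) (index (1ℤ + i))))) P-1+i

  P′-high : P′ ⟦ 1ℤ + i ⟧ ≡ U
  P′-high = trans (cong (𝒫.step P) (transpose-at₂ (index i) (index (1ℤ + i)) λ e → ≋-suc-absurd (index-injective {1ℤ + i} {i} e) ≋-refl)) P-i

  P′-other : ∀ {j} → ¬ j ≋ i → ¬ j ≋ 1ℤ + i → P′ ⟦ j ⟧ ≡ P ⟦ j ⟧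
  P′-other {j} h h′ = cong (𝒫.step P) (transpose-other (index i) (index (1ℤ + i)) (index j) (h ∘ index-injective) (h′ ∘ index-injective))

  private
    module T  = Timed n P i P-i
    module T′ = Timed n P′ (1ℤ + i) P′-high

  0<M : 0 ℕ.< T.M
  0<M = ℕₚ.≤-<-trans ℕ.z≤n (T.depth< 0)

  pr-0 : ∀ L → T.pr (T.time L 0) ≡ R
  pr-0 L = trans (sym (T.pr-≋ L 0 i 0<M (≋-reflexive (sym (ℤₚ.+-identityʳ i))))) P-1+i

  -- Flipping the corner at step i removes the first letter of the word of P and appends one at the end.
  pr-shift-at : ∀ L d → d ℕ.< T.M → T.pr (ℕ.suc (T.time L d)) ≡ T′.pr (T′.time L d)
  pr-shift-at L d d<M with ℕ.suc d ℕ.≟ T.M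
  ... | yes e = trans (trans (cong (λ m → T.pr (m ℕ.+ L ℕ.* T.M)) e) (pr-0 (ℕ.suc L))) (sym (trans (sym (T′.pr-≋ L d x d<M ≋-refl)) (P′-low 1+x≋i)))
    where
    x = 1ℤ + i + + d
    l : ∀ i d → 1ℤ + (1ℤ + i + d) ≡ i + (1ℤ + (1ℤ + d))
    l = solve-∀
    1+x≋i : 1ℤ + x ≋ i
    1+x≋i = ≋-trans (≋-reflexive (trans (l i (+ d)) (cong (λ z → i + z) (trans (cong (λ m → 1ℤ + + m) e) (sym T.N≡))))) (≋-+N i)
  ... | no ne = trans (sym (T.pr-≋ L (ℕ.suc d) (i + + ℕ.suc d) 1+d<M ≋-refl))
      (trans (sym (trans (P′-other (λ h → contradiction (T.u-unique {j = 0} place₂ (≋-trans h (≋-reflexive (sym (ℤₚ.+-identityʳ i)))) 2+d<n (ℕₚ.<-trans 0<M T.M<n)) λ ())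
                                   (λ h → contradiction (T.u-unique {j = 1} place₂ (≋-trans h (≋-reflexive (ℤₚ.+-comm 1ℤ i))) 2+d<n (ℕₚ.≤-<-trans 0<M T.M<n)) λ ()))
                         (cong (P ⟦_⟧) (l₂ i (+ d)))))
             (T′.pr-≋ L d x d<M ≋-refl))
    where
    x = 1ℤ + i + + d
    1+d<M : ℕ.suc d ℕ.< T.M
    1+d<M = ℕₚ.≤∧≢⇒< d<M ne
    2+d<n : ℕ.suc (ℕ.suc d) ℕ.< n
    2+d<n = ℕₚ.≤-<-trans 1+d<M T.M<n
    l₁ : ∀ i d → 1ℤ + (1ℤ + i + d) ≡ i + (1ℤ + (1ℤ + d))
    l₁ = solve-∀
    l₂ : ∀ i d → 1ℤ + (1ℤ + i + d) ≡ 1ℤ + (i + (1ℤ + d))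
    l₂ = solve-∀
    place₂ : 1ℤ + x ≋ i + + ℕ.suc (ℕ.suc d)
    place₂ = ≋-reflexive (l₁ i (+ d))

  pr-shift : ∀ t → T.pr (ℕ.suc t) ≡ T′.pr t
  pr-shift t = subst (λ t → T.pr (ℕ.suc t) ≡ T′.pr t) (T.time-layer-depth t) (pr-shift-at (T.layer t) (T.depth t) (T.depth< t))

module Exchange (n : ℕ) .{{nt : NonTrivial n}} {k : ℕ} (P : Periodic.𝒫 n k) (i : ℤ)
  (P-i : Periodic._⟦_⟧ n P i ≡ U) (P-1+i : Periodic._⟦_⟧ n P (1ℤ + i) ≡ R)
  (f : ℤ → ℤ) (f∈𝐁 : Periodic.𝐁 n k f) (sf∈𝐁 : Periodic.𝐁 n k (Periodic.s n i · f)) (fs≻f : Periodic._≻_ n (f · Periodic.s n i) f)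
  where

  open Periodic n
  open Mod n
  open Words n
  open Lengths n
  open Swaps n P i P-i P-1+i

  private
    module T  = Timed n P i P-i
    module T′ = Timed n P′ (1ℤ + i) P′-high
    module W  = Word i T.pr
    module W′ = Word (1ℤ + i) T′.pr
    module G  = Admissible n i T.pr
    module G′ = Admissible n (1ℤ + i) T′.pr
    module Co  = Coding n P i P-i
    module Co′ = Coding n P′ (1ℤ + i) P′-high

  open Transducer i i T.pr

  affine : IsAffinePermutation f
  affine = 𝐁.isAffinePermutation f∈𝐁

  f-shift : Shifts f
  f-shift = affine-shifts affine

  s-translate : ∀ q a c → s (q + c) (a + c) ≡ s q a + c
  s-translate q a c with place q a
  ... | low h e    = trans (s-low (≋-by h (l a c q))) (trans (sym (ℤₚ.+-assoc 1ℤ a c)) (cong (_+ c) (sym e)))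
    where
    l : ∀ a c q → a + c - (q + c) ≡ a - q
    l = solve-∀
  ... | high h e   = trans (s-high (≋-by h (l a c q))) (trans (sym (ℤₚ.+-assoc -1ℤ a c)) (cong (_+ c) (sym e)))
    where
    l : ∀ a c q → a + c - (1ℤ + (q + c)) ≡ a - (1ℤ + q)
    l = solve-∀
  ... | away h h′ e = trans (s-away (λ z → h (≋-by z (l a c q))) (λ z → h′ (≋-by z (l₂ a c q)))) (cong (_+ c) (sym e))
    where
    l : ∀ a c q → a - q ≡ a + c - (q + c)
    l = solve-∀
    l₂ : ∀ a c q → a - (1ℤ + q) ≡ a + c - (1ℤ + (q + c))
    l₂ = solve-∀

  image : Tile → ℤ → ℤ
  image c a = s i (f (sw c a))

  elbowsLeft : Tile → ℤ → ℤ
  elbowsLeft elbow    r = r - 1ℤ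
  elbowsLeft crossing r = r

  elbowsLeft-⇔ : ∀ c {m m′ r} → m ≡ m′ ℕ.+ weight R c → + m ≡ r ⇔ + m′ ≡ elbowsLeft c r
  elbowsLeft-⇔ crossing {m} {m′} refl = mk⇔ (trans (cong +_ (sym (ℕₚ.+-identityʳ m′)))) (trans (cong +_ (ℕₚ.+-identityʳ m′)))
  elbowsLeft-⇔ elbow {m} {m′} {r} refl = mk⇔ (λ { refl → l (+ m′) }) (λ e → trans (cong (_+ 1ℤ) e) (l₂ r))
    where
    l : ∀ x → x ≡ x + 1ℤ - 1ℤ
    l = solve-∀
    l₂ : ∀ x → x - 1ℤ + 1ℤ ≡ x
    l₂ = solve-∀

  Balanced : Tile → Set
  Balanced c = c ≡ elbow → f i < f (1ℤ + i)

  K₀ : ℕ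
  K₀ = ℕ.pred T.K

  0<K : 0 ℕ.< T.K
  0<K = T.time<K {0} {0} T.k≥1 0<M

  1+K₀ : T.K ≡ ℕ.suc K₀
  1+K₀ = sym (ℕₚ.suc-pred T.K {{ℕ.>-nonZero 0<K}})

  pr′-K₀ : T′.pr K₀ ≡ R
  pr′-K₀ = trans (sym (pr-shift K₀)) (trans (cong T.pr (sym 1+K₀)) (pr-0 k))

  q₀ : ℤ
  q₀ = W′.pos K₀

  q₀-≋ : q₀ + + k ≋ i
  q₀-≋ = by (+ k) (trans (l i (+ K₀) (+ k)) (cong (λ z → i + z) (trans (cong (_+ + k) (trans (cong +_ (sym 1+K₀)) (ℤₚ.pos-* k T.M))) (trans (l₂ (+ k) (+ T.M)) (cong (+ k *_) (sym T.N≡))))))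
    where
    l : ∀ i K k → 1ℤ + i + K + k ≡ i + (1ℤ + K + k)
    l = solve-∀
    l₂ : ∀ k M → k * M + k ≡ k * (1ℤ + M)
    l₂ = solve-∀

  s-q₀ : ∀ p → s q₀ p + + k ≡ s i (p + + k)
  s-q₀ p = trans (sym (s-translate q₀ p (+ k))) (s-cong (p + + k) q₀-≋)

  module _ (τ : ℕ → Tile) (τ0 : τ 0 ≡ elbow) where
    private
      module TT = Tail i T.pr τ τ0
      module RR = Relabel n (1ℤ + i) pr-shift

    ρ-rest : ∀ t p → W.ρ τ (ℕ.suc t) p ≡ W′.ρ (τ ∘ ℕ.suc) t p
    ρ-rest t p = trans (TT.ρ-tail t p) (RR.ρ-relabel (τ ∘ ℕ.suc) t p)

    count-rest : ∀ t → W.count τ (ℕ.suc t) ≡ W′.count (τ ∘ ℕ.suc) t ℕ.+ 1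
    count-rest t = trans (TT.count-tail t) (cong₂ ℕ._+_ (RR.count-relabel (τ ∘ ℕ.suc) t) (cong (λ x → weight x elbow) (pr-0 0)))

    Valid-rest : ∀ t → W.Valid τ (ℕ.suc t) ⇔ W′.Valid (τ ∘ ℕ.suc) t
    Valid-rest t = mk⇔ (Equivalence.to (RR.Valid-relabel (τ ∘ ℕ.suc) t) ∘ Equivalence.to (TT.Valid-tail t))
                       (Equivalence.from (TT.Valid-tail t) ∘ Equivalence.from (RR.Valid-relabel (τ ∘ ℕ.suc) t))

  module _ {τ : ℕ → Tile} (τ-last : τ K₀ ≡ crossing) where

    ρ-last : ∀ p → W′.ρ τ (ℕ.suc K₀) p ≡ W′.ρ τ K₀ (s q₀ p)
    ρ-last p = cong₂ (λ x c → W′.ρ τ K₀ (move x c q₀ p)) pr′-K₀ τ-last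

    count-last : W′.count τ (ℕ.suc K₀) ≡ W′.count τ K₀
    count-last = cong₂ (λ x c → weight x c ℕ.+ W′.count τ K₀) pr′-K₀ τ-last

    Valid-last : W′.Valid τ K₀ → W′.Valid τ (ℕ.suc K₀)
    Valid-last v r r<1+K₀ = [ v r , (λ { refl _ e → contradiction (trans (sym e) τ-last) λ () }) ]′ (ℕₚ.m<1+n⇒m<n∨m≡n r<1+K₀)

  Ordered-⇔ : ∀ {K τ} → (∀ p → f (W.ρ τ K p) ≡ p + + k) → Ordered (W.ρ τ K) ⇔ f i < f (1ℤ + i)
  Ordered-⇔ {K} {τ} fρ = mk⇔ to from
    where
    at-label : ∀ a → f a ≡ W.π τ K a + + k
    at-label a = trans (cong f (sym (W.ρπ τ K a))) (fρ (W.π τ K a))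
    to : Ordered (W.ρ τ K) → f i < f (1ℤ + i)
    to o = subst₂ _<_ (sym (at-label i)) (sym (at-label (1ℤ + i))) (ℤₚ.+-monoˡ-< (+ k) (o _ _ (W.ρπ τ K i) (W.ρπ τ K (1ℤ + i))))
    from : f i < f (1ℤ + i) → Ordered (W.ρ τ K)
    from lt p p′ e₀ e = ℤₚ.≰⇒> λ le → ℤₚ.<⇒≱ lt (subst₂ _≤_ (trans (sym (fρ p′)) (cong f e)) (trans (sym (fρ p)) (cong f e₀)) (ℤₚ.+-monoˡ-≤ (+ k) le))

  module Link {τ τ′ τ″ : ℕ → Tile} {c : Tile} (Tr : Trans τ τ′ T.K c) (τ′0 : τ′ 0 ≡ elbow)
    (rest : (τ′ ∘ ℕ.suc) W′.≈[ K₀ ] τ″) (last : τ″ K₀ ≡ crossing) where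

    labels-≡ : ∀ p → W.ρ τ′ T.K p ≡ W′.ρ τ″ T.K (s q₀ p)
    labels-≡ p = trans (cong (λ K → W.ρ τ′ K p) 1+K₀) (trans (ρ-rest τ′ τ′0 K₀ p) (trans (W′.ρ-cong K₀ rest p)
      (trans (cong (W′.ρ τ″ K₀) (sym (s-involutive q₀ p))) (trans (sym (ρ-last {τ″} last (s q₀ p))) (cong (λ K → W′.ρ τ″ K (s q₀ p)) (sym 1+K₀))))))

    count-≡ : W.count τ T.K ≡ W′.count τ″ T.K ℕ.+ weight R c
    count-≡ = ℕₚ.+-cancelʳ-≡ 1 _ _ (trans (Trans-count Tr) (trans (cong (ℕ._+ weight R c) count-τ′)
      (trans (ℕₚ.+-assoc (W′.count τ″ T.K) 1 (weight R c)) (trans (cong (W′.count τ″ T.K ℕ.+_) (ℕₚ.+-comm 1 (weight R c))) (sym (ℕₚ.+-assoc (W′.count τ″ T.K) (weight R c) 1))))))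
      where
      count-τ′ : W.count τ′ T.K ≡ W′.count τ″ T.K ℕ.+ 1
      count-τ′ = trans (cong (W.count τ′) 1+K₀) (trans (count-rest τ′ τ′0 K₀) (cong (ℕ._+ 1)
        (trans (W′.count-cong K₀ rest) (trans (sym (count-last {τ″} last)) (cong (W′.count τ″) (sym 1+K₀))))))

    valid-⇔ : W.Valid τ′ T.K ⇔ W′.Valid τ″ T.K
    valid-⇔ = mk⇔
      (λ v → subst (W′.Valid τ″) (sym 1+K₀) (Valid-last {τ″} last (W′.Valid-cong K₀ rest (Equivalence.to (Valid-rest τ′ τ′0 K₀) (subst (W.Valid τ′) 1+K₀ v)))))
      (λ v → subst (W.Valid τ′) (sym 1+K₀) (Equivalence.from (Valid-rest τ′ τ′0 K₀) (W′.Valid-cong K₀ (W′.≈-sym rest)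
        (λ r r<K₀ → subst (W′.Valid τ″) 1+K₀ v r (ℕₚ.m<n⇒m<1+n r<K₀)))))

    image-⇔ : (∀ p → f (W.ρ τ T.K p) ≡ p + + k) ⇔ (∀ p → image c (W′.ρ τ″ T.K p) ≡ p + + k)
    image-⇔ = mk⇔
      (λ h p → trans (cong (s i ∘ f) (sym (label (s q₀ p) p (s-involutive q₀ p)))) (trans (cong (s i) (trans (h (s q₀ p)) (s-q₀ p))) (s-involutive i (p + + k))))
      (λ h p → trans (cong f (label p (s q₀ p) refl)) (trans (sym (s-involutive i _)) (trans (cong (s i) (trans (h (s q₀ p)) (s-q₀ p))) (s-involutive i (p + + k)))))
      where
      label : ∀ p p′ → s q₀ p ≡ p′ → W.ρ τ T.K p ≡ sw c (W′.ρ τ″ T.K p′)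
      label p p′ refl = trans (Trans-ρ Tr p) (cong (sw c) (labels-≡ p))

    ordered-⇔ : (∀ p → f (W.ρ τ T.K p) ≡ p + + k) → c ≡ elbow → Ordered (W.ρ τ′ T.K) ⇔ f i < f (1ℤ + i)
    ordered-⇔ h refl = Ordered-⇔ {T.K} {τ′} (λ p → trans (cong f (sym (Trans-ρ Tr p))) (h p))

    forth : ∀ {r} → G.Good T.K r f (+ k) τ → G′.Good T.K (elbowsLeft c r) (image c) (+ k) τ″ × Balanced c
    forth (G.mkGood v h t) = G′.mkGood (Equivalence.to valid-⇔ (proj₁ v′)) (Equivalence.to image-⇔ h) (Equivalence.to (elbowsLeft-⇔ c count-≡) t) ,
      λ e → Equivalence.to (ordered-⇔ h e) (proj₂ v′ e)
      where
      v′ = Equivalence.to (Trans-valid Tr) v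

    back : ∀ {r} → Balanced c → G′.Good T.K (elbowsLeft c r) (image c) (+ k) τ″ → G.Good T.K r f (+ k) τ
    back bal (G′.mkGood v h t) = G.mkGood (Equivalence.from (Trans-valid Tr) (Equivalence.from valid-⇔ v , λ e → Equivalence.from (ordered-⇔ h′ e) (bal e)))
      h′ (Equivalence.from (elbowsLeft-⇔ c count-≡) t)
      where
      h′ = Equivalence.from image-⇔ h

module Correspondence (n : ℕ) .{{nt : NonTrivial n}} {k : ℕ} (P : Periodic.𝒫 n k) (i : ℤ)
  (P-i : Periodic._⟦_⟧ n P i ≡ U) (P-1+i : Periodic._⟦_⟧ n P (1ℤ + i) ≡ R)
  (f : ℤ → ℤ) (f∈𝐁 : Periodic.𝐁 n k f) (sf∈𝐁 : Periodic.𝐁 n k (Periodic.s n i · f)) (fs≻f : Periodic._≻_ n (f · Periodic.s n i) f)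
  where

  open Periodic n
  open Mod n
  open Words n
  open Lengths n
  open Swaps n P i P-i P-1+i

  private
    module T  = Timed n P i P-i
    module T′ = Timed n P′ (1ℤ + i) P′-high
    module W  = Word i T.pr
    module W′ = Word (1ℤ + i) T′.pr
    module G  = Admissible n i T.pr
    module G′ = Admissible n (1ℤ + i) T′.pr
    module Co  = Coding n P i P-i
    module Co′ = Coding n P′ (1ℤ + i) P′-high

  open Transducer i i T.pr
  open Exchange n P i P-i P-1+i f f∈𝐁 sf∈𝐁 fs≻f

  preimage : ∀ {c z m a} → f c ≡ z → z ≡ a + m * N → f (c + - m * N) ≡ a
  preimage {c} {z} {m} {a} e refl = trans (f-shift c (- m)) (trans (cong (_+ - m * N) e) (l a m N))
    where
    l : ∀ a m N → a + m * N + - m * N ≡ a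
    l = solve-∀

  -- Otherwise s i · f would be out of bounds at x or at x + 1.
  ¬fixed-pair : ∀ {x z} → x ≋ i → z ≋ i → f x ≡ z → f (1ℤ + x) ≡ 1ℤ + z → ⊥
  ¬fixed-pair {x} {z} x≋i z≋i e e′ = ℤₚ.<⇒≱ (subst (_< 1ℤ + x) x≡z (i<1+i x)) lower
    where
    lower : 1ℤ + x ≤ z
    lower = subst (1ℤ + x ≤_) (trans (cong f (trans (s-high (≋-+ 1ℤ x≋i)) (ℤₚ.pred-suc x))) e) (proj₁ (𝐁.bounded sf∈𝐁 (1ℤ + x)))
    upper : 1ℤ + z ≤ x + N
    upper = subst (_≤ x + N) (trans (cong f (s-low x≋i)) e′) (proj₂ (𝐁.bounded sf∈𝐁 x))
    l₁ : ∀ x z N → N - (1ℤ + (x - z)) ≡ (z - (1ℤ + x)) + (N - 0ℤ)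
    l₁ = solve-∀
    l₂ : ∀ x z N → N - (1ℤ + (z - x)) ≡ x + N - (1ℤ + z)
    l₂ = solve-∀
    x≡z : x ≡ z
    x≡z = ≋-unique (≋-trans x≋i (≋-sym z≋i)) (⇒< (≤-by₂ lower (0≤+ {n}) (l₁ x z N))) (⇒< (≤-by upper (l₂ x z N)))

  last-forced : ∀ c {r τ} → G′.Good T.K r (image c) (+ k) τ → τ K₀ ≡ crossing
  last-forced c {r} {τ} (G′.mkGood v h t) = go (τ K₀) refl
    where
    z : ℤ
    z = q₀ + + k
    go : ∀ x → τ K₀ ≡ x → x ≡ crossing
    go crossing _ = refl
    go elbow    e = ⊥-elim (impossible c at-low at-high)
      where
      a b : ℤ
      a = W′.ρ τ K₀ q₀
      b = W′.ρ τ K₀ (1ℤ + q₀)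
      a<b : a < b
      a<b = v K₀ (ℕₚ.≤-reflexive (sym 1+K₀)) pr′-K₀ e
      ρ-same : ∀ p → W′.ρ τ T.K p ≡ W′.ρ τ K₀ p
      ρ-same p = trans (cong (λ K → W′.ρ τ K p) 1+K₀) (same p)
        where
        same : ∀ p → W′.ρ τ (ℕ.suc K₀) p ≡ W′.ρ τ K₀ p
        same p = cong₂ (λ x c → W′.ρ τ K₀ (move x c q₀ p)) pr′-K₀ e
      value : ∀ p → f (sw c (W′.ρ τ K₀ p)) ≡ s i (p + + k)
      value p = trans (sym (s-involutive i _)) (cong (s i) (trans (cong (image c) (sym (ρ-same p))) (h p)))
      at-low : f (sw c a) ≡ 1ℤ + z
      at-low = trans (value q₀) (s-low q₀-≋)
      at-high : f (sw c b) ≡ z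
      at-high = trans (value (1ℤ + q₀)) (trans (cong (s i) (ℤₚ.+-assoc 1ℤ q₀ (+ k))) (trans (s-high (≋-+ 1ℤ q₀-≋)) (ℤₚ.pred-suc z)))
      b<a : ∀ c → f (sw c a) ≡ 1ℤ + z → f (sw c b) ≡ z → sw c b < sw c a
      b<a c lo hi = below q₀-≋
        where
        l : ∀ a b x → a - b ≡ a + x - (b + x)
        l = solve-∀
        below : z ≋ i → sw c b < sw c a
        below (by m e) = <-by (right-ascent affine fs≻f (preimage {m = m} hi e) (preimage {m = m} lo (trans (cong (λ z → 1ℤ + z) e) (sym (ℤₚ.+-assoc 1ℤ i (m * N)))))) (l (sw c a) (sw c b) (- m * N))
      impossible : ∀ c → f (sw c a) ≡ 1ℤ + z → f (sw c b) ≡ z → ⊥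
      impossible elbow lo hi = ℤₚ.<-asym a<b (b<a elbow lo hi)
      impossible crossing lo hi with ≋-dec a i | b ≟ 1ℤ + a
      ... | yes a≋i | yes b≡ = ¬fixed-pair a≋i q₀-≋
              (trans (cong f (sym (trans (cong (s i) b≡) (trans (s-high (≋-+ 1ℤ a≋i)) (ℤₚ.pred-suc a))))) hi)
              (trans (cong f (sym (s-low a≋i))) lo)
      ... | no ¬a≋i | _ = ℤₚ.<-asym (s-mono a<b (¬a≋i ∘ proj₁)) (b<a crossing lo hi)
      ... | yes _ | no b≢ = ℤₚ.<-asym (s-mono a<b (b≢ ∘ proj₂)) (b<a crossing lo hi)

  pr₀ : T.pr 0 ≡ R
  pr₀ = pr-0 0

  Trans-first : ∀ {τ τ′ c} t → Trans τ τ′ (ℕ.suc t) c → τ′ 0 ≡ elbow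
  Trans-first ℕ.zero    (skip start u)         = contradiction u (R≢U {0} pr₀)
  Trans-first ℕ.zero    (copy start _ nm _)    = contradiction (inj₁ (≋-reflexive (ℤₚ.+-identityʳ i) , refl)) nm
  Trans-first ℕ.zero    (delay start _ _ e _)  = e
  Trans-first (ℕ.suc t) (skip Tr _)            = Trans-first t Tr
  Trans-first (ℕ.suc t) (copy Tr _ _ _)        = Trans-first t Tr
  Trans-first (ℕ.suc t) (delay Tr _ _ _ _)     = Trans-first t Tr

  Image : Tile → ℤ → Set
  Image c r = Deogram (elbowsLeft c r) (image c) P′

  record Output (τ : ℕ → Tile) : Set where
    field
      τ′    : ℕ → Tile
      c     : Tile
      trans′ : Trans τ τ′ T.K c

    τ″ : ℕ → Tile
    τ″ = update K₀ crossing (τ′ ∘ ℕ.suc)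

    first : τ′ 0 ≡ elbow
    first = Trans-first K₀ (subst (λ K → Trans τ τ′ K c) 1+K₀ trans′)

    below : (τ′ ∘ ℕ.suc) W′.≈[ K₀ ] τ″
    below t t<K₀ _ = update-other crossing (τ′ ∘ ℕ.suc) (ℕₚ.<⇒≢ t<K₀)

    last : τ″ K₀ ≡ crossing
    last = update-at K₀ crossing (τ′ ∘ ℕ.suc)

    open Link trans′ first below last public

  output : ∀ τ → Output τ
  output τ with Trans-forward τ T.K
  ... | τ′ , c , Tr = record { τ′ = τ′ ; c = c ; trans′ = Tr }

  prepend : (ℕ → Tile) → ℕ → Tile
  prepend τ ℕ.zero    = elbow
  prepend τ (ℕ.suc t) = τ t

  ≈-prepend : ∀ {τ₁ τ₂} → τ₁ 0 ≡ elbow → τ₂ 0 ≡ elbow → (τ₁ ∘ ℕ.suc) W′.≈[ K₀ ] (τ₂ ∘ ℕ.suc) → τ₁ W.≈[ T.K ] τ₂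
  ≈-prepend e₁ e₂ h ℕ.zero    _ _ = trans e₁ (sym e₂)
  ≈-prepend e₁ e₂ h (ℕ.suc t) t<K r = h t (ℕₚ.≤-pred (subst (ℕ.suc t ℕ.<_) 1+K₀ t<K)) (trans (sym (pr-shift t)) r)

  ≈-tail : ∀ {τ₁ τ₂} → τ₁ W.≈[ T.K ] τ₂ → (τ₁ ∘ ℕ.suc) W′.≈[ K₀ ] (τ₂ ∘ ℕ.suc)
  ≈-tail h t t<K₀ r = h (ℕ.suc t) (subst (ℕ.suc t ℕ.<_) (sym 1+K₀) (ℕ.s≤s t<K₀)) (trans (pr-shift t) r)

  ≈-last : ∀ {τ₁ τ₂} → τ₁ W′.≈[ K₀ ] τ₂ → τ₁ K₀ ≡ crossing → τ₂ K₀ ≡ crossing → τ₁ W′.≈[ T.K ] τ₂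
  ≈-last {τ₁} {τ₂} h e₁ e₂ = subst (λ K → τ₁ W′.≈[ K ] τ₂) (sym 1+K₀) (W′.≈-snoc h (λ _ → trans e₁ (sym e₂)))

  ≈-init : ∀ {τ₁ τ₂} → τ₁ W′.≈[ T.K ] τ₂ → τ₁ W′.≈[ K₀ ] τ₂
  ≈-init {τ₁} {τ₂} h = W′.≈-pred (subst (λ K → τ₁ W′.≈[ K ] τ₂) 1+K₀ h)

  ≈-refl : ∀ {τ t} → τ W′.≈[ t ] τ
  ≈-refl _ _ _ = refl

  ≈-trans : ∀ {τ₁ τ₂ τ₃ t} → τ₁ W′.≈[ t ] τ₂ → τ₂ W′.≈[ t ] τ₃ → τ₁ W′.≈[ t ] τ₃
  ≈-trans h h′ r r<t e = trans (h r r<t e) (h′ r r<t e)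

  module Assemble (r : ℤ) (B : Setoid 0ℓ 0ℓ)
    (inject : ∀ c → Balanced c → Image c r → Setoid.Carrier B)
    (inject-cong : ∀ c (bal bal′ : Balanced c) {X Y : Image c r} → (∀ b → Deogram.tile X b ≡ Deogram.tile Y b) →
      Setoid._≈_ B (inject c bal X) (inject c bal′ Y))
    (inject-injective : ∀ c c′ (bal : Balanced c) (bal′ : Balanced c′) {X : Image c r} {Y : Image c′ r} →
      Setoid._≈_ B (inject c bal X) (inject c′ bal′ Y) → c ≡ c′ × (∀ b → Deogram.tile X b ≡ Deogram.tile Y b))
    (inject-surjective : ∀ y → ∃[ c ] Σ[ bal ∈ Balanced c ] Σ[ X ∈ Image c r ] Setoid._≈_ B (inject c bal X) y)
    where

    open Setoid B using () renaming (Carrier to ∣B∣; _≈_ to _≈B_)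

    module Of (D : Deogram r f P) where
      open Output (output (Co.code (Deogram.filling D))) public

      balanced : Balanced c
      balanced = proj₂ (forth (Co.good D))

      target : Image c r
      target = Co′.deogram (proj₁ (forth (Co.good D)))

      code-target : Co′.code (Deogram.filling target) W′.≈[ T.K ] τ″
      code-target = T′.tileAt-fill τ″

    to : Deogram r f P → ∣B∣
    to D = inject (Of.c D) (Of.balanced D) (Of.target D)

    inject-≡ : ∀ {c c′} → c ≡ c′ → (bal : Balanced c) (bal′ : Balanced c′) {X : Image c r} {Y : Image c′ r} →
      (∀ b → Deogram.tile X b ≡ Deogram.tile Y b) → inject c bal X ≈B inject c′ bal′ Y
    inject-≡ {c} refl = inject-cong c

    same-code : ∀ {c c′} {X : Image c r} {Y : Image c′ r} {τ₁ τ₂} →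
      Co′.code (Deogram.filling X) W′.≈[ T.K ] τ₁ → Co′.code (Deogram.filling Y) W′.≈[ T.K ] τ₂ →
      τ₁ W′.≈[ T.K ] τ₂ → ∀ b → Deogram.tile X b ≡ Deogram.tile Y b
    same-code {X = X} {Y} h₁ h₂ h = Co′.code-injective (Deogram.filling X) (Deogram.filling Y) (≈-trans h₁ (≈-trans h (W′.≈-sym h₂)))

    to-link : ∀ D {c τ τ′ τ″} (bal : Balanced c) (X : Image c r) → Co.code (Deogram.filling D) W.≈[ T.K ] τ → Trans τ τ′ T.K c →
      (τ′ ∘ ℕ.suc) W′.≈[ K₀ ] τ″ → τ″ K₀ ≡ crossing → Co′.code (Deogram.filling X) W′.≈[ T.K ] τ″ → to D ≈B inject c bal X
    to-link D {c} {τ} {τ′} {τ″} bal X h Tr rest e hX = inject-≡ (proj₂ functional) (Of.balanced D) bal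
      (same-code {Of.c D} {c} {Of.target D} {X} (Of.code-target D) hX
        (≈-last (≈-trans (W′.≈-sym (Of.below D)) (≈-trans (≈-tail (proj₁ functional)) rest)) (Of.last D) e))
      where
      functional : Of.τ′ D W.≈[ T.K ] τ′ × Of.c D ≡ c
      functional = Trans-functional h (Of.trans′ D) Tr

    to-cong : ∀ {D E} → (∀ b → Deogram.tile D b ≡ Deogram.tile E b) → to D ≈B to E
    to-cong {D} {E} h = to-link D (Of.balanced E) (Of.target E) (Co.code-cong (Deogram.filling D) (Deogram.filling E) h)
      (Of.trans′ E) (Of.below E) (Of.last E) (Of.code-target E)

    to-injective : ∀ {D E} → to D ≈B to E → ∀ b → Deogram.tile D b ≡ Deogram.tile E b
    to-injective {D} {E} h = Co.code-injective (Deogram.filling D) (Deogram.filling E)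
      (Trans-injective τ′-≈ (Of.trans′ D) (subst (Trans (Co.code (Deogram.filling E)) (Of.τ′ E) T.K) (sym (proj₁ same)) (Of.trans′ E)))
      where
      same : Of.c D ≡ Of.c E × (∀ b → Deogram.tile (Of.target D) b ≡ Deogram.tile (Of.target E) b)
      same = inject-injective (Of.c D) (Of.c E) (Of.balanced D) (Of.balanced E) h
      τ″-≈ : Of.τ″ D W′.≈[ T.K ] Of.τ″ E
      τ″-≈ = ≈-trans (W′.≈-sym (Of.code-target D)) (≈-trans
        (Co′.code-cong (Deogram.filling (Of.target D)) (Deogram.filling (Of.target E)) (proj₂ same)) (Of.code-target E))
      τ′-≈ : Of.τ′ D W.≈[ T.K ] Of.τ′ E
      τ′-≈ = ≈-prepend (Of.first D) (Of.first E) (≈-trans (Of.below D) (≈-trans (≈-init τ″-≈) (W′.≈-sym (Of.below E))))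

    to-surjective : ∀ y → ∃[ D ] (∀ {E} → (∀ b → Deogram.tile E b ≡ Deogram.tile D b) → to E ≈B y)
    to-surjective y = lift-image (inject-surjective y)
      where
      lift-image : (∃[ c ] Σ[ bal ∈ Balanced c ] Σ[ X ∈ Image c r ] inject c bal X ≈B y) →
        ∃[ D ] (∀ {E} → (∀ b → Deogram.tile E b ≡ Deogram.tile D b) → to E ≈B y)
      lift-image (c , bal , X , X≈y) = D , λ {E} h → Setoid.trans B (to-link E bal X (code-E {E} h) Tr ≈-refl forced ≈-refl) X≈y
        where
        τ″ : ℕ → Tile
        τ″ = Co′.code (Deogram.filling X)
        good-X : G′.Good T.K (elbowsLeft c r) (image c) (+ k) τ″
        good-X = Co′.good X
        forced : τ″ K₀ ≡ crossing
        forced = last-forced c good-X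
        backward : ∃ λ τ → Trans τ (prepend τ″) T.K c
        backward = Trans-backward pr₀ refl (prepend τ″) refl T.K c (λ e → contradiction e (ℕₚ.>⇒≢ 0<K))
        τ : ℕ → Tile
        τ = proj₁ backward
        Tr : Trans τ (prepend τ″) T.K c
        Tr = proj₂ backward
        D : Deogram r f P
        D = Co.deogram (Link.back Tr refl ≈-refl forced bal good-X)
        code-E : ∀ {E : Deogram r f P} → (∀ b → Deogram.tile E b ≡ Deogram.tile D b) → Co.code (Deogram.filling E) W.≈[ T.K ] τ
        code-E {E} h t t<K e = trans (Co.code-cong (Deogram.filling E) (Deogram.filling D) h t t<K e) (T.tileAt-fill τ t t<K e)

    bijection : Bijection (𝒜 r f P) B
    bijection = record { to = to ; cong = λ {D} {E} → to-cong {D} {E} ; bijective = (λ {D} {E} → to-injective {D} {E}) , to-surjective }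

module Final (n : ℕ) .{{nt : NonTrivial n}} {k : ℕ} (P : Periodic.𝒫 n k) (i : ℤ)
  (P-i : Periodic._⟦_⟧ n P i ≡ U) (P-1+i : Periodic._⟦_⟧ n P (1ℤ + i) ≡ R)
  (f : ℤ → ℤ) (f∈𝐁 : Periodic.𝐁 n k f) (sf∈𝐁 : Periodic.𝐁 n k (Periodic.s n i · f)) (fs≻f : Periodic._≻_ n (f · Periodic.s n i) f)
  (r : ℤ)
  where

  open Periodic n
  open Lengths n
  open Swaps n P i P-i P-1+i
  open Exchange n P i P-i P-1+i f f∈𝐁 sf∈𝐁 fs≻f
  open Correspondence n P i P-i P-1+i f f∈𝐁 sf∈𝐁 fs≻f

  bijection-< : s i · f ≺ f → Bijection (𝒜 r f P) (𝒜 r (s i · f · s i) P′)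
  bijection-< sf≺f = Assemble.bijection r B inject inject-cong inject-injective (λ y → crossing , (λ ()) , y , λ _ → refl)
    where
    B : Setoid _ _
    B = 𝒜 r (s i · f · s i) P′
    unbalanced : ∀ {A : Set} → Balanced elbow → A
    unbalanced bal = contradiction (left-descent {i} {f} affine sf≺f) (ℤₚ.<-asym (bal refl))
    inject : ∀ c → Balanced c → Image c r → Setoid.Carrier B
    inject crossing bal X = X
    inject elbow    bal X = unbalanced bal
    inject-cong : ∀ c (bal bal′ : Balanced c) {X Y : Image c r} → (∀ b → Deogram.tile X b ≡ Deogram.tile Y b) → Setoid._≈_ B (inject c bal X) (inject c bal′ Y)
    inject-cong crossing bal bal′ h = h
    inject-cong elbow    bal bal′ h = unbalanced bal
    inject-injective : ∀ c c′ (bal : Balanced c) (bal′ : Balanced c′) {X : Image c r} {Y : Image c′ r} →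
      Setoid._≈_ B (inject c bal X) (inject c′ bal′ Y) → c ≡ c′ × (∀ b → Deogram.tile X b ≡ Deogram.tile Y b)
    inject-injective crossing crossing bal bal′ h = refl , h
    inject-injective elbow    c′       bal bal′ h = unbalanced bal
    inject-injective crossing elbow    bal bal′ h = unbalanced bal′

  bijection-> : s i · f ≻ f → Bijection (𝒜 r f P) (𝒜 (r - 1ℤ) (f · s i) P′ ⊎ₛ 𝒜 r (s i · f · s i) P′)
  bijection-> sf≻f = Assemble.bijection r B inject inject-cong inject-injective surjective
    where
    B : Setoid _ _
    B = 𝒜 (r - 1ℤ) (f · s i) P′ ⊎ₛ 𝒜 r (s i · f · s i) P′
    inject : ∀ c → Balanced c → Image c r → Setoid.Carrier B
    inject elbow    _ X = inj₁ X
    inject crossing _ X = inj₂ X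
    inject-cong : ∀ c (bal bal′ : Balanced c) {X Y : Image c r} → (∀ b → Deogram.tile X b ≡ Deogram.tile Y b) → Setoid._≈_ B (inject c bal X) (inject c bal′ Y)
    inject-cong elbow    _ _ h = Pointwise.inj₁ h
    inject-cong crossing _ _ h = Pointwise.inj₂ h
    inject-injective : ∀ c c′ (bal : Balanced c) (bal′ : Balanced c′) {X : Image c r} {Y : Image c′ r} →
      Setoid._≈_ B (inject c bal X) (inject c′ bal′ Y) → c ≡ c′ × (∀ b → Deogram.tile X b ≡ Deogram.tile Y b)
    inject-injective elbow    elbow    _ _ (Pointwise.inj₁ h) = refl , h
    inject-injective crossing crossing _ _ (Pointwise.inj₂ h) = refl , h
    surjective : ∀ y → ∃[ c ] Σ[ bal ∈ Balanced c ] Σ[ X ∈ Image c r ] Setoid._≈_ B (inject c bal X) y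
    surjective (inj₁ X) = elbow , (λ _ → left-ascent {i} {f} affine sf≻f) , X , Setoid.refl B
    surjective (inj₂ X) = crossing , (λ ()) , X , Setoid.refl B

lemma3p25 : (n : ℕ) .{{_ : NonTrivial n}} (k : ℕ) → k ℕ.≤ n →
    let open Periodic n in
    (i : ℤ) → i ∈[n] →
    (f : ℤ → ℤ) → 𝐁 k f → 𝐁 k (s i · f) → 𝐁 k (f · s i) → 𝐁 k (s i · f · s i) →
    f · s i ≻ f →
    (P : 𝒫 k) → P ⟦ i ⟧ ≡ U → P ⟦ suc i ⟧ ≡ R →
    (r : ℤ) →
    (s i · f ≺ f → Bijection (𝒜 r f P) (𝒜 r (s i · f · s i) (swap i P)))
    × (s i · f ≻ f → Bijection (𝒜 r f P) (𝒜 (r - 1ℤ) (f · s i) (swap i P) ⊎ₛ 𝒜 r (s i · f · s i) (swap i P)))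
lemma3p25 n k _ i _ f f∈𝐁 sf∈𝐁 _ _ fs≻f P P-i P-1+i r =
  Final.bijection-< n P i P-i P-1+i f f∈𝐁 sf∈𝐁 fs≻f r , Final.bijection-> n P i P-i P-1+i f f∈𝐁 sf∈𝐁 fs≻f r
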